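{- For positive integers $n,i,j$ let $\mathrm{Magog}_n$ be the set of $n\times n$ magog matrices and $\mathrm{Magog}_n(i,j)$ the set of $n\times n$ magog matrices whose entry in row $i$, column $j$ equals $1$ (empty if $i>n$ or $j>n$). Then: (1) for all $n\ge 1$, $|\mathrm{Magog}_n(1,1)|=1$; (2) for all $n>1$, $|\mathrm{Magog}_n(n,1)|=|\mathrm{Magog}_n(n,2)|=|\mathrm{Magog}_{n-1}|=\prod_{j=0}^{n-2}\frac{(3j+1)!}{(n-1+j)!}$; (3) for all $n>1$, $|\mathrm{Magog}_n(1,n)|=|\mathrm{Magog}_n(1,n-1)|$; (4) for all $n\ge 1$, $|\mathrm{Magog}_n(2,1)|=\frac{1}{n+1}\binom{2n}{n}-1$; (5) for all $n\ge 1$, $|\mathrm{Magog}_n(1,2)|=2^{n-1}-1$.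
   Context: An $n\times n$ magog matrix is an $n\times n$ matrix $A=(a_{ij})$ with entries in $\{0,1,-1\}$ such that all row sums and all column sums equal $1$, $0\le \sum_{i'=1}^{i}a_{i'j}\le 1$ for all $1\le i,j\le n$, $\sum_{j'=1}^{j}a_{ij'}\ge 0$ for all $1\le i,j\le n$, and for all $1\le i\le n-2$, $1\le j\le n-2$, $$\sum_{j'=1}^{j}a_{i+1,j'}+\sum_{i'=1}^{i+1}a_{i',j+1}-\sum_{i'=1}^{i}a_{i'j}\ge 0.$$ -}

module Defs where

open import Data.Nat using (ℕ; zero; suc; _≤_; _+_; _*_; _∸_; _!)
open import Data.Integer as ℤ using (ℤ; 0ℤ; 1ℤ; -1ℤ)
open import Data.Vec using (Vec; []; _∷_; map)
open import Data.List using (List; length; upTo) renaming (map to lmap)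
open import Data.Nat.ListAction using (product)
open import Data.List.Relation.Unary.Unique.Propositional using (Unique)
open import Data.List.Membership.Propositional using (_∈_)
open import Data.Product using (Σ; _×_)
open import Data.Sum using (_⊎_)
open import Function.Bundles using (_⇔_)
open import Relation.Binary.PropositionalEquality using (_≡_)

-- 1-based lookup into a vector; 0 outside the range 1..n.
get : ∀ {n} → Vec ℤ n → ℕ → ℤ
get []       _                = 0ℤ
get (x ∷ xs) zero             = 0ℤ
get (x ∷ xs) (suc zero)       = x
get (x ∷ xs) (suc (suc k))    = get xs (suc k)

Matrix : ℕ → Set
Matrix n = Vec (Vec ℤ n) n

-- entry M i j = a_{ij} (1-based indices; 0 outside 1..n).
entry : ∀ {n} → Matrix n → ℕ → ℕ → ℤ
entry M i j = get (map (λ r → get r j) M) i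

sumTo : (ℕ → ℤ) → ℕ → ℤ
sumTo f zero    = 0ℤ
sumTo f (suc k) = sumTo f k ℤ.+ f (suc k)

record IsMagog (n : ℕ) (A : Matrix n) : Set where
  field
    entries  : ∀ i j → 1 ≤ i → i ≤ n → 1 ≤ j → j ≤ n →
               (entry A i j ≡ 0ℤ) ⊎ (entry A i j ≡ 1ℤ) ⊎ (entry A i j ≡ -1ℤ)
    rowSums  : ∀ i → 1 ≤ i → i ≤ n → sumTo (λ j → entry A i j) n ≡ 1ℤ
    colSums  : ∀ j → 1 ≤ j → j ≤ n → sumTo (λ i → entry A i j) n ≡ 1ℤ
    colPartial : ∀ i j → 1 ≤ i → i ≤ n → 1 ≤ j → j ≤ n →
               (0ℤ ℤ.≤ sumTo (λ i′ → entry A i′ j) i) × (sumTo (λ i′ → entry A i′ j) i ℤ.≤ 1ℤ)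
    rowPartial : ∀ i j → 1 ≤ i → i ≤ n → 1 ≤ j → j ≤ n →
               0ℤ ℤ.≤ sumTo (λ j′ → entry A i j′) j
    magogIneq : ∀ i j → 1 ≤ i → i + 2 ≤ n → 1 ≤ j → j + 2 ≤ n →
               0ℤ ℤ.≤ (sumTo (λ j′ → entry A (suc i) j′) j
                        ℤ.+ sumTo (λ i′ → entry A i′ (suc j)) (suc i)
                        ℤ.- sumTo (λ i′ → entry A i′ j) i)

MagogAt : (n i j : ℕ) → Matrix n → Set
MagogAt n i j A = IsMagog n A × (entry A i j ≡ 1ℤ)

HasCard : {A : Set} → (A → Set) → ℕ → Set
HasCard {A} P k = Σ (List A) (λ xs → Unique xs × (∀ x → (x ∈ xs) ⇔ P x) × (length xs ≡ k))

prodBelow : ℕ → (ℕ → ℕ) → ℕ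
prodBelow m f = product (lmap f (upTo m))

{-# OPTIONS --safe #-}
-- A magog matrix is determined by the rows at which its corner sums (first i rows, first j columns) reach k. Read
-- along the diagonals of fixed j − k, these rows describe n − 1 walkers on ℕ: in each unit of time a new walker
-- enters at the lowest position and then every walker stays or advances by one, all positions remaining distinct.
--
-- Put u = z + z² and let B f g = Σ sgn(r − s) f_r g_s for polynomials f, g in z. The walkers are counted by the
-- Pfaffian of the powers of u with respect to B: a unit of time multiplies every argument by 1 + z, and in the
-- multilinear expansion the collisions disappear because a Pfaffian with a repeated argument vanishes. To evaluate
-- the Pfaffian, its second argument u^q is replaced by a polynomial g in u that is B-orthogonal to all lower
-- powers, so that the expansion has a single term. The orthogonality of g to u^(i+1) − 2u^i is a hypergeometric
-- sum satisfying a first-order recurrence in i, which has a telescoping (Zeilberger) proof. The remaining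
-- orthogonality, to the lowest power of u, follows from B g g = 0: this leaves two possible values of B 1 g, one
-- of which would make the Pfaffian of one size less vanish.
--
-- The refined counts are read off the same walkers: the position of the 1 in the first column or row prescribes
-- how the first walker moves, or which walkers move at all.
module Submission where

open import Defs
open import Data.Nat using (ℕ; zero; suc; _+_; _*_; _∸_; _^_; _⊓_; _≤_; _<_; _>_; z≤n; s≤s; z<s; _≤?_; _<?_; _!)
open import Data.Nat.Combinatorics using (_C_; nCk+nC[k+1]≡[n+1]C[k+1]; nCk≡nC[n∸k]; nC1≡n)
open import Data.Nat.Combinatorics.Specification using (k>n⇒nCk≡0)
open import Data.Nat.Properties using (*-assoc; *-comm; *-distribˡ-+; *-identityʳ; *-identityˡ; *-suc;
  *-zeroʳ; +-assoc; +-cancelʳ-≡; +-cancelˡ-≡; +-comm; +-identityʳ; +-mono-≤; +-monoʳ-≤; +-monoˡ-≤; +-suc;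
  +-∸-assoc; 1+n≰n; <-trans; <-≤-connex; <⇒≤; <⇒≱; _≟_; m+[n∸m]≡n; m+n∸n≡m; m<n⇒0<n∸m; m<n⇒n≢0; m∸[m∸n]≡n;
  m∸n+n≡m; m∸n≤m; m≤m+n; m≤n+m; m≤n⇒m<n∨m≡n; m≤n⇒m≤1+n; m≤n⇒m⊓n≡m; m≥n⇒m⊓n≡n; m⊓n≤m; m⊓n≤n; n∸n≡0; n≢0⇒n>0;
  n≤1+n; n≮n; suc-injective; ∸-monoʳ-≤; ∸-monoˡ-≤; ≤-<-connex; ≤-antisym; ≤-pred; ≤-refl; ≤-reflexive;
  ≤-trans; ≤∧≢⇒<; ≮⇒≥; ≰⇒>; ⊓-glb)
open import Data.Nat.ListAction using (product)
open import Data.Nat.ListAction.Properties using (product-++)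
import Data.Nat.Tactic.RingSolver as ℕ-Solver
open import Data.Integer as ℤ using (ℤ; +_; -[1+_]; +[1+_]; 0ℤ; 1ℤ)
  renaming (_+_ to _+ᶻ_; _*_ to _*ᶻ_; _-_ to _−ᶻ_; -_ to -ᶻ_)
import Data.Integer.Properties as ℤP
open import Data.Integer.Tactic.RingSolver using (solve-∀)
open import Data.Bool using (Bool; true; false)
open import Data.List using (List; []; _∷_; _++_; length; map; concatMap; filter; applyUpTo; upTo; drop)
open import Data.List.Properties using (++-assoc; ++-identityʳ; length-++; length-map; length-applyUpTo;
  map-++; applyUpTo-∷ʳ; upTo-∷ʳ)
open import Data.List.Relation.Unary.All as All using (All; []; _∷_)
open import Data.List.Relation.Unary.Any using (here; there)
open import Data.List.Relation.Unary.AllPairs as AllPairs using (AllPairs; []; _∷_)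
import Data.List.Relation.Unary.AllPairs.Properties as AllPairs
open import Data.List.Relation.Unary.Linked as Linked using (Linked; []; [-]; _∷_)
import Data.List.Relation.Unary.Linked.Properties as Linked
open import Data.List.Relation.Unary.Unique.Propositional using (Unique)
import Data.List.Relation.Unary.Unique.Propositional.Properties as Unique
open import Data.List.Relation.Binary.Pointwise as Pointwise using (Pointwise; []; _∷_)
open import Data.List.Relation.Binary.Sublist.Propositional using (_⊆_; []; _∷_; _∷ʳ_; ⊆-refl)
open import Data.List.Relation.Binary.Sublist.Propositional.Properties using (All-resp-⊆)
open import Data.List.Membership.Propositional using (_∈_; find; lose)
open import Data.List.Membership.Propositional.Properties using (∈-∃++; ∈-++⁺ˡ; ∈-++⁺ʳ; ∈-++⁻; ∈-concatMap⁺;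
  ∈-concatMap⁻; ∈-map⁺; ∈-map⁻; ∈-filter⁺; ∈-filter⁻)
open import Data.Vec using (Vec; []; _∷_) renaming (map to vmap)
open import Data.Product using (Σ; ∃; _×_; _,_; proj₁; proj₂)
open import Data.Sum using (_⊎_; inj₁; inj₂; [_,_]′; swap)
open import Data.Unit using (⊤; tt)
open import Data.Empty using (⊥-elim)
open import Relation.Nullary using (¬_; Dec; yes; no; contradiction)
open import Relation.Nullary.Decidable using (isYes)
open import Function using (_∘_; id)
open import Function.Bundles using (mk⇔; Equivalence)
open import Relation.Binary.PropositionalEquality using (_≡_; _≢_; refl; sym; trans; cong; cong₂; subst;
  subst₂; module ≡-Reasoning)

-- Pfaffians of a skew form

-- The end positions of the walkers are free, so no single determinant counts them. A Pfaffian does: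
-- strictly decreasing exponents have pairwise sign 1, and then the Pfaffian is 1 whatever the end
-- positions are. A walker that enters at position j has j units of time left and contributes z^j (1
-- + z)^j = u^j. The 2 in u^(i+1) - 2u^i is the value of u at z = 1: the difference is divisible by
-- z - 1, and multiplication by z - 1 turns the sign kernel into a local one, so that only products
-- of equal coefficients remain, that is, binomial coefficients. The price is one unknown pairing B
-- 1 g, tied to the sum of the coefficients of g weighted by 2^j. That sum is never evaluated;
-- skewness alone leaves two cases, according to whether the power u^0 is kept or dropped. Since a
-- Pfaffian takes an even number of arguments, the right case depends on the parity of q. Hence the
-- recurrence joins the sizes q and q + 2, while the case is decided at size q + 1.

module Pfaffian {V : Set} (B : V → V → ℤ) (B-anti : ∀ f g → B f g ≡ -ᶻ B g f) where

  -- The interior product with `B f`: one entry is removed, with alternating signs. The function `Φ`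
  -- receives the remaining list, so that skipped entries can be stored in it during the recursion.
  contract : V → (List V → ℤ) → List V → ℤ
  contract f Φ []       = 0ℤ
  contract f Φ (g ∷ gs) = B f g *ᶻ Φ gs −ᶻ contract f (λ hs → Φ (g ∷ hs)) gs

  -- Expansion along the first row, with `k` the number of pairs. The value is 0 on every list whose
  -- length is not `2 * k`, so multilinearity and antisymmetry hold without conditions on lengths.
  Pf : ℕ → List V → ℤ
  Pf zero    []       = 1ℤ
  Pf zero    (_ ∷ _)  = 0ℤ
  Pf (suc k) []       = 0ℤ
  Pf (suc k) (f ∷ fs) = contract f (Pf k) fs

  contract-cong : ∀ f {Φ Ψ} fs → (∀ hs → Φ hs ≡ Ψ hs) → contract f Φ fs ≡ contract f Ψ fs
  contract-cong f []       e = refl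
  contract-cong f (g ∷ gs) e =
    cong₂ _−ᶻ_ (cong (B f g *ᶻ_) (e gs)) (contract-cong f gs (λ hs → e (g ∷ hs)))

  contract-lin : ∀ f a b {Φ Ψ} fs →
    contract f (λ hs → a *ᶻ Φ hs +ᶻ b *ᶻ Ψ hs) fs ≡ a *ᶻ contract f Φ fs +ᶻ b *ᶻ contract f Ψ fs
  contract-lin f a b []       = sym (cong₂ _+ᶻ_ (ℤP.*-zeroʳ a) (ℤP.*-zeroʳ b))
  contract-lin f a b {Φ} {Ψ} (g ∷ gs) = trans
    (cong (B f g *ᶻ (a *ᶻ Φ gs +ᶻ b *ᶻ Ψ gs) −ᶻ_) (contract-lin f a b gs))
    (rearrange (B f g) a b (Φ gs) (Ψ gs) _ _)
    where
    rearrange : ∀ x a b p q s t → x *ᶻ (a *ᶻ p +ᶻ b *ᶻ q) −ᶻ (a *ᶻ s +ᶻ b *ᶻ t)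
                                ≡ a *ᶻ (x *ᶻ p −ᶻ s) +ᶻ b *ᶻ (x *ᶻ q −ᶻ t)
    rearrange = solve-∀

  contract-neg : ∀ f {Φ} fs → contract f (λ hs → -ᶻ Φ hs) fs ≡ -ᶻ contract f Φ fs
  contract-neg f []           = refl
  contract-neg f {Φ} (g ∷ gs) = trans
    (cong (B f g *ᶻ (-ᶻ Φ gs) −ᶻ_) (contract-neg f gs)) (rearrange (B f g) (Φ gs) _)
    where
    rearrange : ∀ x p s → x *ᶻ (-ᶻ p) −ᶻ (-ᶻ s) ≡ -ᶻ (x *ᶻ p −ᶻ s)
    rearrange = solve-∀

  contract-0 : ∀ f fs → contract f (λ _ → 0ℤ) fs ≡ 0ℤ
  contract-0 f []       = refl
  contract-0 f (g ∷ gs) = cong₂ _−ᶻ_ (ℤP.*-zeroʳ (B f g)) (contract-0 f gs)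

  -- Interior products anticommute: removing one entry shifts the sign of the other removal. In the
  -- induction the two terms that remove the head `h` change places.
  contract-anticomm : ∀ f g Φ fs → contract f (contract g Φ) fs ≡ -ᶻ contract g (contract f Φ) fs
  contract-anticomm f g Φ []       = refl
  contract-anticomm f g Φ (h ∷ fs) = begin
    B f h *ᶻ contract g Φ fs −ᶻ contract f (λ hs → B g h *ᶻ Φ hs −ᶻ contract g Φh hs) fs
      ≡⟨ cong (B f h *ᶻ contract g Φ fs −ᶻ_) (split f g) ⟩
    B f h *ᶻ contract g Φ fs −ᶻ (B g h *ᶻ contract f Φ fs −ᶻ contract f (contract g Φh) fs)
      ≡⟨ cong (λ t → B f h *ᶻ contract g Φ fs −ᶻ (B g h *ᶻ contract f Φ fs −ᶻ t))
              (contract-anticomm f g Φh fs) ⟩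
    B f h *ᶻ contract g Φ fs −ᶻ (B g h *ᶻ contract f Φ fs −ᶻ (-ᶻ contract g (contract f Φh) fs))
      ≡⟨ rearrange (B f h *ᶻ contract g Φ fs) (B g h *ᶻ contract f Φ fs) _ ⟩
    -ᶻ (B g h *ᶻ contract f Φ fs −ᶻ (B f h *ᶻ contract g Φ fs −ᶻ contract g (contract f Φh) fs))
      ≡⟨ cong (λ t → -ᶻ (B g h *ᶻ contract f Φ fs −ᶻ t)) (split g f) ⟨
    -ᶻ (B g h *ᶻ contract f Φ fs −ᶻ contract g (λ hs → B f h *ᶻ Φ hs −ᶻ contract f Φh hs) fs) ∎
    where
    open ≡-Reasoning
    Φh : List V → ℤ
    Φh hs = Φ (h ∷ hs)
    norm : ∀ x p q → x *ᶻ p −ᶻ q ≡ x *ᶻ p +ᶻ ℤ.-1ℤ *ᶻ q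
    norm = solve-∀
    split : ∀ f g → contract f (λ hs → B g h *ᶻ Φ hs −ᶻ contract g Φh hs) fs
                  ≡ B g h *ᶻ contract f Φ fs −ᶻ contract f (contract g Φh) fs
    split f g = trans (contract-cong f fs (λ hs → norm (B g h) (Φ hs) (contract g Φh hs)))
      (trans (contract-lin f (B g h) ℤ.-1ℤ fs) (sym (norm (B g h) _ _)))
    rearrange : ∀ p q r → p −ᶻ (q −ᶻ (-ᶻ r)) ≡ -ᶻ (q −ᶻ (p −ᶻ r))
    rearrange = solve-∀

  Swaps : V → V → (List V → ℤ) → Set
  Swaps f g Φ = ∀ l r → Φ (l ++ f ∷ g ∷ r) ≡ -ᶻ Φ (l ++ g ∷ f ∷ r)

  contract-swaps : ∀ x {f g Φ} → Swaps f g Φ → Swaps f g (contract x Φ)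
  contract-swaps x {f} {g} {Φ} s [] r = begin
    p −ᶻ (q −ᶻ contract x (λ hs → Φ (f ∷ g ∷ hs)) r)
      ≡⟨ cong (λ t → p −ᶻ (q −ᶻ t)) (contract-cong x r (s [])) ⟩
    p −ᶻ (q −ᶻ contract x (λ hs → -ᶻ Φ (g ∷ f ∷ hs)) r)
      ≡⟨ cong (λ t → p −ᶻ (q −ᶻ t)) (contract-neg x r) ⟩
    p −ᶻ (q −ᶻ (-ᶻ contract x (λ hs → Φ (g ∷ f ∷ hs)) r))
      ≡⟨ rearrange p q _ ⟩
    -ᶻ (q −ᶻ (p −ᶻ contract x (λ hs → Φ (g ∷ f ∷ hs)) r)) ∎
    where
    open ≡-Reasoning
    p q : ℤ
    p = B x f *ᶻ Φ (g ∷ r)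
    q = B x g *ᶻ Φ (f ∷ r)
    rearrange : ∀ p q r → p −ᶻ (q −ᶻ (-ᶻ r)) ≡ -ᶻ (q −ᶻ (p −ᶻ r))
    rearrange = solve-∀
  contract-swaps x {f} {g} {Φ} s (y ∷ l) r = trans
    (cong₂ (λ a b → B x y *ᶻ a −ᶻ b) (s l r) (contract-swaps x (λ l′ → s (y ∷ l′)) l r))
    (rearrange (B x y) (Φ (l ++ g ∷ f ∷ r)) _)
    where
    rearrange : ∀ x p s → x *ᶻ (-ᶻ p) −ᶻ (-ᶻ s) ≡ -ᶻ (x *ᶻ p −ᶻ s)
    rearrange = solve-∀

  -- At the front, the term that pairs `f` with `g` is skew because `B` is, and the other terms form
  -- a double contraction, skew by `contract-anticomm`. Further inside, the property passes through
  -- `contract`.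
  Pf-swap : ∀ k f g → Swaps f g (Pf k)
  Pf-swap zero    f g []      r = refl
  Pf-swap zero    f g (_ ∷ _) r = refl
  Pf-swap (suc k) f g []      r = trans
    (cong₂ (λ a b → a *ᶻ Pf k r −ᶻ b) (B-anti f g) (crossed k))
    (rearrange (B g f) (Pf k r) _)
    where
    crossed : ∀ k → contract f (λ hs → Pf k (g ∷ hs)) r ≡ -ᶻ contract g (λ hs → Pf k (f ∷ hs)) r
    crossed zero    = trans (contract-0 f r) (sym (cong -ᶻ_ (contract-0 g r)))
    crossed (suc k) = contract-anticomm f g (Pf k) r
    rearrange : ∀ x p s → (-ᶻ x) *ᶻ p −ᶻ (-ᶻ s) ≡ -ᶻ (x *ᶻ p −ᶻ s)
    rearrange = solve-∀
  Pf-swap (suc k) f g (x ∷ l) r = contract-swaps x (Pf-swap k f g) l r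

  negate-self : ∀ {x} → x ≡ -ᶻ x → x ≡ 0ℤ
  negate-self {+ zero}   e = refl
  negate-self {+[1+ _ ]}  ()
  negate-self { -[1+ _ ]}  ()

  Pf-repeat : ∀ k f l r → Pf k (l ++ f ∷ f ∷ r) ≡ 0ℤ
  Pf-repeat k f l r = negate-self (Pf-swap k f f l r)

  Pf-repeat-apart : ∀ k f l m r → Pf k (l ++ f ∷ m ++ f ∷ r) ≡ 0ℤ
  Pf-repeat-apart k f l []      r = Pf-repeat k f l r
  Pf-repeat-apart k f l (x ∷ m) r = trans (Pf-swap k f x l (m ++ f ∷ r))
    (cong -ᶻ_ (trans (cong (Pf k) (sym (++-assoc l (x ∷ []) (f ∷ m ++ f ∷ r))))
      (Pf-repeat-apart k f (l ++ x ∷ []) m r)))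
    where open import Data.List.Properties using (++-assoc)

  -- A Pfaffian sees its arguments only through `B`, so a linear relation is only required there.
  -- Equality would be too strict for unreduced formal sums.
  record Combination (h : V) (a : ℤ) (f : V) (b : ℤ) (g : V) : Set where
    constructor combination
    field expand : ∀ v → B h v ≡ a *ᶻ B f v +ᶻ b *ᶻ B g v
  open Combination

  LinearOn : V → ℤ → V → ℤ → V → (List V → ℤ) → Set
  LinearOn h a f b g Φ = ∀ l r → Φ (l ++ h ∷ r) ≡ a *ᶻ Φ (l ++ f ∷ r) +ᶻ b *ᶻ Φ (l ++ g ∷ r)

  combine-right : ∀ {h a f b g} → Combination h a f b g → ∀ x → B x h ≡ a *ᶻ B x f +ᶻ b *ᶻ B x g
  combine-right {h} {a} {f} {b} {g} c x = begin
    B x h                                     ≡⟨ B-anti x h ⟩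
    -ᶻ B h x                                  ≡⟨ cong -ᶻ_ (expand c x) ⟩
    -ᶻ (a *ᶻ B f x +ᶻ b *ᶻ B g x)             ≡⟨ rearrange a (B f x) b (B g x) ⟩
    a *ᶻ (-ᶻ B f x) +ᶻ b *ᶻ (-ᶻ B g x)        ≡⟨ cong₂ (λ s t → a *ᶻ s +ᶻ b *ᶻ t) (B-anti x f) (B-anti x g) ⟨
    a *ᶻ B x f +ᶻ b *ᶻ B x g                  ∎
    where
    open ≡-Reasoning
    rearrange : ∀ a p b q → -ᶻ (a *ᶻ p +ᶻ b *ᶻ q) ≡ a *ᶻ (-ᶻ p) +ᶻ b *ᶻ (-ᶻ q)
    rearrange = solve-∀

  private
    rearr : ∀ a b p s t x y → (a *ᶻ x +ᶻ b *ᶻ y) *ᶻ p −ᶻ (a *ᶻ s +ᶻ b *ᶻ t)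
                            ≡ a *ᶻ (x *ᶻ p −ᶻ s) +ᶻ b *ᶻ (y *ᶻ p −ᶻ t)
    rearr = solve-∀

  contract-linear : ∀ x {h a f b g} Φ → Combination h a f b g →
    LinearOn h a f b g Φ → LinearOn h a f b g (contract x Φ)
  contract-linear x {h} {a} {f} {b} {g} Φ c lin [] r = trans
    (cong₂ (λ s t → s *ᶻ Φ r −ᶻ t) (combine-right c x)
      (trans (contract-cong x r (lin [])) (contract-lin x a b r)))
    (rearr a b (Φ r) _ _ (B x f) (B x g))
  contract-linear x {h} {a} {f} {b} {g} Φ c lin (y ∷ l) r = trans
    (cong₂ (λ s t → B x y *ᶻ s −ᶻ t) (lin l r) (contract-linear x (λ hs → Φ (y ∷ hs)) c (λ l′ → lin (y ∷ l′)) l r))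
    (rearrange (B x y) a b _ _ _ _)
    where
    rearrange : ∀ x a b p q s t → x *ᶻ (a *ᶻ p +ᶻ b *ᶻ q) −ᶻ (a *ᶻ s +ᶻ b *ᶻ t)
                                ≡ a *ᶻ (x *ᶻ p −ᶻ s) +ᶻ b *ᶻ (x *ᶻ q −ᶻ t)
    rearrange = solve-∀

  contract-combination : ∀ {h a f b g} Φ fs → Combination h a f b g →
    contract h Φ fs ≡ a *ᶻ contract f Φ fs +ᶻ b *ᶻ contract g Φ fs
  contract-combination {a = a} {b = b} Φ [] c = sym (cong₂ _+ᶻ_ (ℤP.*-zeroʳ a) (ℤP.*-zeroʳ b))
  contract-combination {h} {a} {f} {b} {g} Φ (x ∷ fs) c = trans
    (cong₂ (λ s t → s *ᶻ Φ fs −ᶻ t) (expand c x) (contract-combination (λ hs → Φ (x ∷ hs)) fs c))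
    (rearr a b (Φ fs) _ _ (B f x) (B g x))

  Pf-linear : ∀ k {h a f b g} → Combination h a f b g → LinearOn h a f b g (Pf k)
  Pf-linear zero {a = a} {b = b} c [] r      = sym (cong₂ _+ᶻ_ (ℤP.*-zeroʳ a) (ℤP.*-zeroʳ b))
  Pf-linear zero {a = a} {b = b} c (_ ∷ _) r = sym (cong₂ _+ᶻ_ (ℤP.*-zeroʳ a) (ℤP.*-zeroʳ b))
  Pf-linear (suc k) c []      r = contract-combination (Pf k) r c
  Pf-linear (suc k) c (x ∷ l) r = contract-linear x (Pf k) c (Pf-linear k c) l r

  alternating : ℕ → ℤ
  alternating zero    = 0ℤ
  alternating (suc n) = 1ℤ −ᶻ alternating n

  contract-ones : ∀ f Φ fs → All (λ g → B f g ≡ 1ℤ) fs →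
    (∀ hs → hs ⊆ fs → suc (length hs) ≡ length fs → Φ hs ≡ 1ℤ) →
    contract f Φ fs ≡ alternating (length fs)
  contract-ones f Φ []       _        _    = refl
  contract-ones f Φ (g ∷ gs) (b ∷ bs) ones = cong₂ _−ᶻ_
    (cong₂ _*ᶻ_ b (ones gs (g ∷ʳ ⊆-refl) refl))
    (contract-ones f (λ hs → Φ (g ∷ hs)) gs bs
      (λ hs s e → ones (g ∷ hs) (refl ∷ s) (cong suc e)))

  alternating-odd : ∀ k → alternating (suc (2 * k)) ≡ 1ℤ
  alternating-odd zero    = refl
  alternating-odd (suc k) = trans (cong (λ n → alternating (suc n)) (*-suc 2 k))
    (cong (λ t → 1ℤ −ᶻ (1ℤ −ᶻ t)) (alternating-odd k))

  AllPairs-⊆ : ∀ {R : V → V → Set} {hs gs} → hs ⊆ gs → AllPairs R gs → AllPairs R hs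
  AllPairs-⊆ []         p        = p
  AllPairs-⊆ (_ ∷ʳ s)   (_ ∷ p)  = AllPairs-⊆ s p
  AllPairs-⊆ (refl ∷ s) (a ∷ p)  = All-resp-⊆ s a ∷ AllPairs-⊆ s p

  -- The expansion is an alternating sum of an odd number of ones. This makes every final
  -- configuration of the walkers count exactly once.
  Pf-ones : ∀ k fs → AllPairs (λ f g → B f g ≡ 1ℤ) fs → length fs ≡ 2 * k → Pf k fs ≡ 1ℤ
  Pf-ones zero    []       _       _  = refl
  Pf-ones (suc k) (f ∷ fs) (a ∷ p) e  = trans
    (contract-ones f (Pf k) fs a (λ hs s e′ → Pf-ones k hs (AllPairs-⊆ s p)
      (suc-injective (trans e′ len))))
    (trans (cong alternating len) (alternating-odd k))
    where
    len : length fs ≡ suc (2 * k)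
    len = suc-injective (trans e (*-suc 2 k))

-- Formal sums of pairs (coefficient, exponent)

LPoly : Set
LPoly = List (ℤ × ℕ)

-- The linear functional that sends `z^r` to `φ r`; nesting it twice gives bilinear pairings.
ev : (ℕ → ℤ) → LPoly → ℤ
ev φ []            = 0ℤ
ev φ ((c , r) ∷ f) = c *ᶻ φ r +ᶻ ev φ f

ev-cong : ∀ {φ ψ} f → (∀ r → φ r ≡ ψ r) → ev φ f ≡ ev ψ f
ev-cong []            e = refl
ev-cong ((c , r) ∷ f) e = cong₂ (λ x y → c *ᶻ x +ᶻ y) (e r) (ev-cong f e)

ev-++ : ∀ φ f g → ev φ (f ++ g) ≡ ev φ f +ᶻ ev φ g
ev-++ φ []            g = sym (ℤP.+-identityˡ _)
ev-++ φ ((c , r) ∷ f) g = trans (cong (c *ᶻ φ r +ᶻ_) (ev-++ φ f g))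
  (sym (ℤP.+-assoc (c *ᶻ φ r) (ev φ f) (ev φ g)))

ev-0 : ∀ f → ev (λ _ → 0ℤ) f ≡ 0ℤ
ev-0 []            = refl
ev-0 ((c , r) ∷ f) = cong₂ _+ᶻ_ (ℤP.*-zeroʳ c) (ev-0 f)

ev-lin : ∀ a b φ ψ f → ev (λ r → a *ᶻ φ r +ᶻ b *ᶻ ψ r) f ≡ a *ᶻ ev φ f +ᶻ b *ᶻ ev ψ f
ev-lin a b φ ψ []            = sym (cong₂ _+ᶻ_ (ℤP.*-zeroʳ a) (ℤP.*-zeroʳ b))
ev-lin a b φ ψ ((c , r) ∷ f) = trans (cong (c *ᶻ (a *ᶻ φ r +ᶻ b *ᶻ ψ r) +ᶻ_) (ev-lin a b φ ψ f))
  (rearrange c a b (φ r) (ψ r) (ev φ f) (ev ψ f))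
  where
  rearrange : ∀ c a b p q s t → c *ᶻ (a *ᶻ p +ᶻ b *ᶻ q) +ᶻ (a *ᶻ s +ᶻ b *ᶻ t)
                              ≡ a *ᶻ (c *ᶻ p +ᶻ s) +ᶻ b *ᶻ (c *ᶻ q +ᶻ t)
  rearrange = solve-∀

scale : ℤ → LPoly → LPoly
scale a = map (λ (c , r) → a *ᶻ c , r)

ev-scale : ∀ φ a f → ev φ (scale a f) ≡ a *ᶻ ev φ f
ev-scale φ a []            = sym (ℤP.*-zeroʳ a)
ev-scale φ a ((c , r) ∷ f) = trans (cong (a *ᶻ c *ᶻ φ r +ᶻ_) (ev-scale φ a f))
  (rearrange a c (φ r) (ev φ f))
  where
  rearrange : ∀ a c p s → a *ᶻ c *ᶻ p +ᶻ a *ᶻ s ≡ a *ᶻ (c *ᶻ p +ᶻ s)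
  rearrange = solve-∀

pair : (ℕ → ℕ → ℤ) → LPoly → LPoly → ℤ
pair κ f g = ev (λ r → ev (κ r) g) f

pair-swap : ∀ κ f g → pair κ f g ≡ pair (λ s r → κ r s) g f
pair-swap κ []            g = sym (ev-0 g)
pair-swap κ ((c , r) ∷ f) g = begin
  c *ᶻ ev (κ r) g +ᶻ pair κ f g                         ≡⟨ cong (c *ᶻ ev (κ r) g +ᶻ_) (pair-swap κ f g) ⟩
  c *ᶻ ev (κ r) g +ᶻ pair (λ s r → κ r s) g f           ≡⟨ cong (c *ᶻ ev (κ r) g +ᶻ_) (ℤP.*-identityˡ _) ⟨
  c *ᶻ ev (κ r) g +ᶻ 1ℤ *ᶻ pair (λ s r → κ r s) g f     ≡⟨ ev-lin c 1ℤ (κ r) _ g ⟨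
  ev (λ s → c *ᶻ κ r s +ᶻ 1ℤ *ᶻ ev (λ r → κ r s) f) g   ≡⟨ ev-cong g
      (λ s → cong (c *ᶻ κ r s +ᶻ_) (ℤP.*-identityˡ _)) ⟩
  pair (λ s r → κ r s) g ((c , r) ∷ f)                  ∎
  where open ≡-Reasoning

sg : ℕ → ℕ → ℤ
sg zero    zero    = 0ℤ
sg zero    (suc s) = ℤ.-1ℤ
sg (suc r) zero    = 1ℤ
sg (suc r) (suc s) = sg r s

sg-anti : ∀ r s → sg r s ≡ -ᶻ sg s r
sg-anti zero    zero    = refl
sg-anti zero    (suc s) = refl
sg-anti (suc r) zero    = refl
sg-anti (suc r) (suc s) = sg-anti r s

sg-> : ∀ {r s} → r > s → sg r s ≡ 1ℤ
sg-> {suc r} {zero}  _       = refl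
sg-> {suc r} {suc s} (s≤s p) = sg-> p

B : LPoly → LPoly → ℤ
B = pair sg

B-anti : ∀ f g → B f g ≡ -ᶻ B g f
B-anti f g = begin
  pair sg f g                                     ≡⟨ pair-swap sg f g ⟩
  pair (λ s r → sg r s) g f                       ≡⟨ ev-cong g
      (λ s → trans (ev-cong f (λ r → trans (sg-anti r s) (minus (sg s r)))) (ev-lin ℤ.-1ℤ 0ℤ (sg s) (sg s) f)) ⟩
  ev (λ s → ℤ.-1ℤ *ᶻ ev (sg s) f +ᶻ 0ℤ *ᶻ ev (sg s) f) g  ≡⟨ ev-lin ℤ.-1ℤ 0ℤ _ (λ s → ev (sg s) f) g ⟩
  ℤ.-1ℤ *ᶻ B g f +ᶻ 0ℤ *ᶻ B g f                   ≡⟨ minus (B g f) ⟨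
  -ᶻ B g f                                        ∎
  where
  open ≡-Reasoning
  minus : ∀ x → -ᶻ x ≡ ℤ.-1ℤ *ᶻ x +ᶻ 0ℤ *ᶻ x
  minus = solve-∀

open Pfaffian B B-anti
open Combination

-- z^a (1 + z)^m
pw : ℕ → ℕ → LPoly
pw a zero    = (1ℤ , a) ∷ []
pw a (suc m) = pw a m ++ pw (suc a) m

unit-combination : ∀ x y → 1ℤ *ᶻ x +ᶻ 1ℤ *ᶻ y ≡ x +ᶻ y
unit-combination = solve-∀

pw-suc : ∀ a m → Combination (pw a (suc m)) 1ℤ (pw a m) 1ℤ (pw (suc a) m)
pw-suc a m = combination λ v → trans (ev-++ _ (pw a m) (pw (suc a) m))
  (sym (unit-combination (B (pw a m) v) (B (pw (suc a) m) v)))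

sumL : ∀ {A : Set} → (A → ℤ) → List A → ℤ
sumL f []       = 0ℤ
sumL f (x ∷ xs) = f x +ᶻ sumL f xs

sumL-++ : ∀ {A : Set} (f : A → ℤ) xs ys → sumL f (xs ++ ys) ≡ sumL f xs +ᶻ sumL f ys
sumL-++ f []       ys = sym (ℤP.+-identityˡ _)
sumL-++ f (x ∷ xs) ys = trans (cong (f x +ᶻ_) (sumL-++ f xs ys)) (sym (ℤP.+-assoc (f x) _ _))

sumL-concatMap : ∀ {A C : Set} (f : C → ℤ) (g : A → List C) xs →
  sumL f (concatMap g xs) ≡ sumL (λ x → sumL f (g x)) xs
sumL-concatMap f g []       = refl
sumL-concatMap f g (x ∷ xs) = trans (sumL-++ f (g x) _) (cong (sumL f (g x) +ᶻ_) (sumL-concatMap f g xs))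

sumL-cong : ∀ {A : Set} {f g : A → ℤ} xs → (∀ {x} → x ∈ xs → f x ≡ g x) → sumL f xs ≡ sumL g xs
sumL-cong []       e = refl
sumL-cong (x ∷ xs) e = cong₂ _+ᶻ_ (e (here refl)) (sumL-cong xs (λ i → e (there i)))

sumL-+ : ∀ {A : Set} (f g : A → ℤ) xs → sumL (λ x → f x +ᶻ g x) xs ≡ sumL f xs +ᶻ sumL g xs
sumL-+ f g []       = refl
sumL-+ f g (x ∷ xs) = trans (cong (f x +ᶻ g x +ᶻ_) (sumL-+ f g xs)) (rearrange (f x) (g x) _ _)
  where
  rearrange : ∀ a b s t → a +ᶻ b +ᶻ (s +ᶻ t) ≡ (a +ᶻ s) +ᶻ (b +ᶻ t)
  rearrange = solve-∀

length-sum : ∀ {A C : Set} (g : A → List C) xs → + length (concatMap g xs) ≡ sumL (λ x → + length (g x)) xs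
length-sum g []       = refl
length-sum g (x ∷ xs) = trans (cong +_ (length-++ (g x))) (cong (+ length (g x) +ᶻ_) (length-sum g xs))

-- Non-colliding walkers, listed by decreasing position; in one unit of time each stays or advances by one.

Desc : List ℕ → Set
Desc = Linked _>_

Step : ℕ → ℕ → Set
Step x y = y ≡ x ⊎ y ≡ suc x

headIs? : (x : ℕ) (bs : List ℕ) → Dec (∃ λ r → bs ≡ x ∷ r)
headIs? x []       = no λ ()
headIs? x (b ∷ bs) with b ≟ x
... | yes refl = yes (bs , refl)
... | no  b≢x  = no λ { (_ , refl) → b≢x refl }

-- The lower walkers `bs` have already moved; if the nearest of them now occupies `x`, the walker at
-- `x` has to advance.
extend : ℕ → List ℕ → List (List ℕ)
extend x bs with headIs? x bs
... | yes _ = (suc x ∷ bs) ∷ []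
... | no  _ = (x ∷ bs) ∷ (suc x ∷ bs) ∷ []

moves : List ℕ → List (List ℕ)
moves []       = [] ∷ []
moves (x ∷ as) = concatMap (extend x) (moves as)

desc-∷ : ∀ {y b bs} → Desc (b ∷ bs) → y > b → Desc (y ∷ b ∷ bs)
desc-∷ d p = p ∷ d

moves-sound : ∀ a {b} → Desc a → b ∈ moves a → Pointwise Step a b × Desc b
moves-sound []       d (here refl) = [] , []
moves-sound (x ∷ as) d b∈ with find (∈-concatMap⁻ (extend x) {xs = moves as} b∈)
... | bs , bs∈ , b∈e with moves-sound as (Linked.tail d) bs∈ | headIs? x bs
moves-sound (x ∷ []) d b∈ | [] , bs∈ , here refl | [] , _ | no _ = inj₁ refl ∷ [] , [-]
moves-sound (x ∷ []) d b∈ | [] , bs∈ , there (here refl) | [] , _ | no _ = inj₂ refl ∷ [] , [-]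
moves-sound (x ∷ a ∷ as) (x>a ∷ d) b∈ | (y ∷ bs) , bs∈ , here refl | (p ∷ ps) , d′ | yes (_ , refl) =
  inj₂ refl ∷ p ∷ ps , desc-∷ d′ ≤-refl
moves-sound (x ∷ a ∷ as) (x>a ∷ d) b∈ | (y ∷ bs) , bs∈ , here refl | (p ∷ ps) , d′ | no ¬h =
  inj₁ refl ∷ p ∷ ps , desc-∷ d′ (≤∧≢⇒< (below p x>a) λ { refl → ¬h (_ , refl) })
  where
  below : ∀ {a y x} → Step a y → x > a → y ≤ x
  below (inj₁ refl) q = <⇒≤ q
  below (inj₂ refl) q = q
moves-sound (x ∷ a ∷ as) (x>a ∷ d) b∈ | (y ∷ bs) , bs∈ , there (here refl) | (p ∷ ps) , d′ | no ¬h =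
  inj₂ refl ∷ p ∷ ps , desc-∷ d′ (s≤s (below p x>a))
  where
  below : ∀ {a y x} → Step a y → x > a → y ≤ x
  below (inj₁ refl) q = <⇒≤ q
  below (inj₂ refl) q = q

moves-complete : ∀ a {b} → Pointwise Step a b → Desc b → b ∈ moves a
moves-complete []       []       d = here refl
moves-complete (x ∷ as) {y ∷ bs} (p ∷ ps) d =
  ∈-concatMap⁺ (extend x) {xs = moves as} (lose (moves-complete as ps (Linked.tail d)) (member p d))
  where
  member : ∀ {y bs} → Step x y → Desc (y ∷ bs) → (y ∷ bs) ∈ extend x bs
  member {bs = bs} st d with headIs? x bs
  member (inj₁ refl) (x>x ∷ _) | yes (_ , refl) = ⊥-elim (n≮n _ x>x)
  member (inj₂ refl) d         | yes _ = here refl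
  member (inj₁ refl) d         | no _  = here refl
  member (inj₂ refl) d         | no _  = there (here refl)

-- Walkers i, i − 1, …, 1 still have to enter; walker j enters at position j.
walks : ℕ → List ℕ → List (List (List ℕ))
walks zero    a = [] ∷ []
walks (suc i) a = concatMap (λ b → map (b ∷_) (walks i b)) (moves (a ++ suc i ∷ []))

Multilinear : (List LPoly → ℤ) → Set
Multilinear Φ = ∀ {h a f b g} → Combination h a f b g → LinearOn h a f b g Φ

VanishesOnRepeats : (List LPoly → ℤ) → Set
VanishesOnRepeats Φ = ∀ f l r → Φ (l ++ f ∷ f ∷ r) ≡ 0ℤ

expand-step : ∀ m a t Φ → Multilinear Φ → VanishesOnRepeats Φ →
  Φ (map (λ x → pw x (suc m)) a ++ t) ≡ sumL (λ b → Φ (map (λ x → pw x m) b ++ t)) (moves a)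
expand-step m []       t Φ lin rep = sym (ℤP.+-identityʳ _)
expand-step m (x ∷ as) t Φ lin rep = begin
  Φ (pw x (suc m) ∷ rest)
    ≡⟨ lin (pw-suc x m) [] rest ⟩
  1ℤ *ᶻ Φ (pw x m ∷ rest) +ᶻ 1ℤ *ᶻ Φ (pw (suc x) m ∷ rest)
    ≡⟨ unit-combination (Φ (pw x m ∷ rest)) (Φ (pw (suc x) m ∷ rest)) ⟩
  Φ (pw x m ∷ rest) +ᶻ Φ (pw (suc x) m ∷ rest)
    ≡⟨ cong₂ _+ᶻ_ (rec x) (rec (suc x)) ⟩
  sumL (term x) (moves as) +ᶻ sumL (term (suc x)) (moves as)
    ≡⟨ sumL-+ (term x) (term (suc x)) (moves as) ⟨
  sumL (λ b → term x b +ᶻ term (suc x) b) (moves as)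
    ≡⟨ sumL-cong (moves as) (λ {b} _ → collect b) ⟩
  sumL (λ b → sumL Ψ (extend x b)) (moves as)
    ≡⟨ sumL-concatMap Ψ (extend x) (moves as) ⟨
  sumL Ψ (moves (x ∷ as)) ∎
  where
  open ≡-Reasoning
  rest : List LPoly
  rest = map (λ x → pw x (suc m)) as ++ t
  Ψ : List ℕ → ℤ
  Ψ b = Φ (map (λ x → pw x m) b ++ t)
  term : ℕ → List ℕ → ℤ
  term y b = Ψ (y ∷ b)
  rec : ∀ y → Φ (pw y m ∷ rest) ≡ sumL (term y) (moves as)
  rec y = expand-step m as t (λ hs → Φ (pw y m ∷ hs))
    (λ c l r → lin c (pw y m ∷ l) r) (λ f l r → rep f (pw y m ∷ l) r)
  collect : ∀ b → term x b +ᶻ term (suc x) b ≡ sumL Ψ (extend x b)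
  collect b with headIs? x b
  -- The missing move would leave the walker at `x` next to another one at `x`: two adjacent equal
  -- arguments.
  ... | yes (r , refl) = trans (cong (_+ᶻ term (suc x) b) (rep (pw x m) [] (map (λ x → pw x m) r ++ t)))
                           (trans (ℤP.+-identityˡ (term (suc x) b)) (sym (ℤP.+-identityʳ (term (suc x) b))))
  ... | no _           = cong (term x b +ᶻ_) (sym (ℤP.+-identityʳ _))

-- The walker entering at position `j` has exactly `j` units of time left, hence the argument
-- `z^j (1 + z)^j`.
pending : List LPoly → ℕ → List LPoly
pending e zero    = e
pending e (suc i) = pw (suc i) (suc i) ∷ pending e i

-- With an odd number of walkers, the constant 1 completes the arguments to an even number. It acts
-- as a walker resting at position 0, below all the others.
data Padding : List LPoly → Set where
  unpadded : Padding []
  padded   : Padding (pw 0 0 ∷ [])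

∷ʳ-> : ∀ {i} a → Desc (a ++ suc i ∷ []) → All (_> i) (a ++ suc i ∷ [])
∷ʳ-> []       d           = ≤-refl ∷ []
∷ʳ-> (x ∷ []) (p ∷ d)     = <-trans ≤-refl p ∷ ≤-refl ∷ []
∷ʳ-> (x ∷ y ∷ a) (p ∷ d) with ∷ʳ-> (y ∷ a) d
... | q ∷ qs = <-trans q p ∷ q ∷ qs

step-> : ∀ {i a b} → Pointwise Step a b → All (_> i) a → All (_> i) b
step-> []                []       = []
step-> (inj₁ refl ∷ ps)  (q ∷ qs) = q ∷ step-> ps qs
step-> (inj₂ refl ∷ ps)  (q ∷ qs) = m≤n⇒m≤1+n q ∷ step-> ps qs

desc-∷ʳ : ∀ {i} a → Desc a → All (_> i) a → Desc (a ++ i ∷ [])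
desc-∷ʳ []          d       []       = [-]
desc-∷ʳ (x ∷ [])    d       (q ∷ []) = q ∷ [-]
desc-∷ʳ (x ∷ y ∷ a) (p ∷ d) (q ∷ qs) = p ∷ desc-∷ʳ (y ∷ a) d qs

-- A walker at `x` with `i` units of time left stands for `z^x (1 + z)^i`. The bound `All (_> i) a`
-- makes room for the next walker, which enters at `i`, and at the end keeps position 0 free for the
-- padding.
walks-Pf : ∀ i k a {e} → Padding e → Desc a → All (_> i) a → length a + (i + length e) ≡ 2 * k →
  + length (walks i a) ≡ Pf k (map (λ x → pw x i) a ++ pending e i)
walks-Pf zero k a {e} pad d pos len = sym (Pf-ones k _ (pairs pad)
    (trans (length-++ (map _ a)) (trans (cong (_+ length e) (length-map _ a)) len)))
  where
  mono : ∀ {r s} → r > s → B (pw r 0) (pw s 0) ≡ 1ℤ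
  mono {r} {s} r>s rewrite sg-> r>s = refl
  pairs : ∀ {e} → Padding e → AllPairs (λ f g → B f g ≡ 1ℤ) (map (λ x → pw x 0) a ++ e)
  pairs unpadded = subst (AllPairs _) (sym (++-identityʳ _))
    (AllPairs.map⁺ (AllPairs.map mono (Linked.Linked⇒AllPairs (λ p q → <-trans q p) d)))
  pairs padded = subst (AllPairs _) (map-++ (λ x → pw x 0) a (0 ∷ []))
    (AllPairs.map⁺ (AllPairs.map mono (Linked.Linked⇒AllPairs (λ p q → <-trans q p) (desc-∷ʳ a d pos))))
walks-Pf (suc i) k a {e} pad d pos len = begin
  + length (walks (suc i) a)
    ≡⟨ length-sum (λ b → map (b ∷_) (walks i b)) (moves a′) ⟩
  sumL (λ b → + length (map (b ∷_) (walks i b))) (moves a′)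
    ≡⟨ sumL-cong (moves a′) (λ {b} b∈ → trans (cong +_ (length-map (b ∷_) (walks i b))) (rec b∈)) ⟩
  sumL (λ b → Pf k (map (λ x → pw x i) b ++ pending e i)) (moves a′)
    ≡⟨ expand-step i a′ (pending e i) (Pf k) (Pf-linear k) (Pf-repeat k) ⟨
  Pf k (map (λ x → pw x (suc i)) a′ ++ pending e i)
    ≡⟨ cong (λ l → Pf k (l ++ pending e i)) (map-++ _ a (suc i ∷ [])) ⟩
  Pf k ((map (λ x → pw x (suc i)) a ++ pw (suc i) (suc i) ∷ []) ++ pending e i)
    ≡⟨ cong (Pf k) (++-assoc (map (λ x → pw x (suc i)) a) _ _) ⟩
  Pf k (map (λ x → pw x (suc i)) a ++ pending e (suc i)) ∎
  where
  open ≡-Reasoning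
  a′ : List ℕ
  a′ = a ++ suc i ∷ []
  d′ : Desc a′
  d′ = desc-∷ʳ a d pos
  rec : ∀ {b} → b ∈ moves a′ → + length (walks i b) ≡ Pf k (map (λ x → pw x i) b ++ pending e i)
  rec {b} b∈ with moves-sound a′ d′ b∈
  ... | ps , db = walks-Pf i k b pad db (step-> ps (∷ʳ-> a d′)) (begin
    length b + (i + length e)         ≡⟨ cong (_+ _) (Pointwise.Pointwise-length ps) ⟨
    length a′ + (i + length e)        ≡⟨ cong (_+ _) (length-++ a) ⟩
    length a + 1 + (i + length e)     ≡⟨ +-assoc (length a) 1 _ ⟩
    length a + (suc i + length e)     ≡⟨ len ⟩
    2 * k                             ∎)

-- Evaluation of the Pfaffian

sumBelow : (ℕ → ℤ) → ℕ → ℤ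
sumBelow f zero    = 0ℤ
sumBelow f (suc n) = sumBelow f n +ᶻ f n

sumBelow-cong : ∀ {f g} n → (∀ j → j < n → f j ≡ g j) → sumBelow f n ≡ sumBelow g n
sumBelow-cong zero    e = refl
sumBelow-cong (suc n) e = cong₂ _+ᶻ_ (sumBelow-cong n (λ j p → e j (m≤n⇒m≤1+n p))) (e n ≤-refl)

sumBelow-lin : ∀ a b (f g : ℕ → ℤ) n → sumBelow (λ j → a *ᶻ f j +ᶻ b *ᶻ g j) n
    ≡ a *ᶻ sumBelow f n +ᶻ b *ᶻ sumBelow g n
sumBelow-lin a b f g zero    = sym (cong₂ _+ᶻ_ (ℤP.*-zeroʳ a) (ℤP.*-zeroʳ b))
sumBelow-lin a b f g (suc n) = trans (cong (_+ᶻ (a *ᶻ f n +ᶻ b *ᶻ g n)) (sumBelow-lin a b f g n))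
  (rearrange a b (sumBelow f n) (sumBelow g n) (f n) (g n))
  where
  rearrange : ∀ a b s t p q → (a *ᶻ s +ᶻ b *ᶻ t) +ᶻ (a *ᶻ p +ᶻ b *ᶻ q) ≡ a *ᶻ (s +ᶻ p) +ᶻ b *ᶻ (t +ᶻ q)
  rearrange = solve-∀

sumBelow-0 : ∀ {f} n → (∀ j → j < n → f j ≡ 0ℤ) → sumBelow f n ≡ 0ℤ
sumBelow-0 zero    e = refl
sumBelow-0 (suc n) e = cong₂ _+ᶻ_ (sumBelow-0 n (λ j p → e j (m≤n⇒m≤1+n p))) (e n ≤-refl)

sumBelow-telescope : ∀ (G : ℕ → ℤ) n → sumBelow (λ j → G (suc j) −ᶻ G j) n ≡ G n −ᶻ G 0
sumBelow-telescope G zero    = sym (ℤP.+-inverseʳ (G 0))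
sumBelow-telescope G (suc n) = trans (cong (_+ᶻ (G (suc n) −ᶻ G n)) (sumBelow-telescope G n))
  (rearrange (G n) (G 0) (G (suc n)))
  where
  rearrange : ∀ a b c → a −ᶻ b +ᶻ (c −ᶻ a) ≡ c −ᶻ b
  rearrange = solve-∀

dbl : ℕ → ℕ
dbl zero    = zero
dbl (suc n) = suc (suc (dbl n))

dbl-+ : ∀ n → dbl n ≡ n + n
dbl-+ zero    = refl
dbl-+ (suc n) = cong suc (trans (cong suc (dbl-+ n)) (sym (+-suc n n)))

dbl-ℤ : ∀ n → + dbl n ≡ + 2 *ᶻ + n
dbl-ℤ n = trans (cong +_ (dbl-+ n)) (twice (+ n))
  where
  twice : ∀ x → x +ᶻ x ≡ + 2 *ᶻ x
  twice = solve-∀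

-- Pairings of powers of u in closed form

rise : ℕ → ℕ → ℕ
rise zero    n = 1
rise (suc t) n = suc n * rise t (suc n)

-- ρ x y = K! / (x − y)!, read as 0 for x < y; the factor K! keeps the reciprocal factorials integral for x ≤ K.
module Reciprocal (K : ℕ) where

  ρ : ℕ → ℕ → ℤ
  ρ x       zero    = + rise (K ∸ x) x
  ρ zero    (suc y) = 0ℤ
  ρ (suc x) (suc y) = ρ x y

  K! : ℤ
  K! = ρ 0 0

  -- The rule `1/(t − 1)! = t/t!` at `t = x − y`. It persists for `t ≤ 0` because the reciprocal
  -- factorial of a negative number is read as 0.
  ρ-suc : ∀ x y → x ≤ K → ρ x (suc y) ≡ (+ x −ᶻ + y) *ᶻ ρ x y
  ρ-suc zero    zero    _ = refl
  ρ-suc zero    (suc y) _ = sym (ℤP.*-zeroʳ (+ 0 −ᶻ + suc y))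
  ρ-suc (suc x) zero    p = trans (cong (λ t → + rise t x) (+-∸-assoc 1 p))
    (trans (ℤP.pos-* (suc x) _) (cong (_*ᶻ + rise (K ∸ suc x) (suc x)) (sym (ℤP.+-identityʳ (+ suc x)))))
  ρ-suc (suc x) (suc y) p = trans (ρ-suc x y (<⇒≤ p)) (cong (_*ᶻ ρ x y) (shift (+ x) (+ y)))
    where
    shift : ∀ a b → a −ᶻ b ≡ (+ 1 +ᶻ a) −ᶻ (+ 1 +ᶻ b)
    shift = solve-∀

  δ : ℕ → ℕ → ℤ
  δ zero    zero    = 1ℤ
  δ zero    (suc s) = 0ℤ
  δ (suc r) zero    = 0ℤ
  δ (suc r) (suc s) = δ r s

  -- Unless `a = b`, one of `(a − b)!` and `(b − a)!` belongs to a negative number and has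
  -- reciprocal 0.
  δ-ρ : ∀ a b → K! *ᶻ K! *ᶻ δ a b ≡ ρ a b *ᶻ ρ b a
  δ-ρ zero    zero    = ℤP.*-identityʳ _
  δ-ρ zero    (suc b) = ℤP.*-zeroʳ (K! *ᶻ K!)
  δ-ρ (suc a) zero    = trans (ℤP.*-zeroʳ (K! *ᶻ K!)) (sym (ℤP.*-zeroʳ (ρ (suc a) zero)))
  δ-ρ (suc a) (suc b) = δ-ρ a b

  dot : LPoly → LPoly → ℤ
  dot = pair δ

  dot-++ʳ : ∀ f g h → dot f (g ++ h) ≡ dot f g +ᶻ dot f h
  dot-++ʳ f g h = trans (pair-swap δ f (g ++ h)) (trans (ev-++ _ g h)
    (sym (cong₂ _+ᶻ_ (pair-swap δ f g) (pair-swap δ f h))))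

  -- Vandermonde: the pairing is the binomial coefficient (m + n choose m + a − b).
  dot-pw : ∀ m a n b → m + a ≤ K → n + b ≤ K →
    K! *ᶻ K! *ᶻ dot (pw a m) (pw b n) ≡ + ((m + n) !) *ᶻ (ρ (m + a) b *ᶻ ρ (n + b) a)
  dot-pw zero a zero b p q = trans (cong (K! *ᶻ K! *ᶻ_) (unit (δ a b))) (trans (δ-ρ a b) (sym (ℤP.*-identityˡ _)))
    where
    unit : ∀ x → 1ℤ *ᶻ (1ℤ *ᶻ x +ᶻ 0ℤ) +ᶻ 0ℤ ≡ x
    unit = solve-∀
  dot-pw zero a (suc n) b p q = begin
    c *ᶻ dot (pw a 0) (pw b n ++ pw (suc b) n)
      ≡⟨ cong (c *ᶻ_) (dot-++ʳ (pw a 0) (pw b n) (pw (suc b) n)) ⟩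
    c *ᶻ (dot (pw a 0) (pw b n) +ᶻ dot (pw a 0) (pw (suc b) n))
      ≡⟨ ℤP.*-distribˡ-+ c _ _ ⟩
    c *ᶻ dot (pw a 0) (pw b n) +ᶻ c *ᶻ dot (pw a 0) (pw (suc b) n)
      ≡⟨ cong₂ _+ᶻ_ (dot-pw 0 a n b p (<⇒≤ q)) (dot-pw 0 a n (suc b) p q′) ⟩
    w *ᶻ (ρ a b *ᶻ ρ (suc n + b) (suc a)) +ᶻ w *ᶻ (ρ a (suc b) *ᶻ ρ (n + suc b) a)
      ≡⟨ cong₂ (λ s t → w *ᶻ (ρ a b *ᶻ s) +ᶻ w *ᶻ (t *ᶻ ρ (n + suc b) a)) (ρ-suc (suc n + b) a q) (ρ-suc a b p) ⟩
    w *ᶻ (ρ a b *ᶻ ((+ (suc n + b) −ᶻ + a) *ᶻ y)) +ᶻ w *ᶻ (((+ a −ᶻ + b) *ᶻ ρ a b) *ᶻ ρ (n + suc b) a)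
      ≡⟨ cong (λ k → w *ᶻ (ρ a b *ᶻ ((+ (suc n + b) −ᶻ + a) *ᶻ y)) +ᶻ w *ᶻ (((+ a −ᶻ + b) *ᶻ ρ a b) *ᶻ ρ k a))
          (+-suc n b) ⟩
    w *ᶻ (ρ a b *ᶻ ((+ (suc n + b) −ᶻ + a) *ᶻ y)) +ᶻ w *ᶻ (((+ a −ᶻ + b) *ᶻ ρ a b) *ᶻ y)
      ≡⟨ collect w (ρ a b) y (+ n) (+ a) (+ b) ⟩
    ((+ 1 +ᶻ + n) *ᶻ w) *ᶻ (ρ a b *ᶻ y)
      ≡⟨ cong (_*ᶻ (ρ a b *ᶻ y)) (ℤP.pos-* (suc n) (n !)) ⟨
    + ((suc n) !) *ᶻ (ρ a b *ᶻ y) ∎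
    where
    open ≡-Reasoning
    c w y : ℤ
    c = K! *ᶻ K!
    w = + (n !)
    y = ρ (suc n + b) a
    q′ : n + suc b ≤ K
    q′ = subst (_≤ K) (sym (+-suc n b)) q
    collect : ∀ w r y n a b → w *ᶻ (r *ᶻ ((+ 1 +ᶻ (n +ᶻ b) −ᶻ a) *ᶻ y)) +ᶻ w *ᶻ (((a −ᶻ b) *ᶻ r) *ᶻ y)
                            ≡ ((+ 1 +ᶻ n) *ᶻ w) *ᶻ (r *ᶻ y)
    collect = solve-∀
  dot-pw (suc m) a n b p q = begin
    c *ᶻ dot (pw a m ++ pw (suc a) m) (pw b n)
      ≡⟨ cong (c *ᶻ_) (ev-++ _ (pw a m) (pw (suc a) m)) ⟩
    c *ᶻ (dot (pw a m) (pw b n) +ᶻ dot (pw (suc a) m) (pw b n))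
      ≡⟨ ℤP.*-distribˡ-+ c _ _ ⟩
    c *ᶻ dot (pw a m) (pw b n) +ᶻ c *ᶻ dot (pw (suc a) m) (pw b n)
      ≡⟨ cong₂ _+ᶻ_ (dot-pw m a n b (<⇒≤ p) q) (dot-pw m (suc a) n b p′ q) ⟩
    w *ᶻ (ρ (suc m + a) (suc b) *ᶻ r) +ᶻ w *ᶻ (ρ (m + suc a) b *ᶻ ρ (n + b) (suc a))
      ≡⟨ cong₂ (λ s t → w *ᶻ (s *ᶻ r) +ᶻ w *ᶻ (ρ (m + suc a) b *ᶻ t)) (ρ-suc (suc m + a) b p) (ρ-suc (n + b) a q) ⟩
    w *ᶻ (((+ (suc m + a) −ᶻ + b) *ᶻ y) *ᶻ r) +ᶻ w *ᶻ (ρ (m + suc a) b *ᶻ ((+ (n + b) −ᶻ + a) *ᶻ r))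
      ≡⟨ cong (λ k → w *ᶻ (((+ (suc m + a) −ᶻ + b) *ᶻ y) *ᶻ r) +ᶻ w *ᶻ (ρ k b *ᶻ ((+ (n + b) −ᶻ + a) *ᶻ r)))
          (+-suc m a) ⟩
    w *ᶻ (((+ (suc m + a) −ᶻ + b) *ᶻ y) *ᶻ r) +ᶻ w *ᶻ (y *ᶻ ((+ (n + b) −ᶻ + a) *ᶻ r))
      ≡⟨ collect w r y (+ m) (+ n) (+ a) (+ b) ⟩
    ((+ 1 +ᶻ (+ m +ᶻ + n)) *ᶻ w) *ᶻ (y *ᶻ r)
      ≡⟨ cong (_*ᶻ (y *ᶻ r)) (ℤP.pos-* (suc (m + n)) ((m + n) !)) ⟨
    + ((suc m + n) !) *ᶻ (y *ᶻ r) ∎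
    where
    open ≡-Reasoning
    c w y r : ℤ
    c = K! *ᶻ K!
    w = + ((m + n) !)
    r = ρ (n + b) a
    y = ρ (suc m + a) b
    p′ : m + suc a ≤ K
    p′ = subst (_≤ K) (sym (+-suc m a)) p
    collect : ∀ w r y m n a b → w *ᶻ (((+ 1 +ᶻ (m +ᶻ a) −ᶻ b) *ᶻ y) *ᶻ r) +ᶻ w *ᶻ (y *ᶻ (((n +ᶻ b) −ᶻ a) *ᶻ r))
                              ≡ ((+ 1 +ᶻ (m +ᶻ n)) *ᶻ w) *ᶻ (y *ᶻ r)
    collect = solve-∀

  ev-pw-suc : ∀ φ a m → ev φ (pw (suc a) m) ≡ ev (λ r → φ (suc r)) (pw a m)
  ev-pw-suc φ a zero    = refl
  ev-pw-suc φ a (suc m) = trans (ev-++ φ (pw (suc a) m) (pw (suc (suc a)) m))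
    (trans (cong₂ _+ᶻ_ (ev-pw-suc φ a m) (ev-pw-suc φ (suc a) m))
      (sym (ev-++ (λ r → φ (suc r)) (pw a m) (pw (suc a) m))))

  -- When the first argument passes `s`, the sign rises by 2: by 1 on reaching `s` and by 1 on
  -- leaving it.
  sg-δ : ∀ r s → sg (suc r) s ≡ sg r s +ᶻ (δ r s +ᶻ δ (suc r) s)
  sg-δ zero    zero          = refl
  sg-δ zero    (suc zero)    = refl
  sg-δ zero    (suc (suc s)) = refl
  sg-δ (suc r) zero          = refl
  sg-δ (suc r) (suc s)       = sg-δ r s

  ev-+ : ∀ φ ψ f → ev (λ r → φ r +ᶻ ψ r) f ≡ ev φ f +ᶻ ev ψ f
  ev-+ φ ψ f = trans (ev-cong f (λ r → sym (unit-combination (φ r) (ψ r))))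
    (trans (ev-lin 1ℤ 1ℤ φ ψ f) (unit-combination (ev φ f) (ev ψ f)))

  B-shift : ∀ a m h → B (pw (suc a) m) h ≡ B (pw a m) h +ᶻ (dot (pw a m) h +ᶻ dot (pw (suc a) m) h)
  B-shift a m h = begin
    B (pw (suc a) m) h
      ≡⟨ ev-pw-suc (λ r → ev (sg r) h) a m ⟩
    ev (λ r → ev (sg (suc r)) h) (pw a m)
      ≡⟨ ev-cong (pw a m) (λ r → trans (ev-cong h (sg-δ r)) (trans (ev-+ (sg r) _ h)
           (cong (ev (sg r) h +ᶻ_) (ev-+ (δ r) (δ (suc r)) h)))) ⟩
    ev (λ r → ev (sg r) h +ᶻ (ev (δ r) h +ᶻ ev (δ (suc r)) h)) (pw a m)
      ≡⟨ trans (ev-+ _ _ (pw a m)) (cong (B (pw a m) h +ᶻ_) (ev-+ _ _ (pw a m))) ⟩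
    B (pw a m) h +ᶻ (dot (pw a m) h +ᶻ ev (λ r → ev (δ (suc r)) h) (pw a m))
      ≡⟨ cong (λ t → B (pw a m) h +ᶻ (dot (pw a m) h +ᶻ t)) (ev-pw-suc (λ r → ev (δ r) h) a m) ⟨
    B (pw a m) h +ᶻ (dot (pw a m) h +ᶻ dot (pw (suc a) m) h) ∎
    where open ≡-Reasoning

  -- u^(i+1) − 2u^i = (z − 1)(z + 2)u^i for u = z + z², and the factor z − 1 turns B into the local pairing dot.
  B-difference : ∀ i h → B (pw (suc i) (suc i)) h ≡
    + 2 *ᶻ B (pw i i) h +ᶻ (+ 2 *ᶻ dot (pw i (suc i)) h +ᶻ dot (pw (suc i) (suc i)) h)
  B-difference i h = begin
    B (pw (suc i) (suc i)) h  ≡⟨ ev-++ _ (pw (suc i) i) (pw (suc (suc i)) i) ⟩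
    b₁ +ᶻ B (pw (suc (suc i)) i) h  ≡⟨ cong (b₁ +ᶻ_) (B-shift (suc i) i h) ⟩
    b₁ +ᶻ (b₁ +ᶻ (d₁ +ᶻ d₂))  ≡⟨ cong (λ t → t +ᶻ (t +ᶻ (d₁ +ᶻ d₂))) (B-shift i i h) ⟩
    (b₀ +ᶻ (d₀ +ᶻ d₁)) +ᶻ ((b₀ +ᶻ (d₀ +ᶻ d₁)) +ᶻ (d₁ +ᶻ d₂))  ≡⟨ collect b₀ d₀ d₁ d₂ ⟩
    + 2 *ᶻ b₀ +ᶻ (+ 2 *ᶻ (d₀ +ᶻ d₁) +ᶻ (d₁ +ᶻ d₂))
      ≡⟨ cong₂ (λ s t → + 2 *ᶻ b₀ +ᶻ (+ 2 *ᶻ s +ᶻ t)) (ev-++ _ (pw i i) (pw (suc i) i))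
          (ev-++ _ (pw (suc i) i) (pw (suc (suc i)) i)) ⟨
    + 2 *ᶻ b₀ +ᶻ (+ 2 *ᶻ dot (pw i (suc i)) h +ᶻ dot (pw (suc i) (suc i)) h) ∎
    where
    open ≡-Reasoning
    b₀ b₁ d₀ d₁ d₂ : ℤ
    b₀ = B (pw i i) h
    b₁ = B (pw (suc i) i) h
    d₀ = dot (pw i i) h
    d₁ = dot (pw (suc i) i) h
    d₂ = dot (pw (suc (suc i)) i) h
    collect : ∀ b d₀ d₁ d₂ → (b +ᶻ (d₀ +ᶻ d₁)) +ᶻ ((b +ᶻ (d₀ +ᶻ d₁)) +ᶻ (d₁ +ᶻ d₂))
                           ≡ + 2 *ᶻ b +ᶻ (+ 2 *ᶻ (d₀ +ᶻ d₁) +ᶻ (d₁ +ᶻ d₂))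
    collect = solve-∀

  -- The two Vandermonde products share all factorials. With `I = i + 1` their remaining factors
  -- `2 (2I − j)` and `2j + 1 − I` add up to `3I + 1`, which is free of `j` and can leave any sum
  -- over `j`.
  B-difference-ρ : ∀ i j → dbl (suc i) ≤ K → suc (dbl j) ≤ K →
    K! *ᶻ K! *ᶻ B (pw (suc i) (suc i)) (pw j j) ≡ + 2 *ᶻ (K! *ᶻ K! *ᶻ B (pw i i) (pw j j))
      +ᶻ (+ 3 *ᶻ + suc i +ᶻ 1ℤ) *ᶻ (+ ((suc i + j) !) *ᶻ (ρ (suc (dbl j)) (suc i) *ᶻ ρ (dbl (suc i)) j))
  B-difference-ρ i j p q = begin
    c *ᶻ B (pw (suc i) (suc i)) (pw j j)
      ≡⟨ cong (c *ᶻ_) (B-difference i (pw j j)) ⟩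
    c *ᶻ (+ 2 *ᶻ b +ᶻ (+ 2 *ᶻ dot (pw i (suc i)) (pw j j) +ᶻ dot (pw (suc i) (suc i)) (pw j j)))
      ≡⟨ distribute c b _ _ ⟩
    + 2 *ᶻ (c *ᶻ b) +ᶻ (+ 2 *ᶻ (c *ᶻ dot (pw i (suc i)) (pw j j)) +ᶻ c *ᶻ dot (pw (suc i) (suc i)) (pw j j))
      ≡⟨ cong (+ 2 *ᶻ (c *ᶻ b) +ᶻ_) (cong₂ (λ s t → + 2 *ᶻ s +ᶻ t) first second) ⟩
    + 2 *ᶻ (c *ᶻ b) +ᶻ (+ 2 *ᶻ (w *ᶻ (((+ 2 *ᶻ + suc i) −ᶻ + j) *ᶻ y *ᶻ x)) +ᶻ w *ᶻ
        (y *ᶻ ((+ 1 +ᶻ + 2 *ᶻ + j −ᶻ + suc i) *ᶻ x)))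
      ≡⟨ cong (+ 2 *ᶻ (c *ᶻ b) +ᶻ_) (collect w x y (+ suc i) (+ j)) ⟩
    + 2 *ᶻ (c *ᶻ b) +ᶻ (+ 3 *ᶻ + suc i +ᶻ 1ℤ) *ᶻ (w *ᶻ (x *ᶻ y)) ∎
    where
    open ≡-Reasoning
    c b w x y : ℤ
    c = K! *ᶻ K!
    b = B (pw i i) (pw j j)
    w = + ((suc i + j) !)
    x = ρ (suc (dbl j)) (suc i)
    y = ρ (dbl (suc i)) j
    distribute : ∀ c b s t → c *ᶻ (+ 2 *ᶻ b +ᶻ (+ 2 *ᶻ s +ᶻ t)) ≡ + 2 *ᶻ (c *ᶻ b) +ᶻ (+ 2 *ᶻ (c *ᶻ s) +ᶻ c *ᶻ t)
    distribute = solve-∀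
    collect : ∀ w x y i j → + 2 *ᶻ (w *ᶻ (((+ 2 *ᶻ i) −ᶻ j) *ᶻ y *ᶻ x)) +ᶻ w *ᶻ (y *ᶻ ((+ 1 +ᶻ + 2 *ᶻ j −ᶻ i) *ᶻ x))
                          ≡ (+ 3 *ᶻ i +ᶻ 1ℤ) *ᶻ (w *ᶻ (x *ᶻ y))
    collect = solve-∀
    i+i : suc i + suc i ≡ dbl (suc i)
    i+i = sym (dbl-+ (suc i))
    i+i′ : suc i + i ≡ suc (dbl i)
    i+i′ = cong suc (sym (dbl-+ i))
    j+j : j + j ≡ dbl j
    j+j = sym (dbl-+ j)
    p₁ : suc i + i ≤ K
    p₁ = subst (_≤ K) (sym i+i′) (<⇒≤ p)
    p₂ : suc i + suc i ≤ K
    p₂ = subst (_≤ K) (sym i+i) p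
    q₁ : j + j ≤ K
    q₁ = subst (_≤ K) (sym j+j) (<⇒≤ q)
    first : c *ᶻ dot (pw i (suc i)) (pw j j) ≡ w *ᶻ (((+ 2 *ᶻ + suc i) −ᶻ + j) *ᶻ y *ᶻ x)
    first = trans (dot-pw (suc i) i j j p₁ q₁) (cong (w *ᶻ_) (cong₂ _*ᶻ_
      (trans (cong (λ k → ρ k j) i+i′) (trans (ρ-suc (dbl (suc i)) j p)
          (cong (λ t → (t −ᶻ + j) *ᶻ y) (dbl-ℤ (suc i)))))
      (cong (λ k → ρ k i) j+j)))
    second : c *ᶻ dot (pw (suc i) (suc i)) (pw j j) ≡ w *ᶻ (y *ᶻ ((+ 1 +ᶻ + 2 *ᶻ + j −ᶻ + suc i) *ᶻ x))
    second = trans (dot-pw (suc i) (suc i) j j p₂ q₁) (cong (w *ᶻ_) (cong₂ _*ᶻ_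
      (cong (λ k → ρ k j) i+i)
      (trans (cong (λ k → ρ k (suc i)) j+j)
        (trans (ρ-suc (suc (dbl j)) (suc i) q) (cong (λ t → (+ 1 +ᶻ t −ᶻ + suc i) *ᶻ x) (dbl-ℤ j))))))

-- The annihilating polynomial and its telescoping sum

prodRange : (ℕ → ℤ) → ℕ → ℕ → ℤ
prodRange f s zero    = 1ℤ
prodRange f s (suc l) = f s *ᶻ prodRange f (suc s) l

prodUpTo : (ℕ → ℤ) → ℕ → ℤ
prodUpTo f zero    = 1ℤ
prodUpTo f (suc n) = prodUpTo f n *ᶻ f n

prodUpTo-≢0 : ∀ f n → (∀ j → j < n → f j ≢ 0ℤ) → prodUpTo f n ≢ 0ℤ
prodUpTo-≢0 f zero    nz = λ ()
prodUpTo-≢0 f (suc n) nz e with ℤP.i*j≡0⇒i≡0∨j≡0 (prodUpTo f n) e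
... | inj₁ z = prodUpTo-≢0 f n (λ j p → nz j (m≤n⇒m≤1+n p)) z
... | inj₂ z = nz n ≤-refl z

dbl-mono : ∀ {m n} → m ≤ n → dbl m ≤ dbl n
dbl-mono z≤n     = z≤n
dbl-mono (s≤s p) = s≤s (s≤s (dbl-mono p))

cancel-zero : ∀ {a b} → a ≢ 0ℤ → a *ᶻ b ≡ 0ℤ → b ≡ 0ℤ
cancel-zero {a} a≢0 e with ℤP.i*j≡0⇒i≡0∨j≡0 a e
... | inj₁ z with () ← a≢0 z
... | inj₂ z = z

*-≢0 : ∀ a b → a ≢ 0ℤ → b ≢ 0ℤ → a *ᶻ b ≢ 0ℤ
*-≢0 a b a≢0 b≢0 e = b≢0 (cancel-zero {a} {b} a≢0 e)

minus-≤ : ∀ {a b} → a ≤ b → + b −ᶻ + a ≡ + (b ∸ a)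
minus-≤ {a} {b} p = trans (ℤP.m-n≡m⊖n b a) (ℤP.⊖-≥ p)

-- The polynomial Σ_j coef j u^j is B-orthogonal to u^(i+1) − 2u^i for 1 ≤ i + 1 ≤ q. Its coefficients are
-- hypergeometric in j, with ratio −2 (q − j)(q + j + 2)(2j + 1)(3j + 5) / ((j + 2)(2q + 1 − j)(2q + 3 + j)(3j +
-- 2)); this was found by solving small cases.
module Annihilator (q : ℕ) where

  -- `4q + 4` bounds the arguments at which `ρ-suc` is applied; the largest is `2 (i + 1)` with
  -- `i ≤ 2q`.
  open Reciprocal (dbl (dbl (suc q))) public

  up down : ℕ → ℤ
  up   t = (-ᶻ + 2) *ᶻ (+ q −ᶻ + t) *ᶻ (+ q +ᶻ + t +ᶻ + 2) *ᶻ (+ 2 *ᶻ + t +ᶻ + 1)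
  down t = (+ t +ᶻ + 2) *ᶻ (+ 2 *ᶻ + q +ᶻ + 1 −ᶻ + t) *ᶻ (+ 2 *ᶻ + q +ᶻ + 3 +ᶻ + t)

  -- An integral solution of down t * weight (t + 1) = up t * weight t.
  weight : ℕ → ℤ
  weight j = prodUpTo up j *ᶻ prodRange down j (q ∸ j)

  up-q : up q ≡ 0ℤ
  up-q = zero-factor (+ q)
    where
    zero-factor : ∀ q → (-ᶻ + 2) *ᶻ (q −ᶻ q) *ᶻ (q +ᶻ q +ᶻ + 2) *ᶻ (+ 2 *ᶻ q +ᶻ + 1) ≡ 0ℤ
    zero-factor = solve-∀

  weight-suc : ∀ j → j ≤ q → down j *ᶻ weight (suc j) ≡ up j *ᶻ weight j
  weight-suc j j≤q with m≤n⇒m<n∨m≡n j≤q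
  ... | inj₁ j<q rewrite +-∸-assoc 1 j<q = rearrange (down j) (prodUpTo up j) (up j) _
    where
    rearrange : ∀ d p u r → d *ᶻ (p *ᶻ u *ᶻ r) ≡ u *ᶻ (p *ᶻ (d *ᶻ r))
    rearrange = solve-∀
  ... | inj₂ refl rewrite up-q = zero-factor (down q) (prodUpTo up q) (prodRange down (suc q) (q ∸ suc q)) (weight q)
    where
    zero-factor : ∀ d p r w → d *ᶻ (p *ᶻ 0ℤ *ᶻ r) ≡ 0ℤ *ᶻ w
    zero-factor = solve-∀

  coef : ℕ → ℤ
  coef j = (+ 3 *ᶻ + j +ᶻ + 2) *ᶻ weight j

  -- Up to the factors `3i + 1` and `K!` squared, the contribution of `coef j u^j` to the pairing of
  -- `u^i − 2u^(i−1)` with the annihilating polynomial.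
  term : ℕ → ℕ → ℤ
  term i j = coef j *ᶻ (+ ((i + j) !) *ᶻ (ρ (suc (dbl j)) i *ᶻ ρ (dbl i) j))

  -- This is `down (j − 1) * weight j`, written out so that it also makes sense at `j = 0`. In this
  -- form the ratio equation removes `weight (j + 1)` from the certificate at `j + 1`.
  edge : ℕ → ℤ
  edge j = (+ j +ᶻ + 1) *ᶻ (+ 2 *ᶻ + q +ᶻ + 2 −ᶻ + j) *ᶻ (+ 2 *ᶻ + q +ᶻ + 2 +ᶻ + j) *ᶻ weight j

  edge-suc : ∀ j → j ≤ q → edge (suc j) ≡ up j *ᶻ weight j
  edge-suc j p = trans (cong (_*ᶻ weight (suc j)) (shift (+ j) (+ q))) (weight-suc j p)
    where
    shift : ∀ j q → (+ 1 +ᶻ j +ᶻ + 1) *ᶻ (+ 2 *ᶻ q +ᶻ + 2 −ᶻ (+ 1 +ᶻ j)) *ᶻ (+ 2 *ᶻ q +ᶻ + 2 +ᶻ (+ 1 +ᶻ j))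
                  ≡ (j +ᶻ + 2) *ᶻ (+ 2 *ᶻ q +ᶻ + 1 −ᶻ j) *ᶻ (+ 2 *ᶻ q +ᶻ + 3 +ᶻ j)
    shift = solve-∀

  -- Zeilberger's certificate for the recurrence in i of Σ_j term i j.
  certificate : ℕ → ℕ → ℤ
  certificate i j = + 3 *ᶻ (+ i +ᶻ + 1) *ᶻ
    (edge j *ᶻ (+ ((i + j) !) *ᶻ (ρ (suc (dbl j)) (suc (suc i)) *ᶻ ρ (dbl (suc i)) j)))

  -- Their zeros govern the argument: `α` vanishes at `i = q`, which forces the sums at and below
  -- `q` to vanish, while `β` among natural numbers vanishes only at 0 and `2q + 1`, outside the
  -- range where a nonzero value is needed.
  α β : ℕ → ℤ
  α i = + 2 *ᶻ (+ 2 *ᶻ + i +ᶻ + 3) *ᶻ (+ i −ᶻ + q) *ᶻ (+ i +ᶻ + q +ᶻ + 2)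
  β i = + i *ᶻ (+ i +ᶻ + 2 *ᶻ + q +ᶻ + 3) *ᶻ (+ i −ᶻ (+ 2 *ᶻ + q +ᶻ + 1))

  -- Every quantity is a polynomial multiple of `w * f * a * b`. With this factor taken out, the
  -- claim is the polynomial identity `identity` in `q`, `i` and `j`.
  term-telescopes : ∀ i j → i ≤ dbl q → j ≤ q →
    α i *ᶻ term (suc i) j +ᶻ β i *ᶻ term i j ≡ certificate i (suc j) −ᶻ certificate i j
  term-telescopes i j i≤ j≤ = begin
    α i *ᶻ term (suc i) j +ᶻ β i *ᶻ term i j
      ≡⟨ cong₂ (λ s t → α i *ᶻ s +ᶻ β i *ᶻ t) term₁ term₀ ⟩
    α i *ᶻ (c *ᶻ w *ᶻ (n *ᶻ f *ᶻ (x *ᶻ a *ᶻ b))) +ᶻ β i *ᶻ (c *ᶻ w *ᶻ (f *ᶻ (a *ᶻ (y *ᶻ b))))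
      ≡⟨ factor (α i) (β i) c w n f x a y b ⟩
    (α i *ᶻ (c *ᶻ n *ᶻ x) +ᶻ β i *ᶻ (c *ᶻ y)) *ᶻ (w *ᶻ f *ᶻ a *ᶻ b)
      ≡⟨ cong (_*ᶻ (w *ᶻ f *ᶻ a *ᶻ b)) (identity (+ q) (+ i) (+ j)) ⟩
    (+ 3 *ᶻ (+ i +ᶻ + 1) *ᶻ (up j *ᶻ n *ᶻ z −ᶻ e *ᶻ (x *ᶻ x′))) *ᶻ (w *ᶻ f *ᶻ a *ᶻ b)
      ≡⟨ unfactor (+ 3 *ᶻ (+ i +ᶻ + 1)) (up j) n z e x x′ w f a b ⟩
    + 3 *ᶻ (+ i +ᶻ + 1) *ᶻ (up j *ᶻ w *ᶻ (n *ᶻ f *ᶻ (a *ᶻ (z *ᶻ b))))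
      −ᶻ + 3 *ᶻ (+ i +ᶻ + 1) *ᶻ (e *ᶻ w *ᶻ (f *ᶻ (x′ *ᶻ (x *ᶻ a) *ᶻ b)))
      ≡⟨ cong₂ _−ᶻ_ cert₁ cert₀ ⟨
    certificate i (suc j) −ᶻ certificate i j ∎
    where
    open ≡-Reasoning
    c w n f a b x x′ y z e : ℤ
    c  = + 3 *ᶻ + j +ᶻ + 2
    w  = weight j
    n  = + i +ᶻ + j +ᶻ + 1
    f  = + ((i + j) !)
    a  = ρ (suc (dbl j)) i
    b  = ρ (dbl (suc i)) j
    x  = + 2 *ᶻ + j +ᶻ + 1 −ᶻ + i
    x′ = + 2 *ᶻ + j −ᶻ + i
    z  = + 2 *ᶻ + i +ᶻ + 2 −ᶻ + j
    y  = (+ 2 *ᶻ + i +ᶻ + 1 −ᶻ + j) *ᶻ z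
    e  = (+ j +ᶻ + 1) *ᶻ (+ 2 *ᶻ + q +ᶻ + 2 −ᶻ + j) *ᶻ (+ 2 *ᶻ + q +ᶻ + 2 +ᶻ + j)
    boundᵢ : dbl (suc i) ≤ dbl (dbl (suc q))
    boundᵢ = dbl-mono (s≤s (m≤n⇒m≤1+n i≤))
    boundⱼ : suc (dbl j) ≤ dbl (dbl (suc q))
    boundⱼ = ≤-trans (n≤1+n _) (dbl-mono (≤-trans (s≤s j≤) (subst (suc q ≤_) (sym (dbl-+ (suc q)))
        (s≤s (≤-trans (n≤1+n q) (m≤n+m (suc q) q))))))
    ρx : ρ (suc (dbl j)) (suc i) ≡ x *ᶻ a
    ρx = trans (ρ-suc _ i boundⱼ) (cong (_*ᶻ a) (trans (cong (λ t → + 1 +ᶻ t −ᶻ + i) (dbl-ℤ j)) (shape (+ j) (+ i))))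
      where
      shape : ∀ j i → + 1 +ᶻ + 2 *ᶻ j −ᶻ i ≡ + 2 *ᶻ j +ᶻ + 1 −ᶻ i
      shape = solve-∀
    ρxx : ρ (suc (dbl j)) (suc (suc i)) ≡ x′ *ᶻ (x *ᶻ a)
    ρxx = trans (ρ-suc _ (suc i) boundⱼ) (cong₂ _*ᶻ_
      (trans (cong (λ t → + 1 +ᶻ t −ᶻ (+ 1 +ᶻ + i)) (dbl-ℤ j)) (shape (+ j) (+ i))) ρx)
      where
      shape : ∀ j i → + 1 +ᶻ + 2 *ᶻ j −ᶻ (+ 1 +ᶻ i) ≡ + 2 *ᶻ j −ᶻ i
      shape = solve-∀
    ρz : ρ (dbl (suc i)) (suc j) ≡ z *ᶻ b
    ρz = trans (ρ-suc _ j boundᵢ) (cong (_*ᶻ b) (trans (cong (_−ᶻ + j) (dbl-ℤ (suc i))) (shape (+ i) (+ j))))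
      where
      shape : ∀ i j → + 2 *ᶻ (+ 1 +ᶻ i) −ᶻ j ≡ + 2 *ᶻ i +ᶻ + 2 −ᶻ j
      shape = solve-∀
    ρy : ρ (dbl i) j ≡ y *ᶻ b
    ρy = trans (ρ-suc (dbl (suc i)) (suc j) boundᵢ)
      (trans (cong₂ _*ᶻ_ (trans (cong (_−ᶻ + suc j) (dbl-ℤ (suc i))) (shape (+ i) (+ j))) ρz)
        (sym (ℤP.*-assoc (+ 2 *ᶻ + i +ᶻ + 1 −ᶻ + j) z b)))
      where
      shape : ∀ i j → + 2 *ᶻ (+ 1 +ᶻ i) −ᶻ (+ 1 +ᶻ j) ≡ + 2 *ᶻ i +ᶻ + 1 −ᶻ j
      shape = solve-∀
    fact : + ((suc i + j) !) ≡ n *ᶻ f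
    fact = trans (ℤP.pos-* (suc (i + j)) ((i + j) !)) (cong (_*ᶻ f) (shape (+ i) (+ j)))
      where
      shape : ∀ i j → + 1 +ᶻ (i +ᶻ j) ≡ i +ᶻ j +ᶻ + 1
      shape = solve-∀
    term₁ : term (suc i) j ≡ c *ᶻ w *ᶻ (n *ᶻ f *ᶻ (x *ᶻ a *ᶻ b))
    term₁ = cong (c *ᶻ w *ᶻ_) (cong₂ (λ s t → s *ᶻ (t *ᶻ b)) fact ρx)
    term₀ : term i j ≡ c *ᶻ w *ᶻ (f *ᶻ (a *ᶻ (y *ᶻ b)))
    term₀ = cong (λ t → c *ᶻ w *ᶻ (f *ᶻ (a *ᶻ t))) ρy
    cert₁ : certificate i (suc j) ≡ + 3 *ᶻ (+ i +ᶻ + 1) *ᶻ (up j *ᶻ w *ᶻ (n *ᶻ f *ᶻ (a *ᶻ (z *ᶻ b))))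
    cert₁ = cong (+ 3 *ᶻ (+ i +ᶻ + 1) *ᶻ_) (cong₂ _*ᶻ_ (edge-suc j j≤)
      (cong₂ (λ s t → s *ᶻ (a *ᶻ t)) (trans (cong (λ k → + (k !)) (+-suc i j)) fact) ρz))
    cert₀ : certificate i j ≡ + 3 *ᶻ (+ i +ᶻ + 1) *ᶻ (e *ᶻ w *ᶻ (f *ᶻ (x′ *ᶻ (x *ᶻ a) *ᶻ b)))
    cert₀ = cong (λ t → + 3 *ᶻ (+ i +ᶻ + 1) *ᶻ (e *ᶻ w *ᶻ (f *ᶻ (t *ᶻ b)))) ρxx
    factor : ∀ α β c w n f x a y b →
      α *ᶻ (c *ᶻ w *ᶻ (n *ᶻ f *ᶻ (x *ᶻ a *ᶻ b))) +ᶻ β *ᶻ (c *ᶻ w *ᶻ (f *ᶻ (a *ᶻ (y *ᶻ b))))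
      ≡ (α *ᶻ (c *ᶻ n *ᶻ x) +ᶻ β *ᶻ (c *ᶻ y)) *ᶻ (w *ᶻ f *ᶻ a *ᶻ b)
    factor = solve-∀
    unfactor : ∀ s u n z e x x′ w f a b →
      (s *ᶻ (u *ᶻ n *ᶻ z −ᶻ e *ᶻ (x *ᶻ x′))) *ᶻ (w *ᶻ f *ᶻ a *ᶻ b)
      ≡ s *ᶻ (u *ᶻ w *ᶻ (n *ᶻ f *ᶻ (a *ᶻ (z *ᶻ b)))) −ᶻ s *ᶻ (e *ᶻ w *ᶻ (f *ᶻ (x′ *ᶻ (x *ᶻ a) *ᶻ b)))
    unfactor = solve-∀
    identity : ∀ q i j →
      (+ 2 *ᶻ (+ 2 *ᶻ i +ᶻ + 3) *ᶻ (i −ᶻ q) *ᶻ (i +ᶻ q +ᶻ + 2)) *ᶻ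
        ((+ 3 *ᶻ j +ᶻ + 2) *ᶻ (i +ᶻ j +ᶻ + 1) *ᶻ (+ 2 *ᶻ j +ᶻ + 1 −ᶻ i))
      +ᶻ (i *ᶻ (i +ᶻ + 2 *ᶻ q +ᶻ + 3) *ᶻ (i −ᶻ (+ 2 *ᶻ q +ᶻ + 1))) *ᶻ
        ((+ 3 *ᶻ j +ᶻ + 2) *ᶻ ((+ 2 *ᶻ i +ᶻ + 1 −ᶻ j) *ᶻ (+ 2 *ᶻ i +ᶻ + 2 −ᶻ j)))
      ≡ + 3 *ᶻ (i +ᶻ + 1) *ᶻ
        ((-ᶻ + 2) *ᶻ (q −ᶻ j) *ᶻ (q +ᶻ j +ᶻ + 2) *ᶻ (+ 2 *ᶻ j +ᶻ + 1) *ᶻ (i +ᶻ j +ᶻ + 1) *ᶻ (+ 2 *ᶻ i +ᶻ + 2 −ᶻ j)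
        −ᶻ (j +ᶻ + 1) *ᶻ (+ 2 *ᶻ q +ᶻ + 2 −ᶻ j) *ᶻ (+ 2 *ᶻ q +ᶻ + 2 +ᶻ j) *ᶻ
            ((+ 2 *ᶻ j +ᶻ + 1 −ᶻ i) *ᶻ (+ 2 *ᶻ j −ᶻ i)))
    identity = solve-∀

  total : ℕ → ℤ
  total i = sumBelow (term i) (suc q)

  -- Both ends of the telescoped sum vanish: the upper one through `up q`, the lower one because
  -- `ρ 1 (i + 2)` is 0.
  total-rec : ∀ i → i ≤ dbl q → α i *ᶻ total (suc i) +ᶻ β i *ᶻ total i ≡ 0ℤ
  total-rec i p = begin
    α i *ᶻ total (suc i) +ᶻ β i *ᶻ total i
      ≡⟨ sumBelow-lin (α i) (β i) (term (suc i)) (term i) (suc q) ⟨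
    sumBelow (λ j → α i *ᶻ term (suc i) j +ᶻ β i *ᶻ term i j) (suc q)
      ≡⟨ sumBelow-cong (suc q) (λ j j<q → term-telescopes i j p (≤-pred j<q)) ⟩
    sumBelow (λ j → certificate i (suc j) −ᶻ certificate i j) (suc q)
      ≡⟨ sumBelow-telescope (certificate i) (suc q) ⟩
    certificate i (suc q) −ᶻ certificate i 0
      ≡⟨ cong₂ _−ᶻ_ last (first (+ 3 *ᶻ (+ i +ᶻ + 1)) (edge 0) (+ ((i + 0) !)) (ρ (dbl (suc i)) 0)) ⟩
    0ℤ ∎
    where
    open ≡-Reasoning
    first : ∀ s e f r → s *ᶻ (e *ᶻ (f *ᶻ (0ℤ *ᶻ r))) ≡ 0ℤ
    first = solve-∀
    last : certificate i (suc q) ≡ 0ℤ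
    last = trans (cong (λ t → + 3 *ᶻ (+ i +ᶻ + 1) *ᶻ (t *ᶻ r)) (trans (edge-suc q ≤-refl) (cong (_*ᶻ weight q) up-q)))
      (zeros (+ 3 *ᶻ (+ i +ᶻ + 1)) (weight q) r)
      where
      r : ℤ
      r = + ((i + suc q) !) *ᶻ (ρ (suc (dbl (suc q))) (suc (suc i)) *ᶻ ρ (dbl (suc i)) (suc q))
      zeros : ∀ s w r → s *ᶻ (0ℤ *ᶻ w *ᶻ r) ≡ 0ℤ
      zeros = solve-∀

-- Pfaffians of powers of u

contract-annihilated : ∀ f g {Φ} fs → (∀ hs → All (λ h → B g h ≡ 0ℤ) hs → Φ hs ≡ 0ℤ) →
  All (λ h → B g h ≡ 0ℤ) fs → contract f Φ fs ≡ 0ℤ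
contract-annihilated f g []       z []       = refl
contract-annihilated f g (h ∷ fs) z (a ∷ as) = cong₂ _−ᶻ_
  (trans (cong (B f h *ᶻ_) (z fs as)) (ℤP.*-zeroʳ (B f h)))
  (contract-annihilated f g fs (λ hs bs → z (h ∷ hs) (a ∷ bs)) as)

contract-null : ∀ g Φ fs → All (λ h → B g h ≡ 0ℤ) fs → contract g Φ fs ≡ 0ℤ
contract-null g Φ []       []       = refl
contract-null g Φ (h ∷ fs) (a ∷ as) = cong₂ _−ᶻ_ (cong (_*ᶻ Φ fs) a) (contract-null g _ fs as)

Pf-null : ∀ k g fs → All (λ h → B g h ≡ 0ℤ) fs → Pf k (g ∷ fs) ≡ 0ℤ
Pf-null zero    g fs as = refl
Pf-null (suc k) g fs as = contract-null g (Pf k) fs as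

u : ℕ → LPoly
u k = pw k k

-- Ends with u⁰ or u¹, whichever makes the length even.
powers : ℕ → List LPoly
powers zero          = []
powers (suc zero)    = []
powers (suc (suc m)) = u (suc m) ∷ u m ∷ powers m

half : ℕ → ℕ
half zero          = zero
half (suc zero)    = zero
half (suc (suc m)) = suc (half m)

magogPf : ℕ → ℤ
magogPf m = Pf (half m) (powers m)

start : ℕ → ℕ
start zero          = 0
start (suc zero)    = 1
start (suc (suc m)) = start m

start≤ : ∀ m → start m ≤ m
start≤ zero          = z≤n
start≤ (suc zero)    = z<s
start≤ (suc (suc m)) = m≤n⇒m≤1+n (m≤n⇒m≤1+n (start≤ m))

∈-powers : ∀ m j → start m ≤ j → j < m → u j ∈ powers m
∈-powers (suc zero)    zero    () _
∈-powers (suc zero)    (suc j) _  (s≤s ())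
∈-powers (suc (suc m)) j p (s≤s j≤) with m≤n⇒m<n∨m≡n j≤
... | inj₂ refl = here refl
... | inj₁ (s≤s j≤m) with m≤n⇒m<n∨m≡n j≤m
...   | inj₂ refl = there (here refl)
...   | inj₁ j<m  = there (there (∈-powers m j p j<m))

All-powers : ∀ {P : LPoly → Set} m → (∀ j → start m ≤ j → j < m → P (u j)) → All P (powers m)
All-powers zero          f = []
All-powers (suc zero)    f = []
All-powers (suc (suc m)) f =
  f (suc m) (m≤n⇒m≤1+n (start≤ m)) ≤-refl ∷ f m (start≤ m) (n≤1+n _) ∷
  All-powers m (λ j p q → f j p (m≤n⇒m≤1+n (m≤n⇒m≤1+n q)))

combo : (ℕ → ℤ) → ℕ → LPoly
combo κ zero    = []
combo κ (suc n) = combo κ n ++ scale (κ n) (u n)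

B-combo : ∀ κ n h → B (combo κ n) h ≡ sumBelow (λ j → κ j *ᶻ B (u j) h) n
B-combo κ zero    h = refl
B-combo κ (suc n) h = trans (ev-++ _ (combo κ n) (scale (κ n) (u n)))
  (cong₂ _+ᶻ_ (B-combo κ n h) (ev-scale _ (κ n) (u n)))

combo-suc : ∀ κ n → Combination (combo κ (suc n)) 1ℤ (combo κ n) (κ n) (u n)
combo-suc κ n = combination λ h → trans (ev-++ _ (combo κ n) (scale (κ n) (u n)))
  (cong₂ _+ᶻ_ (sym (ℤP.*-identityˡ (B (combo κ n) h))) (ev-scale _ (κ n) (u n)))

Pf-combo-0 : ∀ k κ n l r → (∀ j → j < n → κ j ≡ 0ℤ ⊎ u j ∈ r) → Pf k (l ++ combo κ n ∷ r) ≡ 0ℤ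
Pf-combo-0 k κ zero    l r dep =
  Pf-linear k {h = []} {a = 0ℤ} {f = []} {b = 0ℤ} {g = []} (combination λ _ → refl) l r
Pf-combo-0 k κ (suc n) l r dep = trans (Pf-linear k (combo-suc κ n) l r)
  (cong₂ _+ᶻ_ (trans (ℤP.*-identityˡ _) (Pf-combo-0 k κ n l r (λ j p → dep j (m≤n⇒m≤1+n p))))
    (vanish (dep n ≤-refl)))
  where
  vanish : κ n ≡ 0ℤ ⊎ u n ∈ r → κ n *ᶻ Pf k (l ++ u n ∷ r) ≡ 0ℤ
  vanish (inj₁ z) = cong (_*ᶻ Pf k (l ++ u n ∷ r)) z
  vanish (inj₂ m) with ∈-∃++ m
  ... | ys , zs , refl = trans (cong (κ n *ᶻ_) (Pf-repeat-apart k (u n) l ys zs)) (ℤP.*-zeroʳ (κ n))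

-- Only the leading term survives, since each lower power has coefficient 0 or repeats an argument
-- in `r`.
Pf-combo : ∀ k κ n l r → (∀ j → j < n → κ j ≡ 0ℤ ⊎ u j ∈ r) →
  Pf k (l ++ combo κ (suc n) ∷ r) ≡ κ n *ᶻ Pf k (l ++ u n ∷ r)
Pf-combo k κ n l r dep = trans (Pf-linear k (combo-suc κ n) l r)
  (trans (cong (λ t → 1ℤ *ᶻ t +ᶻ κ n *ᶻ Pf k (l ++ u n ∷ r)) (Pf-combo-0 k κ n l r dep)) (ℤP.+-identityˡ _))

two^ : ℕ → ℤ
two^ zero    = 1ℤ
two^ (suc n) = + 2 *ᶻ two^ n

-- All exponents in `u^(k+1)` are positive, so pairing with 1 is evaluation at `z = 1`, where
-- `u = 2`.
B-u-u0 : ∀ k → B (u (suc k)) (u 0) ≡ two^ (suc k)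
B-u-u0 k = trans (unfold (suc k) (suc k)) (value k (suc k))
  where
  φ : ℕ → ℤ
  φ r = sg r 0
  unfold : ∀ a m → B (pw a m) (u 0) ≡ ev φ (pw a m)
  unfold a m = ev-cong (pw a m) (λ r → unit (sg r 0))
    where
    unit : ∀ x → 1ℤ *ᶻ x +ᶻ 0ℤ ≡ x
    unit = solve-∀
  value : ∀ a m → ev φ (pw (suc a) m) ≡ two^ m
  value a zero    = refl
  value a (suc m) = trans (ev-++ φ (pw (suc a) m) (pw (suc (suc a)) m))
    (trans (cong₂ _+ᶻ_ (value a m) (value (suc a) m)) (double (two^ m)))
    where
    double : ∀ x → x +ᶻ x ≡ + 2 *ᶻ x
    double = solve-∀

B-self : ∀ f → B f f ≡ 0ℤ
B-self f = negate-self (B-anti f f)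

-- Orthogonality and the two-step recurrence

module Evaluation (q-1 : ℕ) where

  q : ℕ
  q = suc q-1

  open Annihilator q

  K : ℕ
  K = dbl (dbl (suc q))

  rise-! : ∀ t n → n ! * rise t n ≡ (n + t) !
  rise-! zero    n = trans (*-identityʳ (n !)) (cong _! (sym (+-identityʳ n)))
  rise-! (suc t) n = begin
    n ! * (suc n * rise t (suc n)) ≡⟨ *-assoc (n !) (suc n) _ ⟨
    n ! * suc n * rise t (suc n)   ≡⟨ cong (_* rise t (suc n)) (*-comm (n !) (suc n)) ⟩
    (suc n) ! * rise t (suc n)     ≡⟨ rise-! t (suc n) ⟩
    (suc n + t) !                  ≡⟨ cong _! (sym (+-suc n t)) ⟩
    (n + suc t) !                  ∎
    where open ≡-Reasoning

  ρ-! : ∀ x → x ≤ K → + (x !) *ᶻ ρ x 0 ≡ K!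
  ρ-! x p = begin
    + (x !) *ᶻ + rise (K ∸ x) x ≡⟨ ℤP.pos-* (x !) _ ⟨
    + (x ! * rise (K ∸ x) x)    ≡⟨ cong +_ (rise-! (K ∸ x) x) ⟩
    + ((x + (K ∸ x)) !)         ≡⟨ cong (λ n → + (n !)) (m+[n∸m]≡n p) ⟩
    + (K !)                     ≡⟨ cong +_ (trans (sym (rise-! K 0)) (+-identityʳ (rise K 0))) ⟩
    K!                          ∎
    where open ≡-Reasoning

  rise-≢0 : ∀ t n → + rise t n ≢ 0ℤ
  rise-≢0 zero    n ()
  rise-≢0 (suc t) n e = rise-≢0 t (suc n)
    (cancel-zero {+ suc n} (λ ()) (trans (sym (ℤP.pos-* (suc n) (rise t (suc n)))) e))

  K!² : ℤ
  K!² = K! *ᶻ K!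

  K!²≢0 : K!² ≢ 0ℤ
  K!²≢0 e = rise-≢0 K 0 (cancel-zero (rise-≢0 K 0) e)

  ρ-diag : ∀ x y → ρ (y + x) y ≡ ρ x 0
  ρ-diag x zero    = refl
  ρ-diag x (suc y) = ρ-diag x y

  ρ-< : ∀ {x y} → x < y → ρ x y ≡ 0ℤ
  ρ-< {zero}  (s≤s _) = refl
  ρ-< {suc x} (s≤s p) = ρ-< p

  difference≢0 : ∀ a b → a ≢ b → a −ᶻ b ≢ 0ℤ
  difference≢0 a b a≢b e = a≢b (ℤP.i-j≡0⇒i≡j a b e)

  β≢0 : ∀ i → i < dbl q → β (suc i) ≢ 0ℤ
  β≢0 i p = *-≢0 (+ suc i *ᶻ (+ suc i +ᶻ + 2 *ᶻ + q +ᶻ + 3)) (+ suc i −ᶻ (+ 2 *ᶻ + q +ᶻ + 1))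
    (*-≢0 (+ suc i) (+ suc i +ᶻ + 2 *ᶻ + q +ᶻ + 3) (λ ()) (λ ()))
    (difference≢0 (+ suc i) (+ 2 *ᶻ + q +ᶻ + 1) different)
    where
    different : + suc i ≢ + 2 *ᶻ + q +ᶻ + 1
    different e = n≮n (dbl q) (subst (_< dbl q) i≡ p)
      where
      i≡ : i ≡ dbl q
      i≡ = suc-injective (ℤP.+-injective (trans e (trans (cong (_+ᶻ + 1) (sym (dbl-ℤ q)))
          (cong +_ (+-comm (dbl q) 1)))))

  q≤dbl : q ≤ dbl q
  q≤dbl = subst (q ≤_) (sym (dbl-+ q)) (m≤m+n q q)

  -- Descent from `q`: there `α` vanishes and `β` does not, so the recurrence kills `total q`, and
  -- then each sum kills the one below it, down to index 1.
  total-0 : ∀ d i → suc i + d ≡ q → total (suc i) ≡ 0ℤ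
  total-0 d i e = cancel-zero (β≢0 i i<) (trans (sym (ℤP.+-identityˡ _))
    (trans (cong (_+ᶻ β (suc i) *ᶻ total (suc i)) (sym (first d e))) (total-rec (suc i) i<)))
    where
    i< : i < dbl q
    i< = ≤-trans (subst (suc i ≤_) e (m≤m+n (suc i) d)) q≤dbl
    first : ∀ d → suc i + d ≡ q → α (suc i) *ᶻ total (suc (suc i)) ≡ 0ℤ
    first zero    e = trans (cong (λ k → α k *ᶻ total (suc k)) (trans (sym (+-identityʳ (suc i))) e))
        (zero-factor (+ q) (total (suc q)))
      where
      zero-factor : ∀ i t → + 2 *ᶻ (+ 2 *ᶻ i +ᶻ + 3) *ᶻ (i −ᶻ i) *ᶻ (i +ᶻ i +ᶻ + 2) *ᶻ t ≡ 0ℤ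
      zero-factor = solve-∀
    first (suc d) e = trans (cong (α (suc i) *ᶻ_) (total-0 d (suc i) (trans (sym (+-suc (suc i) d)) e)))
      (ℤP.*-zeroʳ (α (suc i)))

  -- Here the sum has a single term: `ρ (2j + 1) (2q + 1)` is 0 for `j < q`. In the term `j = q` the
  -- factor `3q + 2` of `coef q` completes `(3q + 1)!` to `(3q + 2)!`, which cancels against `ρ`.
  total-top : total (suc (dbl q)) ≡ weight q *ᶻ K!²
  total-top = begin
    sumBelow (term (suc (dbl q))) q +ᶻ term (suc (dbl q)) q
      ≡⟨ cong₂ _+ᶻ_ (sumBelow-0 q (λ j j<q → lower j j<q)) refl ⟩
    0ℤ +ᶻ coef q *ᶻ (+ ((suc (dbl q) + q) !) *ᶻ (ρ (dbl q) (dbl q) *ᶻ ρ (dbl (suc (dbl q))) q))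
      ≡⟨ cong₂ (λ s t → 0ℤ +ᶻ coef q *ᶻ (+ ((suc (dbl q) + q) !) *ᶻ (s *ᶻ t))) diagonal
          (trans (cong (λ k → ρ k q) split) (ρ-diag (suc N) q)) ⟩
    0ℤ +ᶻ coef q *ᶻ (+ (N !) *ᶻ (K! *ᶻ ρ (suc N) 0))
      ≡⟨ collect (+ 3 *ᶻ + q +ᶻ + 2) (weight q) (+ (N !)) K! (ρ (suc N) 0) ⟩
    weight q *ᶻ (K! *ᶻ ((+ 3 *ᶻ + q +ᶻ + 2) *ᶻ + (N !) *ᶻ ρ (suc N) 0))
      ≡⟨ cong (λ t → weight q *ᶻ (K! *ᶻ (t *ᶻ ρ (suc N) 0))) (trans (cong (_*ᶻ + (N !)) top)
          (sym (ℤP.pos-* (suc N) (N !)))) ⟩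
    weight q *ᶻ (K! *ᶻ (+ ((suc N) !) *ᶻ ρ (suc N) 0))
      ≡⟨ cong (λ t → weight q *ᶻ (K! *ᶻ t)) (ρ-! (suc N) N≤K) ⟩
    weight q *ᶻ K!² ∎
    where
    open ≡-Reasoning
    N : ℕ
    N = suc (dbl q) + q
    lower : ∀ j → j < q → term (suc (dbl q)) j ≡ 0ℤ
    lower j j<q = trans (cong (λ t → coef j *ᶻ (+ ((suc (dbl q) + j) !) *ᶻ (t *ᶻ ρ (dbl (suc (dbl q))) j)))
      (ρ-< {suc (dbl j)} {suc (dbl q)} (s≤s (≤-trans (n≤1+n _) (dbl-mono j<q)))))
      (zeros (coef j) (+ ((suc (dbl q) + j) !)) (ρ (dbl (suc (dbl q))) j))
      where
      zeros : ∀ c f r → c *ᶻ (f *ᶻ (0ℤ *ᶻ r)) ≡ 0ℤ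
      zeros = solve-∀
    diagonal : ρ (dbl q) (dbl q) ≡ K!
    diagonal = trans (cong (λ k → ρ k (dbl q)) (sym (+-identityʳ (dbl q)))) (ρ-diag 0 (dbl q))
    split : dbl (suc (dbl q)) ≡ q + suc N
    split = begin
      suc (suc (dbl (dbl q)))           ≡⟨ cong (λ k → suc (suc k)) (dbl-+ (dbl q)) ⟩
      suc (suc (dbl q + dbl q))         ≡⟨ cong (λ k → suc (suc (dbl q + k))) (dbl-+ q) ⟩
      suc (suc (dbl q + (q + q)))       ≡⟨ cong (λ k → suc (suc k)) (sym (+-assoc (dbl q) q q)) ⟩
      suc N + q                         ≡⟨ +-comm (suc N) q ⟩
      q + suc N                         ∎
    top : + 3 *ᶻ + q +ᶻ + 2 ≡ + suc N
    top = trans (shape (+ q)) (cong (λ t → + 2 +ᶻ t +ᶻ + q) (sym (dbl-ℤ q)))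
      where
      shape : ∀ q → + 3 *ᶻ q +ᶻ + 2 ≡ + 2 +ᶻ + 2 *ᶻ q +ᶻ q
      shape = solve-∀
    N≤K : suc N ≤ K
    N≤K = ≤-trans (m≤n+m (suc N) q) (subst (_≤ K) split (dbl-mono (n≤1+n (suc (dbl q)))))
    collect : ∀ c w f k r → 0ℤ +ᶻ c *ᶻ w *ᶻ (f *ᶻ (k *ᶻ r)) ≡ w *ᶻ (k *ᶻ (c *ᶻ f *ᶻ r))
    collect = solve-∀

  -- The pairing with `u^(q+1)` involves `total (q + 1)`, whereas the value known in closed form is
  -- `total (2q + 1)`. The products stay on opposite sides to avoid division.
  total-climb : ∀ n → n ≤ q →
    prodUpTo (λ t → -ᶻ β (suc q + t)) n *ᶻ total (suc q) ≡ prodUpTo (λ t → α (suc q + t)) n *ᶻ total (suc q + n)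
  total-climb zero    p = cong (λ k → 1ℤ *ᶻ total k) (sym (+-identityʳ (suc q)))
  total-climb (suc n) p = begin
    b *ᶻ (-ᶻ β i) *ᶻ total (suc q)    ≡⟨ move b (-ᶻ β i) (total (suc q)) ⟩
    (-ᶻ β i) *ᶻ (b *ᶻ total (suc q))  ≡⟨ cong ((-ᶻ β i) *ᶻ_) (total-climb n (<⇒≤ p)) ⟩
    (-ᶻ β i) *ᶻ (a *ᶻ total i)        ≡⟨ solve-β (α i *ᶻ total (suc i)) (β i) a (total i) ⟩
    a *ᶻ (α i *ᶻ total (suc i)) −ᶻ a *ᶻ (α i *ᶻ total (suc i) +ᶻ β i *ᶻ total i)
      ≡⟨ cong (λ t → a *ᶻ (α i *ᶻ total (suc i)) −ᶻ a *ᶻ t) (total-rec i i≤) ⟩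
    a *ᶻ (α i *ᶻ total (suc i)) −ᶻ a *ᶻ 0ℤ ≡⟨ finish a (α i) (total (suc i)) ⟩
    a *ᶻ α i *ᶻ total (suc i)         ≡⟨ cong (λ k → a *ᶻ α i *ᶻ total k) (sym (+-suc (suc q) n)) ⟩
    a *ᶻ α i *ᶻ total (suc q + suc n) ∎
    where
    open ≡-Reasoning
    i : ℕ
    i = suc q + n
    i≤ : i ≤ dbl q
    i≤ = subst (i ≤_) (sym (dbl-+ q)) (subst (_≤ q + q) (+-suc q n) (+-monoʳ-≤ q p))
    a b : ℤ
    a = prodUpTo (λ t → α (suc q + t)) n
    b = prodUpTo (λ t → -ᶻ β (suc q + t)) n
    move : ∀ b c t → b *ᶻ c *ᶻ t ≡ c *ᶻ (b *ᶻ t)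
    move = solve-∀
    solve-β : ∀ s c a t → (-ᶻ c) *ᶻ (a *ᶻ t) ≡ a *ᶻ s −ᶻ a *ᶻ (s +ᶻ c *ᶻ t)
    solve-β = solve-∀
    finish : ∀ a c t → a *ᶻ (c *ᶻ t) −ᶻ a *ᶻ 0ℤ ≡ a *ᶻ c *ᶻ t
    finish = solve-∀

  weight≢0 : weight q ≢ 0ℤ
  weight≢0 = *-≢0 (prodUpTo up q) (prodRange down q (q ∸ q)) (prodUpTo-≢0 up q up≢0)
      (subst (λ k → prodRange down q k ≢ 0ℤ) (sym (n∸n≡0 q)) λ ())
    where
    up≢0 : ∀ t → t < q → up t ≢ 0ℤ
    up≢0 t t<q = *-≢0 ((-ᶻ + 2) *ᶻ (+ q −ᶻ + t) *ᶻ (+ q +ᶻ + t +ᶻ + 2)) (+ 2 *ᶻ + t +ᶻ + 1)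
      (*-≢0 ((-ᶻ + 2) *ᶻ (+ q −ᶻ + t)) (+ q +ᶻ + t +ᶻ + 2)
        (*-≢0 (-ᶻ + 2) (+ q −ᶻ + t) (λ ())
          (difference≢0 (+ q) (+ t) (λ e → n≮n q (subst (_< q) (sym (ℤP.+-injective e)) t<q))))
        (λ ()))
      (λ e → m<n⇒n≢0 (m≤n+m 1 (2 * t)) (ℤP.+-injective (trans (cong (_+ᶻ + 1) (ℤP.pos-* 2 t)) e)))

  coef≢0 : coef q ≢ 0ℤ
  coef≢0 = *-≢0 (+ 3 *ᶻ + q +ᶻ + 2) (weight q) (λ ()) weight≢0

  g : LPoly
  g = combo coef (suc q)

  B-u-g : ∀ k → B (u k) g ≡ sumBelow (λ j → coef j *ᶻ B (u k) (u j)) (suc q)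
  B-u-g k = begin
    B (u k) g                                          ≡⟨ B-anti (u k) g ⟩
    -ᶻ B g (u k)                                       ≡⟨ cong -ᶻ_ (B-combo coef (suc q) (u k)) ⟩
    -ᶻ sumBelow (λ j → coef j *ᶻ B (u j) (u k)) (suc q)  ≡⟨ minus
        (sumBelow (λ j → coef j *ᶻ B (u j) (u k)) (suc q)) (sumBelow coef (suc q)) ⟩
    ℤ.-1ℤ *ᶻ sumBelow (λ j → coef j *ᶻ B (u j) (u k)) (suc q) +ᶻ 0ℤ *ᶻ sumBelow coef (suc q)
      ≡⟨ sumBelow-lin ℤ.-1ℤ 0ℤ (λ j → coef j *ᶻ B (u j) (u k)) coef (suc q) ⟨
    sumBelow (λ j → ℤ.-1ℤ *ᶻ (coef j *ᶻ B (u j) (u k)) +ᶻ 0ℤ *ᶻ coef j) (suc q)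
      ≡⟨ sumBelow-cong (suc q) (λ j _ → trans (flip (coef j) (B (u j) (u k)))
          (cong (coef j *ᶻ_) (sym (B-anti (u k) (u j))))) ⟩
    sumBelow (λ j → coef j *ᶻ B (u k) (u j)) (suc q) ∎
    where
    open ≡-Reasoning
    minus : ∀ x y → -ᶻ x ≡ ℤ.-1ℤ *ᶻ x +ᶻ 0ℤ *ᶻ y
    minus = solve-∀
    flip : ∀ c b → ℤ.-1ℤ *ᶻ (c *ᶻ b) +ᶻ 0ℤ *ᶻ c ≡ c *ᶻ (-ᶻ b)
    flip = solve-∀

  B-step-g : ∀ i → i ≤ q →
    K!² *ᶻ B (u (suc i)) g ≡ + 2 *ᶻ (K!² *ᶻ B (u i) g) +ᶻ (+ 3 *ᶻ + suc i +ᶻ 1ℤ) *ᶻ total (suc i)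
  B-step-g i i≤ = begin
    K!² *ᶻ B (u (suc i)) g
      ≡⟨ cong (K!² *ᶻ_) (B-u-g (suc i)) ⟩
    K!² *ᶻ sumBelow b₁ (suc q)
      ≡⟨ only K!² (sumBelow b₁ (suc q)) ⟩
    K!² *ᶻ sumBelow b₁ (suc q) +ᶻ 0ℤ *ᶻ sumBelow b₁ (suc q)
      ≡⟨ sumBelow-lin K!² 0ℤ b₁ b₁ (suc q) ⟨
    sumBelow (λ j → K!² *ᶻ b₁ j +ᶻ 0ℤ *ᶻ b₁ j) (suc q)
      ≡⟨ sumBelow-cong (suc q) (λ j j<q → each j (≤-pred j<q)) ⟩
    sumBelow (λ j → (+ 2 *ᶻ K!²) *ᶻ b₀ j +ᶻ (+ 3 *ᶻ + suc i +ᶻ 1ℤ) *ᶻ term (suc i) j) (suc q)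
      ≡⟨ sumBelow-lin (+ 2 *ᶻ K!²) (+ 3 *ᶻ + suc i +ᶻ 1ℤ) b₀ (term (suc i)) (suc q) ⟩
    (+ 2 *ᶻ K!²) *ᶻ sumBelow b₀ (suc q) +ᶻ (+ 3 *ᶻ + suc i +ᶻ 1ℤ) *ᶻ total (suc i)
      ≡⟨ cong (_+ᶻ (+ 3 *ᶻ + suc i +ᶻ 1ℤ) *ᶻ total (suc i))
           (trans (cong ((+ 2 *ᶻ K!²) *ᶻ_) (sym (B-u-g i))) (ℤP.*-assoc (+ 2) K!² (B (u i) g))) ⟩
    + 2 *ᶻ (K!² *ᶻ B (u i) g) +ᶻ (+ 3 *ᶻ + suc i +ᶻ 1ℤ) *ᶻ total (suc i) ∎
    where
    open ≡-Reasoning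
    b₀ b₁ : ℕ → ℤ
    b₀ j = coef j *ᶻ B (u i) (u j)
    b₁ j = coef j *ᶻ B (u (suc i)) (u j)
    only : ∀ k s → k *ᶻ s ≡ k *ᶻ s +ᶻ 0ℤ *ᶻ s
    only = solve-∀
    boundᵢ : dbl (suc i) ≤ K
    boundᵢ = dbl-mono (≤-trans (s≤s i≤) (≤-trans (n≤1+n _) (s≤s (s≤s q≤dbl))))
    each : ∀ j → j ≤ q → K!² *ᶻ b₁ j +ᶻ 0ℤ *ᶻ b₁ j ≡ (+ 2 *ᶻ K!²) *ᶻ b₀ j +ᶻ (+ 3 *ᶻ + suc i +ᶻ 1ℤ) *ᶻ term (suc i) j
    each j j≤ = trans (pull K!² (coef j) (B (u (suc i)) (u j)))
      (trans (cong (coef j *ᶻ_) (B-difference-ρ i j boundᵢ boundⱼ))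
        (push (coef j) K!² (B (u i) (u j)) (+ 3 *ᶻ + suc i +ᶻ 1ℤ) _))
      where
      boundⱼ : suc (dbl j) ≤ K
      boundⱼ = ≤-trans (n≤1+n _) (dbl-mono (≤-trans (s≤s j≤) (s≤s (≤-trans (n≤1+n q) (s≤s q≤dbl)))))
      pull : ∀ k c b → k *ᶻ (c *ᶻ b) +ᶻ 0ℤ *ᶻ (c *ᶻ b) ≡ c *ᶻ (k *ᶻ b)
      pull = solve-∀
      push : ∀ c k b s t → c *ᶻ (+ 2 *ᶻ (k *ᶻ b) +ᶻ s *ᶻ t) ≡ (+ 2 *ᶻ k) *ᶻ (c *ᶻ b) +ᶻ s *ᶻ (c *ᶻ t)
      push = solve-∀

  X : ℤ
  X = B (u 0) g

  -- The sums `total 1, …, total q` vanish, so each step from `u^k` to `u^(k+1)` doubles the pairing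
  -- with `g` and `X` is the only unknown.
  B-u-g-power : ∀ k → k ≤ q → B (u k) g ≡ two^ k *ᶻ X
  B-u-g-power zero    p = sym (ℤP.*-identityˡ X)
  B-u-g-power (suc k) p = begin
    B (u (suc k)) g          ≡⟨ cancel ⟩
    + 2 *ᶻ B (u k) g         ≡⟨ cong (+ 2 *ᶻ_) (B-u-g-power k (<⇒≤ p)) ⟩
    + 2 *ᶻ (two^ k *ᶻ X)     ≡⟨ ℤP.*-assoc (+ 2) (two^ k) X ⟨
    two^ (suc k) *ᶻ X        ∎
    where
    open ≡-Reasoning
    isolate : ∀ c x y s → c *ᶻ x −ᶻ (+ 2 *ᶻ (c *ᶻ y) +ᶻ s *ᶻ 0ℤ) ≡ c *ᶻ (x −ᶻ + 2 *ᶻ y)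
    isolate = solve-∀
    cancel : B (u (suc k)) g ≡ + 2 *ᶻ B (u k) g
    cancel = ℤP.i-j≡0⇒i≡j _ _ (cancel-zero K!²≢0 (trans
      (sym (isolate K!² (B (u (suc k)) g) (B (u k) g) (+ 3 *ᶻ + suc k +ᶻ 1ℤ)))
      (trans (cong (λ t → K!² *ᶻ B (u (suc k)) g −ᶻ (+ 2 *ᶻ (K!² *ᶻ B (u k) g) +ᶻ (+ 3 *ᶻ + suc k +ᶻ 1ℤ) *ᶻ t))
          (sym (total-0 (q ∸ suc k) k (m+[n∸m]≡n p))))
        (ℤP.i≡j⇒i-j≡0 (B-step-g k (<⇒≤ p))))))

  sum-two^ : ℤ
  sum-two^ = sumBelow (λ j → coef j *ᶻ two^ j) (suc q)

  -- The left-hand side is B g g.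
  isotropic : sum-two^ *ᶻ X ≡ 0ℤ
  isotropic = begin
    sum-two^ *ᶻ X
      ≡⟨ commute sum-two^ X ⟩
    X *ᶻ sum-two^ +ᶻ 0ℤ *ᶻ sum-two^
      ≡⟨ sumBelow-lin X 0ℤ (λ j → coef j *ᶻ two^ j) (λ j → coef j *ᶻ two^ j) (suc q) ⟨
    sumBelow (λ j → X *ᶻ (coef j *ᶻ two^ j) +ᶻ 0ℤ *ᶻ (coef j *ᶻ two^ j)) (suc q)
      ≡⟨ sumBelow-cong (suc q) (λ j j<q → trans (regroup X (coef j) (two^ j))
          (cong (coef j *ᶻ_) (sym (B-u-g-power j (≤-pred j<q))))) ⟩
    sumBelow (λ j → coef j *ᶻ B (u j) g) (suc q)
      ≡⟨ B-combo coef (suc q) g ⟨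
    B g g
      ≡⟨ B-self g ⟩
    0ℤ ∎
    where
    open ≡-Reasoning
    commute : ∀ s x → s *ᶻ x ≡ x *ᶻ s +ᶻ 0ℤ *ᶻ s
    commute = solve-∀
    regroup : ∀ x c t → x *ᶻ (c *ᶻ t) +ᶻ 0ℤ *ᶻ (c *ᶻ t) ≡ c *ᶻ (t *ᶻ x)
    regroup = solve-∀

  -- The constant 1 pairs with itself to 0 and with `u^j` to `−2^j` for `j ≥ 1`, so only the term
  -- `j = 0` of `sum-two^` has to be corrected.
  X-value : X ≡ coef 0 −ᶻ sum-two^
  X-value = begin
    X                                                            ≡⟨ B-u-g 0 ⟩
    sumBelow (λ j → coef j *ᶻ B (u 0) (u j)) (suc q)             ≡⟨ partial q ⟩
    coef 0 −ᶻ sum-two^                                           ∎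
    where
    open ≡-Reasoning
    base : ∀ c → 0ℤ +ᶻ c *ᶻ 0ℤ ≡ c −ᶻ (0ℤ +ᶻ c *ᶻ 1ℤ)
    base = solve-∀
    step : ∀ c s d t → c −ᶻ s +ᶻ d *ᶻ (-ᶻ t) ≡ c −ᶻ (s +ᶻ d *ᶻ t)
    step = solve-∀
    partial : ∀ n → sumBelow (λ j → coef j *ᶻ B (u 0) (u j)) (suc n) ≡ coef 0 −ᶻ sumBelow (λ j → coef j *ᶻ two^ j)
        (suc n)
    partial zero    = base (coef 0)
    partial (suc n) = trans (cong₂ (λ s t → s +ᶻ coef (suc n) *ᶻ t) (partial n)
        (trans (B-anti (u 0) (u (suc n))) (cong -ᶻ_ (B-u-u0 n))))
      (step (coef 0) (sumBelow (λ j → coef j *ᶻ two^ j) (suc n)) (coef (suc n)) (two^ (suc n)))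

  -- A combination of u^s, …, u^q that is B-orthogonal to u^s, …, u^q.
  record Annihilating (s : ℕ) : Set where
    field
      κ        : ℕ → ℤ
      leading  : κ q ≡ coef q
      low      : ∀ j → j < s → κ j ≡ 0ℤ
      vanishes : ∀ k → s ≤ k → k ≤ q → B (u k) (combo κ (suc q)) ≡ 0ℤ
      next     : K!² *ᶻ B (u (suc q)) (combo κ (suc q)) ≡ (+ 3 *ᶻ + suc q +ᶻ 1ℤ) *ᶻ total (suc q)

  from-g : X ≡ 0ℤ → Annihilating 0
  from-g X≡0 = record
    { κ = coef ; leading = refl ; low = λ _ () ; vanishes = λ k _ → van k
    ; next = trans (B-step-g q ≤-refl) (trans (cong (λ t → + 2 *ᶻ (K!² *ᶻ t) +ᶻ (+ 3 *ᶻ + suc q +ᶻ 1ℤ) *ᶻ total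
        (suc q)) (van q ≤-refl))
        (discard K!² _)) }
    where
    van : ∀ k → k ≤ q → B (u k) g ≡ 0ℤ
    van k p = trans (B-u-g-power k p) (trans (cong (two^ k *ᶻ_) X≡0) (ℤP.*-zeroʳ (two^ k)))
    discard : ∀ k s → + 2 *ᶻ (k *ᶻ 0ℤ) +ᶻ s ≡ s
    discard = solve-∀

  constant-free : ℕ → ℤ
  constant-free zero    = 0ℤ
  constant-free (suc j) = coef (suc j)

  B-constant-free : ∀ h n → B (combo coef (suc n)) h ≡ B (combo constant-free (suc n)) h +ᶻ coef 0 *ᶻ B (u 0) h
  B-constant-free h n = trans (B-combo coef (suc n) h) (trans (go n)
    (cong (_+ᶻ coef 0 *ᶻ B (u 0) h) (sym (B-combo constant-free (suc n) h))))
    where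
    base : ∀ c b → 0ℤ +ᶻ c *ᶻ b ≡ 0ℤ +ᶻ 0ℤ *ᶻ b +ᶻ c *ᶻ b
    base = solve-∀
    step : ∀ s t d → s +ᶻ t +ᶻ d ≡ s +ᶻ d +ᶻ t
    step = solve-∀
    go : ∀ n → sumBelow (λ j → coef j *ᶻ B (u j) h) (suc n)
             ≡ sumBelow (λ j → constant-free j *ᶻ B (u j) h) (suc n) +ᶻ coef 0 *ᶻ B (u 0) h
    go zero    = base (coef 0) (B (u 0) h)
    go (suc n) = trans (cong (_+ᶻ coef (suc n) *ᶻ B (u (suc n)) h) (go n))
      (step (sumBelow (λ j → constant-free j *ᶻ B (u j) h) (suc n)) (coef 0 *ᶻ B (u 0) h)
          (coef (suc n) *ᶻ B (u (suc n)) h))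

  -- In this case `X = coef 0`. Then `g` has with `u^k`, `k ≥ 1`, the pairing `2^k coef 0`, which is
  -- precisely that of its own constant term; dropping that term leaves 0.
  from-g-constant-free : sum-two^ ≡ 0ℤ → Annihilating 1
  from-g-constant-free s≡0 = record
    { κ = constant-free ; leading = refl ; low = λ { zero _ → refl ; (suc _) (s≤s ()) }
    ; vanishes = λ { (suc k) _ p → trans (relate k) (trans (cong (_−ᶻ coef 0 *ᶻ two^ (suc k))
        (trans (B-u-g-power (suc k) p) (cong (two^ (suc k) *ᶻ_) X≡c))) (same (two^ (suc k)) (coef 0))) }
    ; next = trans (cong (K!² *ᶻ_) (relate q)) (trans (expandᵣ K!² (B (u (suc q)) g) (coef 0 *ᶻ two^ (suc q)))
        (trans (cong (_−ᶻ K!² *ᶻ (coef 0 *ᶻ two^ (suc q))) (trans (B-step-g q ≤-refl)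
          (cong (λ t → + 2 *ᶻ (K!² *ᶻ t) +ᶻ (+ 3 *ᶻ + suc q +ᶻ 1ℤ) *ᶻ total (suc q))
            (trans (B-u-g-power q ≤-refl) (cong (two^ q *ᶻ_) X≡c)))))
          (discard K!² (two^ q) (coef 0) _))) }
    where
    X≡c : X ≡ coef 0
    X≡c = trans X-value (trans (cong (λ t → coef 0 −ᶻ t) s≡0) (ℤP.+-identityʳ (coef 0)))
    g′ : LPoly
    g′ = combo constant-free (suc q)
    relate : ∀ k → B (u (suc k)) g′ ≡ B (u (suc k)) g −ᶻ coef 0 *ᶻ two^ (suc k)
    relate k = trans (B-anti (u (suc k)) g′) (trans (solve-g′ (B g′ (u (suc k))) (coef 0 *ᶻ B (u 0) (u (suc k))))
      (cong₂ (λ s t → s −ᶻ t)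
        (trans (cong -ᶻ_ (sym (B-constant-free (u (suc k)) q))) (sym (B-anti (u (suc k)) g)))
        (trans (neg-mul (coef 0) (B (u 0) (u (suc k)))) (cong (coef 0 *ᶻ_)
            (trans (sym (B-anti (u (suc k)) (u 0))) (B-u-u0 k))))))
      where
      solve-g′ : ∀ b c → -ᶻ b ≡ -ᶻ (b +ᶻ c) −ᶻ (-ᶻ c)
      solve-g′ = solve-∀
      neg-mul : ∀ c b → -ᶻ (c *ᶻ b) ≡ c *ᶻ (-ᶻ b)
      neg-mul = solve-∀
    same : ∀ t c → t *ᶻ c −ᶻ c *ᶻ t ≡ 0ℤ
    same = solve-∀
    expandᵣ : ∀ k b c → k *ᶻ (b −ᶻ c) ≡ k *ᶻ b −ᶻ k *ᶻ c
    expandᵣ = solve-∀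
    discard : ∀ k t c s → + 2 *ᶻ (k *ᶻ (t *ᶻ c)) +ᶻ s −ᶻ k *ᶻ (c *ᶻ (+ 2 *ᶻ t)) ≡ s
    discard = solve-∀

  dichotomy : Annihilating 0 ⊎ Annihilating 1
  dichotomy = [ inj₂ ∘ from-g-constant-free , inj₁ ∘ from-g ]′ (ℤP.i*j≡0⇒i≡0∨j≡0 sum-two^ isotropic)

  start-dichotomy : Annihilating (start q) ⊎ Annihilating (start (suc q))
  start-dichotomy = go q
    where
    go : ∀ m → Annihilating (start m) ⊎ Annihilating (start (suc m))
    go zero          = dichotomy
    go (suc zero)    = swap dichotomy
    go (suc (suc m)) = go m

  open Annihilating

  null : ∀ {s} (a : Annihilating s) k → s ≤ k → k ≤ q → B (combo (κ a) (suc q)) (u k) ≡ 0ℤ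
  null a k p p′ = trans (B-anti (combo (κ a) (suc q)) (u k)) (cong -ᶻ_ (vanishes a k p p′))

  -- For this parity the annihilating combination can take the place of the first argument `u^q`,
  -- and it is orthogonal to all the other arguments.
  wrong-parity : Annihilating (start (suc q)) → magogPf (suc q) ≡ 0ℤ
  wrong-parity a = cancel-zero {coef q} coef≢0 (begin
    coef q *ᶻ Pf k (u q ∷ u q-1 ∷ powers q-1)
      ≡⟨ cong (_*ᶻ Pf k (u q ∷ u q-1 ∷ powers q-1)) (leading a) ⟨
    κ a q *ᶻ Pf k (u q ∷ u q-1 ∷ powers q-1)
      ≡⟨ Pf-combo k (κ a) q [] (u q-1 ∷ powers q-1) dependent ⟨
    Pf k (combo (κ a) (suc q) ∷ u q-1 ∷ powers q-1)
      ≡⟨ Pf-null k (combo (κ a) (suc q)) (u q-1 ∷ powers q-1) (null a q-1 (start≤ q-1) (n≤1+n q-1) ∷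
           All-powers q-1 (λ j p p′ → null a j p (≤-trans (<⇒≤ p′) (n≤1+n q-1)))) ⟩
    0ℤ ∎)
    where
    open ≡-Reasoning
    k : ℕ
    k = suc (half q-1)
    dependent : ∀ j → j < q → κ a j ≡ 0ℤ ⊎ u j ∈ u q-1 ∷ powers q-1
    dependent j (s≤s j≤) = [ (λ j< → [ (λ j<s → inj₁ (low a j j<s)) ,
        (λ s≤j → inj₂ (there (∈-powers q-1 j s≤j j<))) ]′ (<-≤-connex j (start q-1)))
                           , (λ j≡ → inj₂ (here (cong u j≡))) ]′ (m≤n⇒m<n∨m≡n j≤)

  -- Here `u^q` is the second argument. Its replacement pairs nontrivially at most with the first
  -- argument `u^(q+1)`, and removing this pair leaves the Pfaffian for `q`.
  magog-step : Annihilating (start q) →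
    K!² *ᶻ (coef q *ᶻ magogPf (suc (suc q))) ≡ (+ 3 *ᶻ + suc q +ᶻ 1ℤ) *ᶻ total (suc q) *ᶻ magogPf q
  magog-step a = begin
    K!² *ᶻ (coef q *ᶻ Pf (suc k) (u (suc q) ∷ u q ∷ powers q))
      ≡⟨ cong (λ t → K!² *ᶻ (t *ᶻ Pf (suc k) (u (suc q) ∷ u q ∷ powers q))) (leading a) ⟨
    K!² *ᶻ (κ a q *ᶻ Pf (suc k) (u (suc q) ∷ u q ∷ powers q))
      ≡⟨ cong (K!² *ᶻ_) (Pf-combo (suc k) (κ a) q (u (suc q) ∷ []) (powers q) dependent) ⟨
    K!² *ᶻ (B (u (suc q)) g₁ *ᶻ Pf k (powers q) −ᶻ contract (u (suc q)) (λ hs → Pf k (g₁ ∷ hs)) (powers q))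
      ≡⟨ cong (λ t → K!² *ᶻ (B (u (suc q)) g₁ *ᶻ Pf k (powers q) −ᶻ t))
           (contract-annihilated (u (suc q)) g₁ (powers q) (Pf-null k g₁)
             (All-powers q (λ j p p′ → null a j p (<⇒≤ p′)))) ⟩
    K!² *ᶻ (B (u (suc q)) g₁ *ᶻ Pf k (powers q) −ᶻ 0ℤ)
      ≡⟨ regroup K!² (B (u (suc q)) g₁) (Pf k (powers q)) ⟩
    K!² *ᶻ B (u (suc q)) g₁ *ᶻ magogPf q
      ≡⟨ cong (_*ᶻ magogPf q) (next a) ⟩
    (+ 3 *ᶻ + suc q +ᶻ 1ℤ) *ᶻ total (suc q) *ᶻ magogPf q ∎
    where
    open ≡-Reasoning
    k : ℕ
    k = half q
    g₁ : LPoly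
    g₁ = combo (κ a) (suc q)
    regroup : ∀ k b p → k *ᶻ (b *ᶻ p −ᶻ 0ℤ) ≡ k *ᶻ b *ᶻ p
    regroup = solve-∀
    dependent : ∀ j → j < q → κ a j ≡ 0ℤ ⊎ u j ∈ powers q
    dependent j j< = [ (λ j<s → inj₁ (low a j j<s)) , (λ s≤j → inj₂ (∈-powers q j s≤j j<)) ]′ (<-≤-connex j (start q))

  magog-recurrence : magogPf (suc q) ≢ 0ℤ →
    prodUpTo (λ t → -ᶻ β (suc q + t)) q *ᶻ (+ 3 *ᶻ + q +ᶻ + 2) *ᶻ magogPf (suc (suc q))
    ≡ prodUpTo (λ t → α (suc q + t)) q *ᶻ (+ 3 *ᶻ + suc q +ᶻ 1ℤ) *ᶻ magogPf q
  magog-recurrence nz = [ solve , (λ a → ⊥-elim (nz (wrong-parity a))) ]′ start-dichotomy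
    where
    open ≡-Reasoning
    b c p s : ℤ
    b = prodUpTo (λ t → -ᶻ β (suc q + t)) q
    c = + 3 *ᶻ + q +ᶻ + 2
    p = prodUpTo (λ t → α (suc q + t)) q
    s = + 3 *ᶻ + suc q +ᶻ 1ℤ
    top : total (suc q + q) ≡ weight q *ᶻ K!²
    top = trans (cong (λ k → total (suc k)) (sym (dbl-+ q))) total-top
    spread : ∀ w k b c m p s n → w *ᶻ k *ᶻ (b *ᶻ c *ᶻ m −ᶻ p *ᶻ s *ᶻ n)
                               ≡ b *ᶻ (k *ᶻ (c *ᶻ w *ᶻ m)) −ᶻ p *ᶻ (w *ᶻ k) *ᶻ s *ᶻ n
    spread = solve-∀
    gather : ∀ b s t m p → b *ᶻ (s *ᶻ t *ᶻ m) −ᶻ p *ᶻ s *ᶻ m ≡ (b *ᶻ t −ᶻ p) *ᶻ (s *ᶻ m)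
    gather = solve-∀
    solve : Annihilating (start q) → b *ᶻ c *ᶻ magogPf (suc (suc q)) ≡ p *ᶻ s *ᶻ magogPf q
    solve a = ℤP.i-j≡0⇒i≡j _ _ (cancel-zero {weight q *ᶻ K!²} (*-≢0 (weight q) K!² weight≢0 K!²≢0) (begin
      weight q *ᶻ K!² *ᶻ (b *ᶻ c *ᶻ magogPf (suc (suc q)) −ᶻ p *ᶻ s *ᶻ magogPf q)
        ≡⟨ spread (weight q) K!² b c (magogPf (suc (suc q))) p s (magogPf q) ⟩
      b *ᶻ (K!² *ᶻ (c *ᶻ weight q *ᶻ magogPf (suc (suc q)))) −ᶻ p *ᶻ (weight q *ᶻ K!²) *ᶻ s *ᶻ magogPf q
        ≡⟨ cong₂ (λ x y → b *ᶻ x −ᶻ p *ᶻ y *ᶻ s *ᶻ magogPf q) (magog-step a) (sym top) ⟩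
      b *ᶻ (s *ᶻ total (suc q) *ᶻ magogPf q) −ᶻ p *ᶻ total (suc q + q) *ᶻ s *ᶻ magogPf q
        ≡⟨ gather b s (total (suc q)) (magogPf q) (p *ᶻ total (suc q + q)) ⟩
      (b *ᶻ total (suc q) −ᶻ p *ᶻ total (suc q + q)) *ᶻ (s *ᶻ magogPf q)
        ≡⟨ cong (_*ᶻ (s *ᶻ magogPf q)) (ℤP.i≡j⇒i-j≡0 (total-climb q ≤-refl)) ⟩
      0ℤ ∎))

-- From the recurrence to the product formula

fact : ℕ → ℤ
fact n = + (n !)

fact-suc : ∀ n → fact (suc n) ≡ (+ 1 +ᶻ + n) *ᶻ fact n
fact-suc n = ℤP.pos-* (suc n) (n !)

fact≢0 : ∀ n → fact n ≢ 0ℤ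
fact≢0 zero    ()
fact≢0 (suc n) e = fact≢0 n (cancel-zero {+ suc n} (λ ()) (trans (sym (fact-suc n)) e))

prodBelow-suc : ∀ m f → + prodBelow (suc m) f ≡ + prodBelow m f *ᶻ + f m
prodBelow-suc m f = trans (cong +_ (begin
  product (map f (upTo (suc m)))              ≡⟨ cong (λ l → product (map f l)) (upTo-∷ʳ m) ⟨
  product (map f (upTo m ++ m ∷ []))          ≡⟨ cong product (map-++ f (upTo m) (m ∷ [])) ⟩
  product (map f (upTo m) ++ f m ∷ [])        ≡⟨ product-++ (map f (upTo m)) (f m ∷ []) ⟩
  prodBelow m f * (f m * 1)                   ≡⟨ cong (prodBelow m f *_) (*-identityʳ (f m)) ⟩
  prodBelow m f * f m                         ∎)) (ℤP.pos-* (prodBelow m f) (f m))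
  where
  open ≡-Reasoning
  open import Data.Nat.ListAction using (product)

numerator : ℕ → ℤ
numerator m = + prodBelow m (λ j → (3 * j + 1) !)

factorials : ℕ → ℕ → ℤ
factorials s l = + prodBelow l (λ j → (s + j) !)

factorials-suc : ∀ s l → factorials s (suc l) ≡ factorials s l *ᶻ fact (s + l)
factorials-suc s l = prodBelow-suc l (λ j → (s + j) !)

factorials-head : ∀ s l → factorials s (suc l) ≡ fact s *ᶻ factorials (suc s) l
factorials-head s zero    = trans (factorials-suc s 0) (trans (cong (λ k → 1ℤ *ᶻ fact k) (+-identityʳ s))
    (ℤP.*-comm 1ℤ (fact s)))
factorials-head s (suc l) = begin
  factorials s (suc (suc l))                            ≡⟨ factorials-suc s (suc l) ⟩
  factorials s (suc l) *ᶻ fact (s + suc l)              ≡⟨ cong₂ _*ᶻ_ (factorials-head s l) (cong fact (+-suc s l)) ⟩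
  fact s *ᶻ factorials (suc s) l *ᶻ fact (suc s + l)    ≡⟨ ℤP.*-assoc (fact s) _ _ ⟩
  fact s *ᶻ (factorials (suc s) l *ᶻ fact (suc s + l))  ≡⟨ cong (fact s *ᶻ_) (factorials-suc (suc s) l) ⟨
  fact s *ᶻ factorials (suc s) (suc l)                  ∎
  where open ≡-Reasoning

denominator : ℕ → ℤ
denominator m = factorials m m

-- Both sides are the product of `(q + j)!` over `j < q + 4`, once with its first two and once with
-- its last four factors split off.
denominator-step : ∀ q → fact q *ᶻ (fact (suc q) *ᶻ denominator (suc (suc q))) ≡
  denominator q *ᶻ fact (q + q) *ᶻ fact (suc (q + q)) *ᶻ fact (suc (suc (q + q))) *ᶻ fact (suc (suc (suc (q + q))))
denominator-step q = begin
  fact q *ᶻ (fact (suc q) *ᶻ factorials (suc (suc q)) (suc (suc q)))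
    ≡⟨ cong (fact q *ᶻ_) (factorials-head (suc q) (suc (suc q))) ⟨
  fact q *ᶻ factorials (suc q) (suc (suc (suc q)))
    ≡⟨ factorials-head q (suc (suc (suc q))) ⟨
  factorials q (suc (suc (suc (suc q))))
    ≡⟨ append (suc (suc (suc q))) 3 refl ⟩
  factorials q (suc (suc (suc q))) *ᶻ fact (3 + (q + q))
    ≡⟨ cong (_*ᶻ fact (3 + (q + q))) (append (suc (suc q)) 2 refl) ⟩
  factorials q (suc (suc q)) *ᶻ fact (2 + (q + q)) *ᶻ fact (3 + (q + q))
    ≡⟨ cong (λ t → t *ᶻ fact (2 + (q + q)) *ᶻ fact (3 + (q + q))) (append (suc q) 1 refl) ⟩
  factorials q (suc q) *ᶻ fact (1 + (q + q)) *ᶻ fact (2 + (q + q)) *ᶻ fact (3 + (q + q))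
    ≡⟨ cong (λ t → t *ᶻ fact (1 + (q + q)) *ᶻ fact (2 + (q + q)) *ᶻ fact (3 + (q + q))) (factorials-suc q q) ⟩
  denominator q *ᶻ fact (q + q) *ᶻ fact (1 + (q + q)) *ᶻ fact (2 + (q + q)) *ᶻ fact (3 + (q + q)) ∎
  where
  open ≡-Reasoning
  append : ∀ l i → l ≡ i + q → factorials q (suc l) ≡ factorials q l *ᶻ fact (i + (q + q))
  append l i refl = trans (factorials-suc q l) (cong (λ k → factorials q l *ᶻ fact k)
    (trans (sym (+-assoc q i q)) (trans (cong (_+ q) (+-comm q i)) (+-assoc i q q))))

prodUpTo-cong : ∀ {f g} n → (∀ j → j < n → f j ≡ g j) → prodUpTo f n ≡ prodUpTo g n
prodUpTo-cong zero    e = refl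
prodUpTo-cong (suc n) e = cong₂ _*ᶻ_ (prodUpTo-cong n (λ j p → e j (m≤n⇒m≤1+n p))) (e n ≤-refl)

prodUpTo-* : ∀ f g n → prodUpTo (λ j → f j *ᶻ g j) n ≡ prodUpTo f n *ᶻ prodUpTo g n
prodUpTo-* f g zero    = refl
prodUpTo-* f g (suc n) = trans (cong (_*ᶻ (f n *ᶻ g n)) (prodUpTo-* f g n))
  (rearrange (prodUpTo f n) (prodUpTo g n) (f n) (g n))
  where
  rearrange : ∀ a b c d → a *ᶻ b *ᶻ (c *ᶻ d) ≡ (a *ᶻ c) *ᶻ (b *ᶻ d)
  rearrange = solve-∀

rising : ℕ → ℕ → ℤ
rising s = prodUpTo (λ t → + (suc s + t))

rising-fact : ∀ s n → rising s n *ᶻ fact s ≡ fact (s + n)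
rising-fact s zero    = trans (ℤP.*-identityˡ _) (cong fact (sym (+-identityʳ s)))
rising-fact s (suc n) = begin
  rising s n *ᶻ + (suc s + n) *ᶻ fact s      ≡⟨ rearrange (rising s n) (+ (suc s + n)) (fact s) ⟩
  + suc (s + n) *ᶻ (rising s n *ᶻ fact s)    ≡⟨ cong (+ suc (s + n) *ᶻ_) (rising-fact s n) ⟩
  + suc (s + n) *ᶻ fact (s + n)              ≡⟨ fact-suc (s + n) ⟨
  fact (suc (s + n))                         ≡⟨ cong fact (sym (+-suc s n)) ⟩
  fact (s + suc n)                           ∎
  where
  open ≡-Reasoning
  rearrange : ∀ a b c → a *ᶻ b *ᶻ c ≡ b *ᶻ (a *ᶻ c)
  rearrange = solve-∀

falling-fact : ∀ q n → n ≤ q → prodUpTo (λ t → + q −ᶻ + t) n *ᶻ fact (q ∸ n) ≡ fact q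
falling-fact q zero    p = ℤP.*-identityˡ _
falling-fact q (suc n) p = begin
  f *ᶻ (+ q −ᶻ + n) *ᶻ fact (q ∸ suc n)       ≡⟨ cong (λ t → f *ᶻ t *ᶻ fact (q ∸ suc n))
      (trans (minus-≤ (<⇒≤ p)) (cong +_ (+-∸-assoc 1 p))) ⟩
  f *ᶻ + suc (q ∸ suc n) *ᶻ fact (q ∸ suc n)  ≡⟨ ℤP.*-assoc f _ _ ⟩
  f *ᶻ (+ suc (q ∸ suc n) *ᶻ fact (q ∸ suc n))  ≡⟨ cong (f *ᶻ_) (fact-suc (q ∸ suc n)) ⟨
  f *ᶻ fact (suc (q ∸ suc n))                 ≡⟨ cong (λ k → f *ᶻ fact k) (sym (+-∸-assoc 1 p)) ⟩
  f *ᶻ fact (q ∸ n)                           ≡⟨ falling-fact q n (<⇒≤ p) ⟩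
  fact q                                      ∎
  where
  open ≡-Reasoning
  f : ℤ
  f = prodUpTo (λ t → + q −ᶻ + t) n

odds : ℕ → ℕ → ℤ
odds q = prodUpTo (λ t → + 2 *ᶻ (+ 2 *ᶻ + q +ᶻ + 5 +ᶻ + 2 *ᶻ + t))

-- The even numbers missing between the odd ones are supplied by `rising`:
-- `2 (2q + 5 + 2t) (q + 2 + t)` is the product of the consecutive integers `2q + 4 + 2t` and
-- `2q + 5 + 2t`.
odds-fact : ∀ q n → odds q n *ᶻ (rising (suc q) n *ᶻ fact (3 + (q + q))) ≡ fact (3 + (q + q) + (n + n))
odds-fact q zero    = trans (ℤP.*-identityˡ _) (trans (ℤP.*-identityˡ _)
    (cong fact (sym (+-identityʳ (3 + (q + q))))))
odds-fact q (suc n) = begin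
  odds q n *ᶻ (+ 2 *ᶻ (+ 2 *ᶻ + q +ᶻ + 5 +ᶻ + 2 *ᶻ + n)) *ᶻ (rising (suc q) n *ᶻ + (suc (suc q) + n) *ᶻ fact
      (3 + (q + q)))
    ≡⟨ rearrange (odds q n) (rising (suc q) n) (fact (3 + (q + q))) (+ q) (+ n) ⟩
  (+ 1 +ᶻ (+ 1 +ᶻ N)) *ᶻ ((+ 1 +ᶻ N) *ᶻ (odds q n *ᶻ (rising (suc q) n *ᶻ fact (3 + (q + q)))))
    ≡⟨ cong (λ t → (+ 1 +ᶻ (+ 1 +ᶻ N)) *ᶻ ((+ 1 +ᶻ N) *ᶻ t)) (odds-fact q n) ⟩
  (+ 1 +ᶻ (+ 1 +ᶻ N)) *ᶻ ((+ 1 +ᶻ N) *ᶻ fact N′)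
    ≡⟨ cong ((+ 1 +ᶻ (+ 1 +ᶻ N)) *ᶻ_) (fact-suc N′) ⟨
  (+ 1 +ᶻ + suc N′) *ᶻ fact (suc N′)
    ≡⟨ fact-suc (suc N′) ⟨
  fact (suc (suc N′))
    ≡⟨ cong fact shape ⟩
  fact (3 + (q + q) + (suc n + suc n)) ∎
  where
  open ≡-Reasoning
  N′ : ℕ
  N′ = 3 + (q + q) + (n + n)
  N : ℤ
  N = + N′
  shape : suc (suc N′) ≡ 3 + (q + q) + (suc n + suc n)
  shape = sym (trans (+-suc (3 + (q + q)) (n + suc n)) (cong suc
      (trans (cong (λ k → 3 + (q + q) + k) (+-suc n n)) (+-suc (3 + (q + q)) (n + n)))))
  rearrange : ∀ o r f q n →
    o *ᶻ (+ 2 *ᶻ (+ 2 *ᶻ q +ᶻ + 5 +ᶻ + 2 *ᶻ n)) *ᶻ (r *ᶻ (+ 2 +ᶻ (q +ᶻ n)) *ᶻ f)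
    ≡ (+ 1 +ᶻ (+ 1 +ᶻ (+ 3 +ᶻ (q +ᶻ q) +ᶻ (n +ᶻ n)))) *ᶻ ((+ 1 +ᶻ (+ 3 +ᶻ (q +ᶻ q) +ᶻ (n +ᶻ n))) *ᶻ (o *ᶻ (r *ᶻ f)))
  rearrange = solve-∀

module _ (q-1 : ℕ) where
  private
    q : ℕ
    q = suc q-1
  open Annihilator q

  β-product : prodUpTo (λ t → -ᶻ β (suc q + t)) q ≡ rising q q *ᶻ rising (3 + (q + q + q)) q *ᶻ fact q
  β-product = begin
    prodUpTo (λ t → -ᶻ β (suc q + t)) q
      ≡⟨ prodUpTo-cong q (λ t _ → shape (+ q) (+ t)) ⟩
    prodUpTo (λ t → + (suc q + t) *ᶻ + (4 + (q + q + q) + t) *ᶻ (+ q −ᶻ + t)) q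
      ≡⟨ prodUpTo-* (λ t → + (suc q + t) *ᶻ + (4 + (q + q + q) + t)) (λ t → + q −ᶻ + t) q ⟩
    prodUpTo (λ t → + (suc q + t) *ᶻ + (4 + (q + q + q) + t)) q *ᶻ prodUpTo (λ t → + q −ᶻ + t) q
      ≡⟨ cong₂ _*ᶻ_ (prodUpTo-* (λ t → + (suc q + t)) (λ t → + (4 + (q + q + q) + t)) q)
           (trans (sym (ℤP.*-identityʳ _)) (trans (cong (λ k → prodUpTo (λ t → + q −ᶻ + t) q *ᶻ fact k)
               (sym (n∸n≡0 q))) (falling-fact q q ≤-refl))) ⟩
    rising q q *ᶻ rising (3 + (q + q + q)) q *ᶻ fact q ∎
    where
    open ≡-Reasoning
    shape : ∀ q t → -ᶻ ((+ 1 +ᶻ q +ᶻ t) *ᶻ (+ 1 +ᶻ q +ᶻ t +ᶻ + 2 *ᶻ q +ᶻ + 3) *ᶻ (+ 1 +ᶻ q +ᶻ t −ᶻ (+ 2 *ᶻ q +ᶻ + 1)))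
                  ≡ (+ 1 +ᶻ q +ᶻ t) *ᶻ (+ 4 +ᶻ (q +ᶻ q +ᶻ q) +ᶻ t) *ᶻ (q −ᶻ t)
    shape = solve-∀

  α-product : prodUpTo (λ t → α (suc q + t)) q ≡ odds q q *ᶻ fact q *ᶻ rising (2 + (q + q)) q
  α-product = begin
    prodUpTo (λ t → α (suc q + t)) q
      ≡⟨ prodUpTo-cong q (λ t _ → shape (+ q) (+ t)) ⟩
    prodUpTo (λ t → + 2 *ᶻ (+ 2 *ᶻ + q +ᶻ + 5 +ᶻ + 2 *ᶻ + t) *ᶻ + (1 + t) *ᶻ + (3 + (q + q) + t)) q
      ≡⟨ prodUpTo-* (λ t → + 2 *ᶻ (+ 2 *ᶻ + q +ᶻ + 5 +ᶻ + 2 *ᶻ + t) *ᶻ + (1 + t)) (λ t → + (3 + (q + q) + t)) q ⟩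
    prodUpTo (λ t → + 2 *ᶻ (+ 2 *ᶻ + q +ᶻ + 5 +ᶻ + 2 *ᶻ + t) *ᶻ + (1 + t)) q *ᶻ rising (2 + (q + q)) q
      ≡⟨ cong (_*ᶻ rising (2 + (q + q)) q) (trans (prodUpTo-* (λ t → + 2 *ᶻ (+ 2 *ᶻ + q +ᶻ + 5 +ᶻ + 2 *ᶻ + t))
          (λ t → + (1 + t)) q)
           (cong (odds q q *ᶻ_) (trans (sym (ℤP.*-identityʳ _)) (rising-fact 0 q)))) ⟩
    odds q q *ᶻ fact q *ᶻ rising (2 + (q + q)) q ∎
    where
    open ≡-Reasoning
    shape : ∀ q t → + 2 *ᶻ (+ 2 *ᶻ (+ 1 +ᶻ q +ᶻ t) +ᶻ + 3) *ᶻ (+ 1 +ᶻ q +ᶻ t −ᶻ q) *ᶻ (+ 1 +ᶻ q +ᶻ t +ᶻ q +ᶻ + 2)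
                  ≡ + 2 *ᶻ (+ 2 *ᶻ q +ᶻ + 5 +ᶻ + 2 *ᶻ t) *ᶻ (+ 1 +ᶻ t) *ᶻ (+ 3 +ᶻ (q +ᶻ q) +ᶻ t)
    shape = solve-∀

-- Each linear product becomes a quotient of factorials once it is multiplied by a suitable
-- factorial; a common nonzero multiple of both sides replaces all divisions.
product-step : ∀ q (T₀ T₂ : ℤ) →
  rising q q *ᶻ rising (3 + (q + q + q)) q *ᶻ fact q *ᶻ (+ 3 *ᶻ + q +ᶻ + 2) *ᶻ T₂
    ≡ odds q q *ᶻ fact q *ᶻ rising (2 + (q + q)) q *ᶻ (+ 3 *ᶻ + suc q +ᶻ 1ℤ) *ᶻ T₀ →
  T₀ *ᶻ denominator q ≡ numerator q → T₂ *ᶻ denominator (suc (suc q)) ≡ numerator (suc (suc q))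
product-step q T₀ T₂ rec ih = ℤP.*-cancelˡ-≡ M _ _ {{ℤ.≢-nonZero M≢0}} (begin
  M *ᶻ (T₂ *ᶻ denominator (suc (suc q)))
    ≡⟨ e₁ P₁ P₂ f₀ c₂ f₁ T₂ (denominator (suc (suc q))) ⟩
  P₁ *ᶻ P₂ *ᶻ f₀ *ᶻ c₂ *ᶻ T₂ *ᶻ (f₀ *ᶻ (f₁ *ᶻ denominator (suc (suc q))))
    ≡⟨ cong₂ _*ᶻ_ rec (denominator-step q) ⟩
  odds q q *ᶻ f₀ *ᶻ Q₃ *ᶻ c₄ *ᶻ T₀ *ᶻ (denominator q *ᶻ fact (q + q) *ᶻ fact (suc (q + q)) *ᶻ fact
      (suc (suc (q + q))) *ᶻ g₃)
    ≡⟨ cong₂ (λ x y → odds q q *ᶻ f₀ *ᶻ Q₃ *ᶻ c₄ *ᶻ T₀ *ᶻ (denominator q *ᶻ x *ᶻ y *ᶻ g₂ *ᶻ g₃))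
         (sym (rising-fact q q)) (sym (rising-fact (suc q) q)) ⟩
  odds q q *ᶻ f₀ *ᶻ Q₃ *ᶻ c₄ *ᶻ T₀ *ᶻ (denominator q *ᶻ (P₁ *ᶻ f₀) *ᶻ (Q₄ *ᶻ f₁) *ᶻ g₂ *ᶻ g₃)
    ≡⟨ e₂ (odds q q) f₀ Q₃ c₄ T₀ (denominator q) P₁ Q₄ f₁ g₂ g₃ ⟩
  f₀ *ᶻ f₀ *ᶻ f₁ *ᶻ c₄ *ᶻ P₁ *ᶻ (T₀ *ᶻ denominator q) *ᶻ (Q₃ *ᶻ g₂) *ᶻ (odds q q *ᶻ (Q₄ *ᶻ g₃))
    ≡⟨ cong₂ (λ x y → f₀ *ᶻ f₀ *ᶻ f₁ *ᶻ c₄ *ᶻ P₁ *ᶻ x *ᶻ (Q₃ *ᶻ g₂) *ᶻ y) ih odds≡ ⟩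
  f₀ *ᶻ f₀ *ᶻ f₁ *ᶻ c₄ *ᶻ P₁ *ᶻ numerator q *ᶻ (Q₃ *ᶻ g₂) *ᶻ (P₂ *ᶻ h₃)
    ≡⟨ cong (λ x → f₀ *ᶻ f₀ *ᶻ f₁ *ᶻ c₄ *ᶻ P₁ *ᶻ numerator q *ᶻ x *ᶻ (P₂ *ᶻ h₃)) Q₃≡ ⟩
  f₀ *ᶻ f₀ *ᶻ f₁ *ᶻ c₄ *ᶻ P₁ *ᶻ numerator q *ᶻ (c₂ *ᶻ h₁) *ᶻ (P₂ *ᶻ h₃)
    ≡⟨ e₃ f₀ f₁ c₄ P₁ (numerator q) c₂ h₁ P₂ h₃ ⟩
  M *ᶻ (numerator q *ᶻ h₁ *ᶻ (c₄ *ᶻ h₃))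
    ≡⟨ cong (M *ᶻ_) (sym numerator-step) ⟩
  M *ᶻ numerator (suc (suc q)) ∎)
  where
  open ≡-Reasoning
  f₀ f₁ g₂ g₃ h₁ h₃ c₂ c₄ P₁ P₂ Q₃ Q₄ M : ℤ
  f₀ = fact q
  f₁ = fact (suc q)
  g₂ = fact (2 + (q + q))
  g₃ = fact (3 + (q + q))
  h₁ = fact (1 + (q + q + q))
  h₃ = fact (3 + (q + q + q))
  c₂ = + 3 *ᶻ + q +ᶻ + 2
  c₄ = + 3 *ᶻ + suc q +ᶻ 1ℤ
  P₁ = rising q q
  P₂ = rising (3 + (q + q + q)) q
  Q₃ = rising (2 + (q + q)) q
  Q₄ = rising (suc q) q
  -- The part `P₁ P₂ f₀ c₂` is the left coefficient of the recurrence, and `f₀ f₁` is what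
  -- `denominator-step` requires.
  M = P₁ *ᶻ P₂ *ᶻ f₀ *ᶻ c₂ *ᶻ f₀ *ᶻ f₁
  c₂≡ : c₂ ≡ + suc (suc (q + q + q))
  c₂≡ = shape (+ q)
    where
    shape : ∀ q → + 3 *ᶻ q +ᶻ + 2 ≡ + 2 +ᶻ (q +ᶻ q +ᶻ q)
    shape = solve-∀
  c₄≡ : c₄ ≡ + 1 +ᶻ + (3 + (q + q + q))
  c₄≡ = shape (+ q)
    where
    shape : ∀ q → + 3 *ᶻ (+ 1 +ᶻ q) +ᶻ + 1 ≡ + 1 +ᶻ (+ 3 +ᶻ (q +ᶻ q +ᶻ q))
    shape = solve-∀
  M≢0 : M ≢ 0ℤ
  M≢0 = *-≢0 _ f₁ (*-≢0 _ f₀ (*-≢0 _ c₂ (*-≢0 _ f₀ (*-≢0 P₁ P₂ (prodUpTo-≢0 _ q (λ _ _ ()))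
      (prodUpTo-≢0 _ q (λ _ _ ())))
    (fact≢0 q)) (subst (_≢ 0ℤ) (sym c₂≡) λ ())) (fact≢0 q)) (fact≢0 (suc q))
  odds≡ : odds q q *ᶻ (Q₄ *ᶻ g₃) ≡ P₂ *ᶻ h₃
  odds≡ = trans (odds-fact q q) (trans (cong (λ k → fact (3 + k)) (sym shape))
      (sym (rising-fact (3 + (q + q + q)) q)))
    where
    shape : q + q + q + q ≡ q + q + (q + q)
    shape = +-assoc (q + q) q q
  Q₃≡ : Q₃ *ᶻ g₂ ≡ c₂ *ᶻ h₁
  Q₃≡ = trans (rising-fact (2 + (q + q)) q) (trans (fact-suc (1 + (q + q + q))) (cong (_*ᶻ h₁) (sym c₂≡)))
  numerator-step : numerator (suc (suc q)) ≡ numerator q *ᶻ h₁ *ᶻ (c₄ *ᶻ h₃)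
  numerator-step = trans (prodBelow-suc (suc q) (λ j → (3 * j + 1) !)) (cong₂ _*ᶻ_
    (trans (prodBelow-suc q (λ j → (3 * j + 1) !)) (cong (λ k → numerator q *ᶻ fact k) i₁))
    (trans (cong fact i₄) (trans (fact-suc (3 + (q + q + q))) (cong (_*ᶻ h₃) (sym c₄≡)))))
    where
    i₁ : 3 * q + 1 ≡ 1 + (q + q + q)
    i₁ = trans (+-comm (3 * q) 1) (cong suc (trans (cong (λ k → q + (q + k)) (+-identityʳ q)) (sym (+-assoc q q q))))
    i₄ : 3 * suc q + 1 ≡ suc (3 + (q + q + q))
    i₄ = trans (cong (_+ 1) (*-suc 3 q)) (cong (λ k → 3 + k) i₁)
  e₁ : ∀ p₁ p₂ f₀ c₂ f₁ t d → p₁ *ᶻ p₂ *ᶻ f₀ *ᶻ c₂ *ᶻ f₀ *ᶻ f₁ *ᶻ (t *ᶻ d)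
                            ≡ p₁ *ᶻ p₂ *ᶻ f₀ *ᶻ c₂ *ᶻ t *ᶻ (f₀ *ᶻ (f₁ *ᶻ d))
  e₁ = solve-∀
  e₂ : ∀ o f₀ q₃ c t d p₁ q₄ f₁ g₂ g₃ →
    o *ᶻ f₀ *ᶻ q₃ *ᶻ c *ᶻ t *ᶻ (d *ᶻ (p₁ *ᶻ f₀) *ᶻ (q₄ *ᶻ f₁) *ᶻ g₂ *ᶻ g₃)
    ≡ f₀ *ᶻ f₀ *ᶻ f₁ *ᶻ c *ᶻ p₁ *ᶻ (t *ᶻ d) *ᶻ (q₃ *ᶻ g₂) *ᶻ (o *ᶻ (q₄ *ᶻ g₃))
  e₂ = solve-∀
  e₃ : ∀ f₀ f₁ c p₁ n c₂ h₁ p₂ h₃ →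
    f₀ *ᶻ f₀ *ᶻ f₁ *ᶻ c *ᶻ p₁ *ᶻ n *ᶻ (c₂ *ᶻ h₁) *ᶻ (p₂ *ᶻ h₃)
    ≡ p₁ *ᶻ p₂ *ᶻ f₀ *ᶻ c₂ *ᶻ f₀ *ᶻ f₁ *ᶻ (n *ᶻ h₁ *ᶻ (c *ᶻ h₃))
  e₃ = solve-∀

numerator≢0 : ∀ m → numerator m ≢ 0ℤ
numerator≢0 zero    ()
numerator≢0 (suc m) e = fact≢0 (3 * m + 1)
  (cancel-zero (numerator≢0 m) (trans (sym (prodBelow-suc m (λ j → (3 * j + 1) !))) e))

-- Two consecutive sizes are carried along: the recurrence leads from `q` to `q + 2` but needs the
-- value at `q + 1` to be nonzero.
magog-formula : ∀ m → magogPf m *ᶻ denominator m ≡ numerator m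
magog-formula m = proj₁ (go m)
  where
  Formula : ℕ → Set
  Formula m = magogPf m *ᶻ denominator m ≡ numerator m
  nonzero : ∀ m → Formula m → magogPf m ≢ 0ℤ
  nonzero m f z = numerator≢0 m (trans (sym f) (cong (_*ᶻ denominator m) z))
  step : ∀ q → Formula q → Formula (suc q) → Formula (suc (suc q))
  -- `Evaluation` covers `q ≥ 1` only; the Pfaffian of size 2 is computed.
  step zero    f₀ f₁ = refl
  step (suc q) f₀ f₁ = product-step (suc q) (magogPf (suc q)) (magogPf (suc (suc (suc q))))
    (trans (cong (λ t → t *ᶻ (+ 3 *ᶻ + suc q +ᶻ + 2) *ᶻ magogPf (suc (suc (suc q)))) (sym (β-product q)))
      (trans (Evaluation.magog-recurrence q (nonzero (suc (suc q)) f₁))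
        (cong (λ t → t *ᶻ (+ 3 *ᶻ + suc (suc q) +ᶻ 1ℤ) *ᶻ magogPf (suc q)) (α-product q)))) f₀
  go : ∀ m → Formula m × Formula (suc m)
  go zero    = refl , refl
  go (suc m) with go m
  ... | f₀ , f₁ = f₁ , step m f₀ f₁

-- Corner sums of magog matrices

fromFun : ∀ {X : Set} n → (ℕ → X) → Vec X n
fromFun zero    f = []
fromFun (suc n) f = f 1 ∷ fromFun n (f ∘ suc)

get-fromFun : ∀ n f i → 1 ≤ i → i ≤ n → get (fromFun n f) i ≡ f i
get-fromFun (suc n) f (suc zero)    _ _       = refl
get-fromFun (suc n) f (suc (suc i)) _ (s≤s p) = get-fromFun n (f ∘ suc) (suc i) z<s p

map-fromFun : ∀ {X Y : Set} (g : X → Y) n f → vmap g (fromFun n f) ≡ fromFun n (g ∘ f)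
map-fromFun g zero    f = refl
map-fromFun g (suc n) f = cong (g (f 1) ∷_) (map-fromFun g n (f ∘ suc))

fromFun₂ : ∀ n → (ℕ → ℕ → ℤ) → Matrix n
fromFun₂ n e = fromFun n (λ i → fromFun n (e i))

entry-fromFun₂ : ∀ n e i j → 1 ≤ i → i ≤ n → 1 ≤ j → j ≤ n → entry (fromFun₂ n e) i j ≡ e i j
entry-fromFun₂ n e i j 1≤i i≤n 1≤j j≤n = trans
  (cong (λ v → get v i) (map-fromFun (λ r → get r j) n (λ i → fromFun n (e i))))
  (trans (get-fromFun n _ i 1≤i i≤n) (get-fromFun n (e i) j 1≤j j≤n))

get-ext : ∀ {n} (v w : Vec ℤ n) → (∀ i → 1 ≤ i → i ≤ n → get v i ≡ get w i) → v ≡ w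
get-ext []       []       e = refl
get-ext (x ∷ v) (y ∷ w) e = cong₂ _∷_ (e 1 ≤-refl z<s)
  (get-ext v w λ { (suc i) _ p → e (suc (suc i)) z<s (s≤s p) })

rows-ext : ∀ {m n} (A A′ : Vec (Vec ℤ n) m) →
  (∀ i j → 1 ≤ i → i ≤ m → 1 ≤ j → j ≤ n → get (vmap (λ r → get r j) A) i ≡ get (vmap (λ r → get r j) A′) i) → A ≡ A′
rows-ext []      []        e = refl
rows-ext (r ∷ A) (r′ ∷ A′) e = cong₂ _∷_
  (get-ext r r′ λ j → e 1 j ≤-refl z<s)
  (rows-ext A A′ λ { (suc i) j _ p → e (suc (suc i)) j z<s (s≤s p) })

sumTo-cong : ∀ {f g} n → (∀ i → 1 ≤ i → i ≤ n → f i ≡ g i) → sumTo f n ≡ sumTo g n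
sumTo-cong zero    e = refl
sumTo-cong (suc n) e = cong₂ _+ᶻ_ (sumTo-cong n (λ i p q → e i p (m≤n⇒m≤1+n q))) (e (suc n) z<s ≤-refl)

sumTo-telescope : ∀ (f : ℕ → ℤ) n → sumTo (λ i → f i −ᶻ f (i ∸ 1)) n ≡ f n −ᶻ f 0
sumTo-telescope f zero    = sym (ℤP.+-inverseʳ (f 0))
sumTo-telescope f (suc n) = trans (cong (_+ᶻ (f (suc n) −ᶻ f n)) (sumTo-telescope f n))
    (rearrange (f n) (f 0) (f (suc n)))
  where
  rearrange : ∀ a b c → a −ᶻ b +ᶻ (c −ᶻ a) ≡ c −ᶻ b
  rearrange = solve-∀

-- The corner sums of a magog matrix: N i j adds the entries in the first i rows and j columns.
record IsCorner (n : ℕ) (N : ℕ → ℕ → ℕ) : Set where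
  field
    col₀  : ∀ i → N i 0 ≡ 0
    row₀  : ∀ j → j ≤ n → N 0 j ≡ 0
    rowₙ  : ∀ i → i ≤ n → N i n ≡ i
    colₙ  : ∀ j → j ≤ n → N n j ≡ j
    step  : ∀ i j → i ≤ n → j < n → N i (suc j) ≡ N i j ⊎ N i (suc j) ≡ suc (N i j)
    mono  : ∀ i j → i < n → j ≤ n → N i j ≤ N (suc i) j
    magog : ∀ i j → i < n → suc j < n → N i (suc j) ≡ suc (N i j) → suc (N i (suc j)) ≤ N (suc i) (suc (suc j))

module FromMatrix {n : ℕ} (A : Matrix n) where

  colSum rowSum : ℕ → ℕ → ℤ
  colSum i j = sumTo (λ i′ → entry A i′ j) i
  rowSum i j = sumTo (λ j′ → entry A i j′) j

  -- Partial column sums of a magog matrix are 0 or 1, so the absolute value only moves them to `ℕ`.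
  bit : ℕ → ℕ → ℕ
  bit i j = ℤ.∣ colSum i j ∣

  corner : ℕ → ℕ → ℕ
  corner i zero    = 0
  corner i (suc j) = corner i j + bit i (suc j)

  module _ (M : IsMagog n A) where
    open IsMagog M

    bit-value : ∀ i j → i ≤ n → 1 ≤ j → j ≤ n → colSum i j ≡ + bit i j × (bit i j ≡ 0 ⊎ bit i j ≡ 1)
    bit-value zero    j _ _ _ = refl , inj₁ refl
    bit-value (suc i) j i≤ 1≤j j≤ with colSum (suc i) j | colPartial (suc i) j z<s i≤ 1≤j j≤
    ... | + 0           | _ = refl , inj₁ refl
    ... | + 1           | _ = refl , inj₂ refl
    ... | +[1+ suc _ ]  | _ , ℤ.+≤+ (s≤s ())
    ... | -[1+ _ ]      | () , _

    corner-row : ∀ i j → i < n → j ≤ n → + corner (suc i) j ≡ + corner i j +ᶻ rowSum (suc i) j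
    corner-row i zero    _  _  = refl
    corner-row i (suc j) i< j< = begin
      + corner (suc i) j +ᶻ + bit (suc i) (suc j)
        ≡⟨ cong₂ _+ᶻ_ (corner-row i j i< (<⇒≤ j<)) (sym (proj₁ (bit-value (suc i) (suc j) i< z<s j<))) ⟩
      + corner i j +ᶻ rowSum (suc i) j +ᶻ (colSum i (suc j) +ᶻ entry A (suc i) (suc j))
        ≡⟨ cong (λ t → + corner i j +ᶻ rowSum (suc i) j +ᶻ (t +ᶻ entry A (suc i) (suc j)))
            (proj₁ (bit-value i (suc j) (<⇒≤ i<) z<s j<)) ⟩
      + corner i j +ᶻ rowSum (suc i) j +ᶻ (+ bit i (suc j) +ᶻ entry A (suc i) (suc j))
        ≡⟨ rearrange (+ corner i j) (rowSum (suc i) j) (+ bit i (suc j)) (entry A (suc i) (suc j)) ⟩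
      (+ corner i j +ᶻ + bit i (suc j)) +ᶻ rowSum (suc i) (suc j) ∎
      where
      open ≡-Reasoning
      rearrange : ∀ a b c d → a +ᶻ b +ᶻ (c +ᶻ d) ≡ (a +ᶻ c) +ᶻ (b +ᶻ d)
      rearrange = solve-∀

    corner-0 : ∀ j → corner 0 j ≡ 0
    corner-0 zero    = refl
    corner-0 (suc j) = trans (+-identityʳ (corner 0 j)) (corner-0 j)

    corner-rowₙ : ∀ i → i ≤ n → corner i n ≡ i
    corner-rowₙ zero    _  = corner-0 n
    corner-rowₙ (suc i) i< = ℤP.+-injective (begin
      + corner (suc i) n                ≡⟨ corner-row i n i< ≤-refl ⟩
      + corner i n +ᶻ rowSum (suc i) n  ≡⟨ cong₂ _+ᶻ_ (cong +_ (corner-rowₙ i (<⇒≤ i<))) (rowSums (suc i) z<s i<) ⟩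
      + (i + 1)                         ≡⟨ cong +_ (+-comm i 1) ⟩
      + suc i                           ∎)
      where open ≡-Reasoning

    corner-colₙ : ∀ j → j ≤ n → corner n j ≡ j
    corner-colₙ zero    _  = refl
    corner-colₙ (suc j) j< = trans (cong₂ _+_ (corner-colₙ j (<⇒≤ j<)) (cong ℤ.∣_∣ (colSums (suc j) z<s j<)))
        (+-comm j 1)

    corner-step : ∀ i j → i ≤ n → j < n → corner i (suc j) ≡ corner i j ⊎ corner i (suc j) ≡ suc (corner i j)
    corner-step i j i≤ j< with proj₂ (bit-value i (suc j) i≤ z<s j<)
    ... | inj₁ e = inj₁ (trans (cong (λ t → corner i j + t) e) (+-identityʳ _))
    ... | inj₂ e = inj₂ (trans (cong (λ t → corner i j + t) e) (+-comm _ 1))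

    corner-mono : ∀ i j → i < n → j ≤ n → corner i j ≤ corner (suc i) j
    corner-mono i zero    _  _  = z≤n
    corner-mono i (suc j) i< j< = ℤP.drop‿+≤+ (subst (+ corner i (suc j) ℤ.≤_) (sym (corner-row i (suc j) i< j<))
      (subst (ℤ._≤ + corner i (suc j) +ᶻ rowSum (suc i) (suc j)) (ℤP.+-identityʳ _)
        (ℤP.+-monoʳ-≤ (+ corner i (suc j)) (rowPartial (suc i) (suc j) z<s i< z<s j<))))

    corner-≤ : ∀ i j → i ≤ n → j ≤ n → corner i j ≤ j
    corner-≤ i zero    _  _  = z≤n
    corner-≤ i (suc j) i≤ j< with corner-step i j i≤ j<
    ... | inj₁ e = ≤-trans (≤-reflexive e) (m≤n⇒m≤1+n (corner-≤ i j i≤ (<⇒≤ j<)))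
    ... | inj₂ e = ≤-trans (≤-reflexive e) (s≤s (corner-≤ i j i≤ (<⇒≤ j<)))

    corner-grows : ∀ i j → i ≤ n → j < n → corner i j ≤ corner i (suc j)
    corner-grows i j i≤ j< = m≤m+n _ _

    -- Inside the range of the defining inequality this is that inequality at a partial column sum
    -- 1. At the last row and at the last column, which the definition omits, the prescribed values
    -- `colₙ` and `rowₙ` give the bound.
    corner-magog : ∀ i j → i < n → suc j < n → corner i (suc j) ≡ suc (corner i j) →
      suc (corner i (suc j)) ≤ corner (suc i) (suc (suc j))
    corner-magog zero    j _  _  e with () ← trans (sym (corner-0 (suc j))) e
    corner-magog (suc i) j i< j< e with m≤n⇒m<n∨m≡n i< | m≤n⇒m<n∨m≡n j<
    ... | inj₂ refl | _ = ≤-trans (s≤s (corner-≤ (suc i) (suc j) (<⇒≤ i<) (<⇒≤ j<)))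
                            (≤-reflexive (sym (corner-colₙ (suc (suc j)) j<)))
    ... | inj₁ i<<  | inj₂ refl = ≤-trans (s≤s (≤-trans (corner-grows (suc i) (suc j) (<⇒≤ i<) ≤-refl)
        (≤-reflexive (corner-rowₙ (suc i) (<⇒≤ i<)))))
                            (≤-reflexive (sym (corner-rowₙ (suc (suc i)) i<)))
    ... | inj₁ i<<  | inj₁ j<<  = ℤP.drop‿+≤+ (ℤP.0≤i-j⇒j≤i (subst (0ℤ ℤ.≤_) rewrite-sum
          (magogIneq (suc i) (suc j) z<s (subst (_≤ n) (+-comm 2 (suc i)) i<<) z<s
              (subst (_≤ n) (+-comm 2 (suc j)) j<<))))
      where
      open ≡-Reasoning
      c₁ : bit (suc i) (suc j) ≡ 1
      c₁ = +-cancelˡ-≡ (corner (suc i) j) _ _ (trans e (+-comm 1 (corner (suc i) j)))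
      rearrange : ∀ r a b c → r +ᶻ c −ᶻ b ≡ (a +ᶻ r) +ᶻ c −ᶻ (b +ᶻ a)
      rearrange = solve-∀
      rewrite-sum : rowSum (suc (suc i)) (suc j) +ᶻ colSum (suc (suc i)) (suc (suc j)) −ᶻ colSum (suc i) (suc j)
        ≡ + corner (suc (suc i)) (suc (suc j)) −ᶻ + suc (corner (suc i) (suc j))
      rewrite-sum = begin
        rowSum (suc (suc i)) (suc j) +ᶻ colSum (suc (suc i)) (suc (suc j)) −ᶻ colSum (suc i) (suc j)
          ≡⟨ cong₂ (λ s t → rowSum (suc (suc i)) (suc j) +ᶻ s −ᶻ t)
               (proj₁ (bit-value (suc (suc i)) (suc (suc j)) i< z<s j<))
               (trans (proj₁ (bit-value (suc i) (suc j) (<⇒≤ i<) z<s (<⇒≤ j<))) (cong +_ c₁)) ⟩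
        rowSum (suc (suc i)) (suc j) +ᶻ + bit (suc (suc i)) (suc (suc j)) −ᶻ 1ℤ
          ≡⟨ rearrange (rowSum (suc (suc i)) (suc j)) (+ corner (suc i) (suc j)) 1ℤ
              (+ bit (suc (suc i)) (suc (suc j))) ⟩
        (+ corner (suc i) (suc j) +ᶻ rowSum (suc (suc i)) (suc j)) +ᶻ + bit (suc (suc i)) (suc (suc j)) −ᶻ + suc
            (corner (suc i) (suc j))
          ≡⟨ cong (λ t → t +ᶻ + bit (suc (suc i)) (suc (suc j)) −ᶻ + suc (corner (suc i) (suc j)))
              (corner-row (suc i) (suc j) i< (<⇒≤ j<)) ⟨
        + corner (suc (suc i)) (suc (suc j)) −ᶻ + suc (corner (suc i) (suc j)) ∎

    isCorner : IsCorner n corner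
    isCorner = record
      { col₀ = λ _ → refl ; row₀ = λ j _ → corner-0 j ; rowₙ = corner-rowₙ ; colₙ = corner-colₙ
      ; step = corner-step ; mono = corner-mono ; magog = corner-magog }

    private
      colSum-corner : ∀ i j → i ≤ n → j < n → colSum i (suc j) ≡ + corner i (suc j) −ᶻ + corner i j
      colSum-corner i j i≤ j< = trans (proj₁ (bit-value i (suc j) i≤ z<s j<))
          (rearrange (+ corner i j) (+ bit i (suc j)))
        where
        rearrange : ∀ a b → b ≡ a +ᶻ b −ᶻ a
        rearrange = solve-∀

    entry-corner : ∀ i j → i < n → j < n → entry A (suc i) (suc j) ≡
      (+ corner (suc i) (suc j) −ᶻ + corner (suc i) j) −ᶻ (+ corner i (suc j) −ᶻ + corner i j)
    entry-corner i j i< j< = trans (rearrange (colSum i (suc j)) (entry A (suc i) (suc j)))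
      (cong₂ _−ᶻ_ (colSum-corner (suc i) j i< j<) (colSum-corner i j (<⇒≤ i<) j<))
      where
      rearrange : ∀ a b → b ≡ a +ᶻ b −ᶻ a
      rearrange = solve-∀

module ToMatrix (n : ℕ) (N : ℕ → ℕ → ℕ) where

  second-difference : ℕ → ℕ → ℤ
  second-difference i j = (+ N i j −ᶻ + N i (j ∸ 1)) −ᶻ (+ N (i ∸ 1) j −ᶻ + N (i ∸ 1) (j ∸ 1))

  matrix : Matrix n
  matrix = fromFun₂ n second-difference

  open FromMatrix matrix

  module _ (C : IsCorner n N) where
    open IsCorner C

    entry-matrix : ∀ i j → 1 ≤ i → i ≤ n → 1 ≤ j → j ≤ n → entry matrix i j ≡ second-difference i j
    entry-matrix = entry-fromFun₂ n second-difference

    colSum-N : ∀ i j → i ≤ n → j < n → colSum i (suc j) ≡ + N i (suc j) −ᶻ + N i j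
    colSum-N i j i≤ j< = begin
      colSum i (suc j)
        ≡⟨ sumTo-cong i (λ i′ 1≤i′ i′≤ → entry-matrix i′ (suc j) 1≤i′ (≤-trans i′≤ i≤) z<s j<) ⟩
      sumTo (λ i′ → f i′ −ᶻ f (i′ ∸ 1)) i
        ≡⟨ sumTo-telescope f i ⟩
      f i −ᶻ f 0
        ≡⟨ cong₂ (λ s t → f i −ᶻ (+ s −ᶻ + t)) (row₀ (suc j) j<) (row₀ j (<⇒≤ j<)) ⟩
      f i −ᶻ 0ℤ
        ≡⟨ ℤP.+-identityʳ (f i) ⟩
      f i ∎
      where
      open ≡-Reasoning
      f : ℕ → ℤ
      f i = + N i (suc j) −ᶻ + N i j

    rowSum-N : ∀ i j → i < n → j ≤ n → rowSum (suc i) j ≡ + N (suc i) j −ᶻ + N i j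
    rowSum-N i j i< j≤ = begin
      rowSum (suc i) j
        ≡⟨ sumTo-cong j (λ j′ 1≤j′ j′≤ → trans (entry-matrix (suc i) j′ z<s i< 1≤j′ (≤-trans j′≤ j≤))
             (rearrange (+ N (suc i) j′) (+ N (suc i) (j′ ∸ 1)) (+ N i j′) (+ N i (j′ ∸ 1)))) ⟩
      sumTo (λ j′ → f j′ −ᶻ f (j′ ∸ 1)) j
        ≡⟨ sumTo-telescope f j ⟩
      f j −ᶻ f 0
        ≡⟨ cong₂ (λ s t → f j −ᶻ (+ s −ᶻ + t)) (col₀ (suc i)) (col₀ i) ⟩
      f j −ᶻ 0ℤ
        ≡⟨ ℤP.+-identityʳ (f j) ⟩
      f j ∎
      where
      open ≡-Reasoning
      f : ℕ → ℤ
      f j = + N (suc i) j −ᶻ + N i j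
      rearrange : ∀ a b c d → (a −ᶻ b) −ᶻ (c −ᶻ d) ≡ (a −ᶻ c) −ᶻ (b −ᶻ d)
      rearrange = solve-∀

    difference : ∀ i j → i ≤ n → j < n → (+ N i (suc j) −ᶻ + N i j ≡ 0ℤ) ⊎ (+ N i (suc j) −ᶻ + N i j ≡ 1ℤ)
    difference i j i≤ j< with step i j i≤ j<
    ... | inj₁ e = inj₁ (trans (cong (λ t → + t −ᶻ + N i j) e) (ℤP.+-inverseʳ (+ N i j)))
    ... | inj₂ e = inj₂ (trans (cong (λ t → + t −ᶻ + N i j) e) (one (+ N i j)))
      where
      one : ∀ x → + 1 +ᶻ x −ᶻ x ≡ + 1
      one = solve-∀

    corner-N : ∀ i j → i ≤ n → j ≤ n → corner i j ≡ N i j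
    corner-N i zero    _  _  = sym (col₀ i)
    corner-N i (suc j) i≤ j< with step i j i≤ j<
    ... | inj₁ e = trans (cong₂ _+_ (corner-N i j i≤ (<⇒≤ j<)) (cong ℤ.∣_∣ (trans (colSum-N i j i≤ j<)
            (trans (cong (λ t → + t −ᶻ + N i j) e) (ℤP.+-inverseʳ (+ N i j)))))) (trans (+-identityʳ _) (sym e))
    ... | inj₂ e = trans (cong₂ _+_ (corner-N i j i≤ (<⇒≤ j<)) (cong ℤ.∣_∣ (trans (colSum-N i j i≤ j<)
            (trans (cong (λ t → + t −ᶻ + N i j) e) (one (+ N i j)))))) (trans (+-comm _ 1) (sym e))
      where
      one : ∀ x → + 1 +ᶻ x −ᶻ x ≡ + 1
      one = solve-∀

    private
      0≤1 : 0ℤ ℤ.≤ 1ℤ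
      0≤1 = ℤ.+≤+ z≤n

      unit-difference : ∀ {a b} → a ≡ suc b → + a −ᶻ + b ≡ 1ℤ
      unit-difference {b = b} refl = one (+ b)
        where
        one : ∀ x → + 1 +ᶻ x −ᶻ x ≡ + 1
        one = solve-∀

    isMagog : IsMagog n matrix
    isMagog = record
      { entries = λ { (suc i) (suc j) _ i< _ j< → ents i j i< j< }
      ; rowSums = λ { (suc i) _ i< → trans (rowSum-N i n i< ≤-refl)
          (unit-difference (trans (rowₙ (suc i) i<) (cong suc (sym (rowₙ i (<⇒≤ i<)))))) }
      ; colSums = λ { (suc j) _ j< → trans (colSum-N n j ≤-refl j<)
          (unit-difference (trans (colₙ (suc j) j<) (cong suc (sym (colₙ j (<⇒≤ j<)))))) }
      ; colPartial = λ { i (suc j) _ i≤ _ j< → cols i j i≤ j< }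
      ; rowPartial = λ { (suc i) j _ i< _ j≤ → subst (0ℤ ℤ.≤_) (sym (rowSum-N i j i< j≤))
          (ℤP.i≤j⇒0≤j-i (ℤ.+≤+ (mono i j i< j≤))) }
      ; magogIneq = λ { i (suc j) _ i+2≤ _ j+2≤ → ineq i j (≤-trans (n≤1+n _) (subst (_≤ n) (+-comm i 2) i+2≤))
          (≤-trans (n≤1+n _) (subst (_≤ n) (+-comm (suc j) 2) j+2≤)) } }
      where
      ents : ∀ i j → i < n → j < n → (entry matrix (suc i) (suc j) ≡ 0ℤ) ⊎ (entry matrix (suc i) (suc j) ≡ 1ℤ) ⊎
          (entry matrix (suc i) (suc j) ≡ ℤ.-1ℤ)
      ents i j i< j< rewrite entry-matrix (suc i) (suc j) z<s i< z<s j<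
        with difference (suc i) j i< j< | difference i j (<⇒≤ i<) j<
      ... | inj₁ e | inj₁ e′ = inj₁ (cong₂ _−ᶻ_ e e′)
      ... | inj₁ e | inj₂ e′ = inj₂ (inj₂ (cong₂ _−ᶻ_ e e′))
      ... | inj₂ e | inj₁ e′ = inj₂ (inj₁ (cong₂ _−ᶻ_ e e′))
      ... | inj₂ e | inj₂ e′ = inj₁ (cong₂ _−ᶻ_ e e′)
      cols : ∀ i j → i ≤ n → j < n → (0ℤ ℤ.≤ colSum i (suc j)) × (colSum i (suc j) ℤ.≤ 1ℤ)
      cols i j i≤ j< rewrite colSum-N i j i≤ j< with difference i j i≤ j<
      ... | inj₁ e rewrite e = ℤP.≤-refl , 0≤1
      ... | inj₂ e rewrite e = 0≤1 , ℤP.≤-refl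
      grows : ∀ i j → i ≤ n → j < n → N i j ≤ N i (suc j)
      grows i j i≤ j< with step i j i≤ j<
      ... | inj₁ e = ≤-reflexive (sym e)
      ... | inj₂ e = ≤-trans (n≤1+n _) (≤-reflexive (sym e))
      ineq : ∀ i j → i < n → suc j < n → 0ℤ ℤ.≤ rowSum (suc i) (suc j) +ᶻ colSum (suc i) (suc (suc j)) −ᶻ colSum i
          (suc j)
      ineq i j i< j< rewrite rowSum-N i (suc j) i< (<⇒≤ j<) | colSum-N (suc i) (suc j) i< j< | colSum-N i j
          (<⇒≤ i<) (<⇒≤ j<)
        = subst (0ℤ ℤ.≤_) (sym (rearrange (+ N (suc i) (suc j)) (+ N i (suc j)) (+ N (suc i) (suc (suc j))) _))
            (bound (difference i j (<⇒≤ i<) (<⇒≤ j<)) {refl})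
        where
        rearrange : ∀ a b c d → (a −ᶻ b) +ᶻ (c −ᶻ a) −ᶻ d ≡ c −ᶻ (d +ᶻ b)
        rearrange = solve-∀
        -- For `d = 0` monotonicity of the corner sums suffices. For `d = 1` the equation for `d`
        -- shows that the corner sum grows at this column, which is the premise of `magog`.
        bound : ∀ {d} → d ≡ 0ℤ ⊎ d ≡ 1ℤ → {_ : d ≡ + N i (suc j) −ᶻ + N i j} → 0ℤ ℤ.≤ + N (suc i) (suc (suc j)) −ᶻ
            (d +ᶻ + N i (suc j))
        bound (inj₁ refl) = ℤP.i≤j⇒0≤j-i (ℤ.+≤+ (≤-trans (mono i (suc j) i< (<⇒≤ j<)) (grows (suc i) (suc j) i< j<)))
        bound (inj₂ refl) {e} = ℤP.i≤j⇒0≤j-i (ℤ.+≤+ (magog i j i< j< (jump (step i j (<⇒≤ i<) (<⇒≤ j<)))))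
          where
          jump : N i (suc j) ≡ N i j ⊎ N i (suc j) ≡ suc (N i j) → N i (suc j) ≡ suc (N i j)
          jump (inj₂ e′) = e′
          jump (inj₁ e′) with () ← trans e (trans (cong (λ t → + t −ᶻ + N i j) e′) (ℤP.+-inverseʳ (+ N i j)))

-- Tables of first passage rows

-- Only `0, …, n − 1` are tested, and `n` is the default; `greatest` likewise falls back to 0.
least : ∀ {P : ℕ → Set} → ℕ → (∀ i → Dec (P i)) → ℕ
least zero    P? = 0
least (suc n) P? with P? 0
... | yes _ = 0
... | no  _ = suc (least n (P? ∘ suc))

least-lower : ∀ {P : ℕ → Set} n (P? : ∀ i → Dec (P i)) i → P i → least n P? ≤ i
least-lower zero    P? i p = z≤n
least-lower (suc n) P? i p with P? 0
least-lower (suc n) P? i       p | yes _ = z≤n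
least-lower (suc n) P? zero    p | no ¬p = ⊥-elim (¬p p)
least-lower (suc n) P? (suc i) p | no _  = s≤s (least-lower n (P? ∘ suc) i p)

least-holds : ∀ {P : ℕ → Set} n (P? : ∀ i → Dec (P i)) → P n → P (least n P?)
least-holds zero    P? p = p
least-holds (suc n) P? p with P? 0
... | yes p₀ = p₀
... | no  _  = least-holds n (P? ∘ suc) p

greatest : ∀ {P : ℕ → Set} → ℕ → (∀ i → Dec (P i)) → ℕ
greatest zero    P? = 0
greatest (suc n) P? with P? (suc n)
... | yes _ = suc n
... | no  _ = greatest n P?

greatest-upper : ∀ {P : ℕ → Set} n (P? : ∀ i → Dec (P i)) i → i ≤ n → P i → i ≤ greatest n P?
greatest-upper zero    P? i i≤n p = i≤n
greatest-upper (suc n) P? i i≤n p with P? (suc n)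
... | yes _ = i≤n
... | no ¬p with m≤n⇒m<n∨m≡n i≤n
...   | inj₁ (s≤s i≤) = greatest-upper n P? i i≤ p
...   | inj₂ refl     = ⊥-elim (¬p p)

greatest-≤ : ∀ {P : ℕ → Set} n (P? : ∀ i → Dec (P i)) → greatest n P? ≤ n
greatest-≤ zero    P? = z≤n
greatest-≤ (suc n) P? with P? (suc n)
... | yes _ = ≤-refl
... | no  _ = m≤n⇒m≤1+n (greatest-≤ n P?)

greatest-holds : ∀ {P : ℕ → Set} n (P? : ∀ i → Dec (P i)) → 1 ≤ greatest n P? → P (greatest n P?)
greatest-holds (suc n) P? p with P? (suc n)
... | yes q = q
... | no  _ = greatest-holds n P? p

Table : Set
Table = ℕ → ℕ → ℕ

-- For a magog matrix, I j k is the first row i at which the corner sum of i rows and j columns reaches k.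
record IsTable (n : ℕ) (I : Table) : Set where
  field
    top  : ∀ k → 1 ≤ k → k ≤ n → I n k ≡ k
    anti : ∀ j k → 1 ≤ k → k ≤ j → j < n → I (suc j) k ≤ I j k
    lo   : ∀ j k → 1 ≤ k → k ≤ j → j < n → I j k ≤ I (suc j) (suc k)
    hi   : ∀ j k → 1 ≤ k → k ≤ j → j < n → I (suc j) (suc k) ≤ suc (I j k)

infix 4 _≈[_]_
_≈[_]_ : Table → ℕ → Table → Set
I ≈[ n ] I′ = ∀ j k → 1 ≤ k → k ≤ j → j ≤ n → I j k ≡ I′ j k

-- For fixed `j` the two functions form a Galois connection. It translates the fields of `IsTable`:
-- `top` is the row condition, `anti` and `lo` say that a corner sum grows by at least 0 and at most
-- 1 from one column to the next, and `hi` is the magog condition.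
record Galois (n : ℕ) (N I : Table) : Set where
  field
    to     : ∀ i j k → i ≤ n → 1 ≤ k → k ≤ j → j ≤ n → I j k ≤ i → k ≤ N i j
    from   : ∀ i j k → i ≤ n → 1 ≤ k → k ≤ j → j ≤ n → k ≤ N i j → I j k ≤ i
    I≤n    : ∀ j k → 1 ≤ k → k ≤ j → j ≤ n → I j k ≤ n
    N≤j    : ∀ i j → i ≤ n → j ≤ n → N i j ≤ j

Galois-unique-I : ∀ {n N N′ I I′} → Galois n N I → Galois n N′ I′ →
  (∀ i j → i ≤ n → j ≤ n → N i j ≡ N′ i j) → I ≈[ n ] I′
Galois-unique-I {n} {N} {N′} {I} {I′} G G′ e j k p q r = ≤-antisym
  (Galois.from G _ j k (Galois.I≤n G′ j k p q r) p q r
    (≤-trans (Galois.to G′ _ j k (Galois.I≤n G′ j k p q r) p q r ≤-refl)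
        (≤-reflexive (sym (e _ j (Galois.I≤n G′ j k p q r) r)))))
  (Galois.from G′ _ j k (Galois.I≤n G j k p q r) p q r
    (≤-trans (Galois.to G _ j k (Galois.I≤n G j k p q r) p q r ≤-refl)
        (≤-reflexive (e _ j (Galois.I≤n G j k p q r) r))))

Galois-unique-N : ∀ {n N N′ I I′} → Galois n N I → Galois n N′ I′ → I ≈[ n ] I′ →
  ∀ i j → i ≤ n → j ≤ n → N i j ≡ N′ i j
Galois-unique-N {n} {N} {N′} {I} {I′} G G′ e i j i≤ j≤ = ≤-antisym (dominated G G′ e)
    (dominated G′ G (λ j k p q r → sym (e j k p q r)))
  where
  dominated : ∀ {N N′ I I′} → Galois n N I → Galois n N′ I′ → I ≈[ n ] I′ → N i j ≤ N′ i j
  dominated {N} {N′} G G′ e with N i j in eq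
  ... | zero  = z≤n
  ... | suc k = Galois.to G′ i j (suc k) i≤ z<s k≤j j≤
    (≤-trans (≤-reflexive (sym (e j (suc k) z<s k≤j j≤))) (Galois.from G i j (suc k) i≤ z<s k≤j j≤
        (≤-reflexive (sym eq))))
    where
    k≤j : suc k ≤ j
    k≤j = ≤-trans (≤-reflexive (sym eq)) (Galois.N≤j G i j i≤ j≤)

module _ (n : ℕ) (N : Table) where

  table : Table
  table j k = least n (λ i → k ≤? N i j)

  module _ (C : IsCorner n N) where
    open IsCorner C

    N-mono : ∀ j → j ≤ n → ∀ i d → i + d ≤ n → N i j ≤ N (i + d) j
    N-mono j j≤ i zero    p = ≤-reflexive (cong (λ k → N k j) (sym (+-identityʳ i)))
    N-mono j j≤ i (suc d) p = ≤-trans (N-mono j j≤ i d (<⇒≤ p′))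
        (≤-trans (mono (i + d) j p′ j≤) (≤-reflexive (cong (λ k → N k j) (sym (+-suc i d)))))
      where
      p′ : i + d < n
      p′ = subst (_≤ n) (+-suc i d) p

    N≤ : ∀ i j → i ≤ n → j ≤ n → N i j ≤ j
    N≤ i zero    i≤ _  = ≤-reflexive (col₀ i)
    N≤ i (suc j) i≤ j< with step i j i≤ j<
    ... | inj₁ e = ≤-trans (≤-reflexive e) (m≤n⇒m≤1+n (N≤ i j i≤ (<⇒≤ j<)))
    ... | inj₂ e = ≤-trans (≤-reflexive e) (s≤s (N≤ i j i≤ (<⇒≤ j<)))

    N-grows : ∀ i j → i ≤ n → j < n → N i j ≤ N i (suc j)
    N-grows i j i≤ j< with step i j i≤ j<
    ... | inj₁ e = ≤-reflexive (sym e)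
    ... | inj₂ e = ≤-trans (n≤1+n _) (≤-reflexive (sym e))

    N-bounded : ∀ i j → i ≤ n → j < n → N i (suc j) ≤ suc (N i j)
    N-bounded i j i≤ j< with step i j i≤ j<
    ... | inj₁ e = ≤-trans (≤-reflexive e) (n≤1+n _)
    ... | inj₂ e = ≤-reflexive e

    table-Galois : Galois n N table
    table-Galois = record
      { to = to ; from = λ i j k _ _ _ _ p → least-lower n (λ i → k ≤? N i j) i p
      ; I≤n = λ j k _ k≤j j≤n → least-lower n (λ i → k ≤? N i j) n (reached j k k≤j j≤n)
      ; N≤j = N≤ }
      where
      reached : ∀ j k → k ≤ j → j ≤ n → k ≤ N n j
      reached j k k≤j j≤n = ≤-trans k≤j (≤-reflexive (sym (colₙ j j≤n)))
      to : ∀ i j k → i ≤ n → 1 ≤ k → k ≤ j → j ≤ n → table j k ≤ i → k ≤ N i j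
      to i j k i≤ _ k≤j j≤ p = ≤-trans (least-holds n (λ i → k ≤? N i j) (reached j k k≤j j≤))
        (subst (λ m → N (table j k) j ≤ N m j) (m+[n∸m]≡n p)
          (N-mono j j≤ (table j k) (i ∸ table j k) (≤-trans (≤-reflexive (m+[n∸m]≡n p)) i≤)))

    open Galois table-Galois

    table-anti : ∀ j k → 1 ≤ k → k ≤ j → j < n → table (suc j) k ≤ table j k
    table-anti j k p q r = from _ (suc j) k i≤ p (m≤n⇒m≤1+n q) r
      (≤-trans (to _ j k i≤ p q (<⇒≤ r) ≤-refl) (N-grows _ j i≤ r))
      where
      i≤ : table j k ≤ n
      i≤ = I≤n j k p q (<⇒≤ r)

    table-lo : ∀ j k → 1 ≤ k → k ≤ j → j < n → table j k ≤ table (suc j) (suc k)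
    table-lo j k p q r = from _ j k i≤ p q (<⇒≤ r)
      (≤-pred (≤-trans (to _ (suc j) (suc k) i≤ z<s (s≤s q) r ≤-refl) (N-bounded _ j i≤ r)))
      where
      i≤ : table (suc j) (suc k) ≤ n
      i≤ = I≤n (suc j) (suc k) z<s (s≤s q) r

    -- Let N i (j + 1) reach k at row i. If column j + 1 does not contribute at row i, then N i j = k already, and
    -- induction on j applies.
    table-hi : ∀ j k → 1 ≤ k → k ≤ j → j < n → table (suc j) (suc k) ≤ suc (table j k)
    table-hi zero zero    () _ _
    table-hi zero (suc _) _ () _
    table-hi (suc j) k p q r with m≤n⇒m<n∨m≡n (I≤n (suc j) k p q (<⇒≤ r))
    ... | inj₂ e = ≤-trans (I≤n (suc (suc j)) (suc k) z<s (s≤s q) r) (≤-trans (≤-reflexive (sym e)) (n≤1+n _))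
    ... | inj₁ i< = go (m≤n⇒m<n∨m≡n reached)
      where
      i : ℕ
      i = table (suc j) k
      reached : k ≤ N i (suc j)
      reached = to i (suc j) k (<⇒≤ i<) p q (<⇒≤ r) ≤-refl
      done : suc k ≤ N (suc i) (suc (suc j)) → table (suc (suc j)) (suc k) ≤ suc i
      done = from (suc i) (suc (suc j)) (suc k) i< z<s (s≤s q) r
      go : k < N i (suc j) ⊎ k ≡ N i (suc j) → table (suc (suc j)) (suc k) ≤ suc i
      go (inj₁ k<) = done (≤-trans k< (≤-trans (mono i (suc j) i< (<⇒≤ r)) (N-grows (suc i) (suc j) i< r)))
      go (inj₂ k≡) with step i j (<⇒≤ i<) (<⇒≤ r)
      ... | inj₂ new = done (≤-trans (s≤s (≤-reflexive k≡)) (magog i j i< r new))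
      ... | inj₁ old = ≤-trans (table-anti (suc j) (suc k) z<s (s≤s k≤j) r)
                         (≤-trans (table-hi j k p k≤j (<⇒≤ r)) (s≤s (from i j k (<⇒≤ i<) p k≤j (<⇒≤ (<⇒≤ r)) k≤N)))
        where
        k≤N : k ≤ N i j
        k≤N = ≤-reflexive (trans k≡ old)
        k≤j : k ≤ j
        k≤j = ≤-trans k≤N (N≤ i j (<⇒≤ i<) (<⇒≤ (<⇒≤ r)))

    table-isTable : IsTable n table
    table-isTable = record
      { top = λ k p q → ≤-antisym (from k n k q p q ≤-refl (≤-reflexive (sym (rowₙ k q))))
                (≤-trans (to _ n k (I≤n n k p q ≤-refl) p q ≤-refl ≤-refl)
                    (≤-reflexive (rowₙ _ (I≤n n k p q ≤-refl))))
      ; anti = table-anti ; lo = table-lo ; hi = table-hi }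

module _ (n : ℕ) (I : Table) where

  cornerOf : Table
  cornerOf i j = greatest j (λ k → I j k ≤? i)

  module _ (T : IsTable n I) where
    open IsTable T

    -- Moving to column `n` at fixed `k` never increases the entry, and there it is `k`. The
    -- companion `I-upper` moves to column `n` along the diagonal instead, by `lo`.
    I-lower : ∀ d j k → 1 ≤ k → k ≤ j → j + d ≡ n → k ≤ I j k
    I-lower zero    j k p q e with refl ← trans (sym (+-identityʳ j)) e = ≤-reflexive (sym (top k p q))
    I-lower (suc d) j k p q e = ≤-trans (I-lower d (suc j) k p (m≤n⇒m≤1+n q) (trans (sym (+-suc j d)) e))
      (anti j k p q (subst (suc j ≤_) e (≤-trans (s≤s (m≤m+n j d)) (≤-reflexive (sym (+-suc j d))))))

    I-upper : ∀ d j k → 1 ≤ k → k ≤ j → j + d ≡ n → I j k ≤ k + d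
    I-upper zero    j k p q e with refl ← trans (sym (+-identityʳ j)) e = ≤-reflexive (trans (top k p q) (sym (+-identityʳ k)))
    I-upper (suc d) j k p q e = ≤-trans (lo j k p q j<n)
      (≤-trans (I-upper d (suc j) (suc k) z<s (s≤s q) (trans (sym (+-suc j d)) e)) (≤-reflexive (sym (+-suc k d))))
      where
      j<n : j < n
      j<n = subst (suc j ≤_) e (≤-trans (s≤s (m≤m+n j d)) (≤-reflexive (sym (+-suc j d))))

    I-increasing : ∀ j k → 1 ≤ k → suc k ≤ j → j ≤ n → I j k ≤ I j (suc k)
    I-increasing (suc j) k p (s≤s q) r = ≤-trans (anti j k p q r) (lo j k p q r)

    I-monotone : ∀ j k d → 1 ≤ k → k + d ≤ j → j ≤ n → I j k ≤ I j (k + d)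
    I-monotone j k zero    p q r = ≤-reflexive (cong (I j) (sym (+-identityʳ k)))
    I-monotone j k (suc d) p q r = ≤-trans (I-monotone j k d p (<⇒≤ q′) r)
      (≤-trans (I-increasing j (k + d) (≤-trans p (m≤m+n k d)) q′ r) (≤-reflexive (cong (I j) (sym (+-suc k d)))))
      where
      q′ : suc (k + d) ≤ j
      q′ = subst (_≤ j) (+-suc k d) q

    I-bounded : ∀ j k → 1 ≤ k → k ≤ j → j ≤ n → I j k ≤ n
    I-bounded j k p q r = ≤-trans (I-upper (n ∸ j) j k p q (m+[n∸m]≡n r))
      (≤-trans (+-monoˡ-≤ (n ∸ j) q) (≤-reflexive (m+[n∸m]≡n r)))

    cornerOf-Galois : Galois n cornerOf I
    cornerOf-Galois = record
      { to = λ i j k _ _ k≤j _ p → greatest-upper j (λ k → I j k ≤? i) k k≤j p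
      ; from = from ; I≤n = I-bounded ; N≤j = λ i j _ _ → greatest-≤ j (λ k → I j k ≤? i) }
      where
      from : ∀ i j k → i ≤ n → 1 ≤ k → k ≤ j → j ≤ n → k ≤ cornerOf i j → I j k ≤ i
      from i j k i≤ p q r k≤ = ≤-trans
        (subst (λ m → I j k ≤ I j m) (m+[n∸m]≡n k≤)
          (I-monotone j k (cornerOf i j ∸ k) p (≤-trans (≤-reflexive (m+[n∸m]≡n k≤))
              (greatest-≤ j (λ k → I j k ≤? i))) r))
        (greatest-holds j (λ k → I j k ≤? i) (≤-trans p k≤))

    open Galois cornerOf-Galois renaming (from to I≤from; to to ≤N)

    private
      N : Table
      N = cornerOf

      ≤-from-below : ∀ {a b} → (∀ k → 1 ≤ k → k ≤ a → k ≤ b) → a ≤ b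
      ≤-from-below {zero}  f = z≤n
      ≤-from-below {suc a} f = f (suc a) z<s ≤-refl

    cornerOf-isCorner : IsCorner n cornerOf
    cornerOf-isCorner = record
      { col₀ = λ _ → refl
      ; row₀ = λ j j≤ → zero-row j j≤ (cornerOf 0 j) refl
      ; rowₙ = λ i i≤ → ≤-antisym
          (≤-from-below λ k p q → ≤-trans (≤-reflexive (sym (top k p (≤-trans q (N≤j i n i≤ ≤-refl)))))
              (I≤from i n k i≤ p (≤-trans q (N≤j i n i≤ ≤-refl)) ≤-refl q))
          (≤-from-below λ k p q → ≤N i n k i≤ p (≤-trans q i≤) ≤-refl
              (≤-trans (≤-reflexive (top k p (≤-trans q i≤))) q))
      ; colₙ = λ j j≤ → ≤-antisym (N≤j n j ≤-refl j≤)
          (≤-from-below λ k p q → ≤N n j k ≤-refl p q j≤ (I≤n j k p q j≤))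
      ; step = step
      ; mono = λ i j i< j≤ → ≤-from-below λ k p q → let k≤j = ≤-trans q (N≤j i j (<⇒≤ i<) j≤) in
          ≤N (suc i) j k i< p k≤j j≤ (m≤n⇒m≤1+n (I≤from i j k (<⇒≤ i<) p k≤j j≤ q))
      ; magog = magog }
      where
      zero-row : ∀ j → j ≤ n → ∀ m → cornerOf 0 j ≡ m → m ≡ 0
      zero-row j j≤ zero    e = refl
      zero-row j j≤ (suc m) e = ⊥-elim (1+n≰n (≤-trans (I-lower (n ∸ j) j 1 ≤-refl 1≤j (m+[n∸m]≡n j≤))
        (I≤from 0 j 1 z≤n ≤-refl 1≤j j≤ (≤-trans z<s (≤-reflexive (sym e))))))
        where
        1≤j : 1 ≤ j
        1≤j = ≤-trans (≤-trans z<s (≤-reflexive (sym e))) (N≤j 0 j z≤n j≤)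
      grows : ∀ i j → i ≤ n → j < n → N i j ≤ N i (suc j)
      grows i j i≤ j< = ≤-from-below λ k p q → let k≤j = ≤-trans q (N≤j i j i≤ (<⇒≤ j<)) in
        ≤N i (suc j) k i≤ p (m≤n⇒m≤1+n k≤j) j< (≤-trans (anti j k p k≤j j<) (I≤from i j k i≤ p k≤j (<⇒≤ j<) q))
      bounded : ∀ i j → i ≤ n → j < n → N i (suc j) ≤ suc (N i j)
      bounded i j i≤ j< = ≤-from-below λ where
        (suc zero)    _ _ → z<s
        (suc (suc k)) _ q → let k<j = ≤-trans q (N≤j i (suc j) i≤ j<) in
          s≤s (≤N i j (suc k) i≤ z<s (≤-pred k<j) (<⇒≤ j<)
            (≤-trans (lo j (suc k) z<s (≤-pred k<j) j<) (I≤from i (suc j) (suc (suc k)) i≤ z<s k<j j< q)))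
      step : ∀ i j → i ≤ n → j < n → N i (suc j) ≡ N i j ⊎ N i (suc j) ≡ suc (N i j)
      step i j i≤ j< with m≤n⇒m<n∨m≡n (bounded i j i≤ j<)
      ... | inj₂ e       = inj₂ e
      ... | inj₁ (s≤s p) = inj₁ (≤-antisym p (grows i j i≤ j<))
      magog : ∀ i j → i < n → suc j < n → N i (suc j) ≡ suc (N i j) → suc (N i (suc j)) ≤ N (suc i) (suc (suc j))
      magog i j i< j< e = ≤N (suc i) (suc (suc j)) (suc k) i< z<s (s≤s k≤j) j<
        (≤-trans (hi (suc j) k 1≤k k≤j j<) (s≤s (I≤from i (suc j) k (<⇒≤ i<) 1≤k k≤j (<⇒≤ j<) ≤-refl)))
        where
        k : ℕ
        k = N i (suc j)
        1≤k : 1 ≤ k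
        1≤k = ≤-trans z<s (≤-reflexive (sym e))
        k≤j : k ≤ suc j
        k≤j = N≤j i (suc j) (<⇒≤ i<) (<⇒≤ j<)

-- The correspondence between magog matrices and tables

tableOf : ∀ {n} → Matrix n → Table
tableOf {n} A = table n (FromMatrix.corner A)

matrixOf : ∀ n → Table → Matrix n
matrixOf n I = ToMatrix.matrix n (cornerOf n I)

tableOf-isTable : ∀ {n} {A : Matrix n} → IsMagog n A → IsTable n (tableOf A)
tableOf-isTable {n} {A} M = table-isTable n _ (FromMatrix.isCorner A M)

tableOf-Galois : ∀ {n} {A : Matrix n} → IsMagog n A → Galois n (FromMatrix.corner A) (tableOf A)
tableOf-Galois {n} {A} M = table-Galois n _ (FromMatrix.isCorner A M)

matrixOf-isMagog : ∀ n {I} → IsTable n I → IsMagog n (matrixOf n I)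
matrixOf-isMagog n {I} T = ToMatrix.isMagog n _ (cornerOf-isCorner n I T)

tableOf-matrixOf : ∀ n {I} → IsTable n I → tableOf (matrixOf n I) ≈[ n ] I
tableOf-matrixOf n {I} T = Galois-unique-I (tableOf-Galois (matrixOf-isMagog n T)) (cornerOf-Galois n I T)
  (λ i j → ToMatrix.corner-N n _ (cornerOf-isCorner n I T) i j)

matrix-ext : ∀ {n} {A A′ : Matrix n} → IsMagog n A → IsMagog n A′ →
  (∀ i j → i ≤ n → j ≤ n → FromMatrix.corner A i j ≡ FromMatrix.corner A′ i j) → A ≡ A′
matrix-ext {n} {A} {A′} M M′ e = rows-ext A A′ λ where
  (suc i) (suc j) _ i< _ j< → trans (FromMatrix.entry-corner A M i j i< j<) (trans
    (cong₂ _−ᶻ_ (cong₂ (λ s t → + s −ᶻ + t) (e (suc i) (suc j) i< j<) (e (suc i) j i< (<⇒≤ j<)))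
                (cong₂ (λ s t → + s −ᶻ + t) (e i (suc j) (<⇒≤ i<) j<) (e i j (<⇒≤ i<) (<⇒≤ j<))))
    (sym (FromMatrix.entry-corner A′ M′ i j i< j<)))

magog-ext : ∀ {n} {A A′ : Matrix n} → IsMagog n A → IsMagog n A′ → tableOf A ≈[ n ] tableOf A′ → A ≡ A′
magog-ext M M′ e = matrix-ext M M′ (Galois-unique-N (tableOf-Galois M) (tableOf-Galois M′) e)

-- Tables and walks

HasCard-map : ∀ {A C : Set} {P : A → Set} {Q : C → Set} {k} (f : A → C) (g : C → A) →
  (∀ a → P a → Q (f a)) → (∀ c → Q c → P (g c)) → (∀ a → P a → g (f a) ≡ a) → (∀ c → Q c → f (g c) ≡ c) →
  HasCard P k → HasCard Q k
HasCard-map {A} {P = P} {Q} f g fP gQ gf fg (xs , uniq , mem , len) =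
  map f xs , unique xs uniq (λ x x∈ → Equivalence.to (mem x) x∈) , (λ c → mk⇔ sound (complete c)) , trans
      (length-map f xs) len
  where
  unique : ∀ ys → Unique ys → (∀ y → y ∈ ys → P y) → Unique (map f ys)
  unique []       []       h = []
  unique (y ∷ ys) (n ∷ ns) h = All.tabulate (λ {z} z∈ e → distinct z∈ e) ∷ unique ys ns (λ z z∈ → h z (there z∈))
    where
    distinct : ∀ {z} → z ∈ map f ys → f y ≢ z
    distinct z∈ e with ∈-map⁻ f z∈
    ... | x , x∈ , refl = All.lookup n x∈
      (trans (sym (gf y (h y (here refl)))) (trans (cong g e) (gf x (h x (there x∈)))))
  sound : ∀ {c} → c ∈ map f xs → Q c
  sound c∈ with ∈-map⁻ f c∈
  ... | x , x∈ , refl = fP x (Equivalence.to (mem x) x∈)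
  complete : ∀ c → Q c → c ∈ map f xs
  complete c q = subst (_∈ map f xs) (fg c q) (∈-map⁺ f (Equivalence.from (mem (g c)) (gQ c q)))

HasCard-⇔ : ∀ {A : Set} {P Q : A → Set} {k} → (∀ a → P a → Q a) → (∀ a → Q a → P a) → HasCard P k → HasCard Q k
HasCard-⇔ to from = HasCard-map id id to from (λ _ _ → refl) (λ _ _ → refl)

HasCard-filter : ∀ {A : Set} {P Q : A → Set} {k} → (∀ a → Dec (Q a)) → HasCard P k → ∃ λ l → HasCard
    (λ a → P a × Q a) l
HasCard-filter Q? (xs , uniq , mem , len) = _ , filter Q? xs , Unique.filter⁺ Q? uniq ,
  (λ a → mk⇔ (λ a∈ → let x∈ , q = ∈-filter⁻ Q? a∈ in Equivalence.to (mem a) x∈ , q)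
             (λ (p , q) → ∈-filter⁺ Q? (Equivalence.from (mem a) p) q)) , refl

AtTable : (n : ℕ) → (Table → Set) → Matrix n → Set
AtTable n P A = IsMagog n A × P (tableOf A)

-- A table is a function with arbitrary values outside `1 ≤ k ≤ j ≤ n`, so one composite of the
-- coding maps is the identity only up to `≈`. The last two hypotheses on `G` and `P` absorb this.
HasCard-table : ∀ {X : Set} {R : X → Set} {k} n {P : Table → Set} (F : X → Table) (G : Table → X) →
  (∀ x → R x → IsTable n (F x)) → (∀ x → R x → P (F x)) → (∀ I → IsTable n I → P I → R (G I)) →
  (∀ x → R x → G (F x) ≡ x) → (∀ I → IsTable n I → P I → F (G I) ≈[ n ] I) →
  (∀ {I I′} → IsTable n I → IsTable n I′ → I ≈[ n ] I′ → G I ≡ G I′) →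
  (∀ {I I′} → IsTable n I → I ≈[ n ] I′ → P I → P I′) → HasCard R k → HasCard (AtTable n P) k
HasCard-table n {P} F G tab sat code GF FG resp respP = HasCard-map (λ x → matrixOf n (F x)) (λ A → G (tableOf A))
  (λ x r → matrixOf-isMagog n (tab x r) , respP (tab x r) (λ j k p q s → sym
      (tableOf-matrixOf n (tab x r) j k p q s)) (sat x r))
  (λ A (M , p) → code _ (tableOf-isTable M) p)
  (λ x r → trans (resp (tableOf-isTable (matrixOf-isMagog n (tab x r))) (tab x r) (tableOf-matrixOf n (tab x r)))
      (GF x r))
  (λ A (M , p) → let r = code _ (tableOf-isTable M) p in magog-ext (matrixOf-isMagog n (tab _ r)) M
    (λ j k a b c → trans (tableOf-matrixOf n (tab _ r) j k a b c) (FG _ (tableOf-isTable M) p j k a b c)))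

Unique-concatMap : ∀ {A C : Set} (f : A → List C) xs → Unique xs → (∀ x → Unique (f x)) →
  (∀ {x y z} → z ∈ f x → z ∈ f y → x ≡ y) → Unique (concatMap f xs)
Unique-concatMap f []       []       uf disj = []
Unique-concatMap f (x ∷ xs) (n ∷ ns) uf disj = Unique.++⁺ (uf x) (Unique-concatMap f xs ns uf disj) apart
  where
  apart : ∀ {z} → ¬ (z ∈ f x × z ∈ concatMap f xs)
  apart (z∈ , z∈′) with find (∈-concatMap⁻ f {xs = xs} z∈′)
  ... | y , y∈ , z∈y = All.lookup n y∈ (disj z∈ z∈y)

Unique-moves : ∀ a → Unique (moves a)
Unique-moves []       = [] ∷ []
Unique-moves (x ∷ as) = Unique-concatMap (extend x) (moves as) (Unique-moves as) uniq same
  where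
  uniq : ∀ bs → Unique (extend x bs)
  uniq bs with headIs? x bs
  ... | yes _ = [] ∷ []
  ... | no  _ = ((λ ()) ∷ []) ∷ [] ∷ []
  tail-of : ∀ {z} bs → z ∈ extend x bs → ∃ λ y → z ≡ y ∷ bs
  tail-of bs z∈ with headIs? x bs
  tail-of bs (here refl)         | yes _ = suc x , refl
  tail-of bs (here refl)         | no  _ = x , refl
  tail-of bs (there (here refl)) | no  _ = suc x , refl
  same : ∀ {bs cs z} → z ∈ extend x bs → z ∈ extend x cs → bs ≡ cs
  same {bs} {cs} p q with tail-of bs p | tail-of cs q
  ... | _ , refl | _ , refl = refl

∈-walks⁻ : ∀ {r a w} → w ∈ walks (suc r) a →
  ∃ λ b → ∃ λ w′ → w ≡ b ∷ w′ × b ∈ moves (a ++ suc r ∷ []) × w′ ∈ walks r b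
∈-walks⁻ {r} {a} w∈ with find (∈-concatMap⁻ (λ b → map (b ∷_) (walks r b)) {xs = moves (a ++ suc r ∷ [])} w∈)
... | b , b∈ , w∈b with ∈-map⁻ (b ∷_) w∈b
...   | w′ , w′∈ , refl = b , w′ , refl , b∈ , w′∈

∈-walks⁺ : ∀ {r a b w} → b ∈ moves (a ++ suc r ∷ []) → w ∈ walks r b → (b ∷ w) ∈ walks (suc r) a
∈-walks⁺ {r} {a} {b} b∈ w∈ = ∈-concatMap⁺ (λ b → map (b ∷_) (walks r b)) {xs = moves (a ++ suc r ∷ [])}
  (lose b∈ (∈-map⁺ (b ∷_) w∈))

Unique-walks : ∀ r a → Unique (walks r a)
Unique-walks zero    a = [] ∷ []
Unique-walks (suc r) a = Unique-concatMap (λ b → map (b ∷_) (walks r b)) _ (Unique-moves (a ++ suc r ∷ []))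
  (λ b → Unique.map⁺ (λ { refl → refl }) (Unique-walks r b)) same
  where
  same : ∀ {b c z} → z ∈ map (b ∷_) (walks r b) → z ∈ map (c ∷_) (walks r c) → b ≡ c
  same {b} {c} p q with ∈-map⁻ (b ∷_) p | ∈-map⁻ (c ∷_) q
  ... | _ , _ , refl | _ , _ , refl = refl

nth : ∀ {A : Set} → A → List A → ℕ → A
nth d []       i       = d
nth d (x ∷ xs) zero    = x
nth d (x ∷ xs) (suc i) = nth d xs i

nth-ext : ∀ {A : Set} (d : A) xs ys → length xs ≡ length ys → (∀ i → i < length xs → nth d xs i ≡ nth d ys i) → xs
    ≡ ys
nth-ext d []       []       _ _ = refl
nth-ext d (x ∷ xs) (y ∷ ys) l e = cong₂ _∷_ (e 0 z<s) (nth-ext d xs ys (suc-injective l) (λ i p → e (suc i) (s≤s p)))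

nth-applyUpTo : ∀ {A : Set} (d : A) f n i → i < n → nth d (applyUpTo f n) i ≡ f i
nth-applyUpTo d f (suc n) zero    _       = refl
nth-applyUpTo d f (suc n) (suc i) (s≤s p) = nth-applyUpTo d (f ∘ suc) n i p

nth-++ : ∀ {A : Set} (d : A) xs ys i → i < length xs → nth d (xs ++ ys) i ≡ nth d xs i
nth-++ d (x ∷ xs) ys zero    _       = refl
nth-++ d (x ∷ xs) ys (suc i) (s≤s p) = nth-++ d xs ys i p

nth-last : ∀ {A : Set} (d : A) xs y → nth d (xs ++ y ∷ []) (length xs) ≡ y
nth-last d []       y = refl
nth-last d (x ∷ xs) y = nth-last d xs y

nth-Pointwise : ∀ {R : ℕ → ℕ → Set} {xs ys} → Pointwise R xs ys → ∀ i → i < length xs → R (nth 0 xs i) (nth 0 ys i)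
nth-Pointwise (r ∷ _)  zero    _       = r
nth-Pointwise (_ ∷ rs) (suc i) (s≤s p) = nth-Pointwise rs i p

nth-Desc : ∀ {xs} → Desc xs → ∀ i → suc i < length xs → nth 0 xs (suc i) < nth 0 xs i
nth-Desc (p ∷ _) zero    _       = p
nth-Desc (_ ∷ d) (suc i) (s≤s q) = nth-Desc d i q
nth-Desc [-]     i (s≤s ())

-- Below a given entry of a strictly decreasing list there is room for all later ones. This keeps
-- the truncated subtraction in the inverse coding exact.
Desc-length : ∀ xs → Desc xs → ∀ i → i < length xs → length xs ≤ nth 0 xs i + suc i
Desc-length (x ∷ [])     d       zero    _       = m≤n+m 1 x
Desc-length (x ∷ y ∷ xs) (p ∷ d) zero    _       = ≤-trans (s≤s (Desc-length (y ∷ xs) d 0 z<s))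
  (≤-trans (s≤s (≤-reflexive (+-comm y 1))) (≤-trans (s≤s p) (≤-reflexive (+-comm 1 x))))
Desc-length (x ∷ y ∷ xs) (p ∷ d) (suc i) (s≤s q) = ≤-trans (s≤s (Desc-length (y ∷ xs) d i q))
  (≤-reflexive (sym (+-suc _ (suc i))))
Desc-length (x ∷ [])     d       (suc i) (s≤s ())

Pointwise-applyUpTo : ∀ {R : ℕ → ℕ → Set} f g n → (∀ i → i < n → R (f i) (g i)) → Pointwise R (applyUpTo f n)
    (applyUpTo g n)
Pointwise-applyUpTo f g zero    h = []
Pointwise-applyUpTo f g (suc n) h = h 0 z<s ∷ Pointwise-applyUpTo (f ∘ suc) (g ∘ suc) n (λ i p → h (suc i) (s≤s p))

applyUpTo-cong : ∀ {A : Set} {f g : ℕ → A} n → (∀ i → i < n → f i ≡ g i) → applyUpTo f n ≡ applyUpTo g n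
applyUpTo-cong zero    e = refl
applyUpTo-cong (suc n) e = cong₂ _∷_ (e 0 z<s) (applyUpTo-cong n (λ i p → e (suc i) (s≤s p)))

-- In row t of a walk with r walkers still to enter, walker c stands at I (c + r + 1) (r + 1) + t − c − 1.
module FromTable (I : Table) where

  position : ℕ → ℕ → ℕ → ℕ
  position t r c = (I (c + suc r) (suc r) + t) ∸ suc c

  row : ℕ → ℕ → List ℕ
  row t r = applyUpTo (position t r) t

  walk : ℕ → ℕ → List (List ℕ)
  walk t zero    = []
  walk t (suc r) = row (suc t) r ∷ walk (suc t) r

  length-walk : ∀ t r → length (walk t r) ≡ r
  length-walk t zero    = refl
  length-walk t (suc r) = cong suc (length-walk (suc t) r)

  nth-walk : ∀ t r s → s < r → nth [] (walk t r) s ≡ row (suc t + s) (r ∸ suc s)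
  nth-walk t (suc r) zero    _       = cong (λ k → row (suc k) r) (sym (+-identityʳ t))
  nth-walk t (suc r) (suc s) (s≤s p) = trans (nth-walk (suc t) r s p)
      (cong (λ k → row (suc k) (r ∸ suc s)) (sym (+-suc t s)))

  module _ {M : ℕ} (T : IsTable (suc M) I) where
    open IsTable T

    index≤ : ∀ {c t r} → c ≤ t → t + suc r ≡ M → c + suc r < suc M
    index≤ {c} {t} {r} c≤ e = s≤s (≤-trans (+-monoˡ-≤ (suc r) c≤) (≤-reflexive e))

    positive : ∀ {c t r} → c ≤ t → t + suc r ≡ M → 1 ≤ I (c + suc r) (suc r)
    positive {c} {t} {r} c≤ e = ≤-trans z<s
      (I-lower (suc M) I T (suc M ∸ (c + suc r)) (c + suc r) (suc r) z<s (m≤n+m (suc r) c)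
          (m+[n∸m]≡n (<⇒≤ (index≤ c≤ e))))

    -- `top` puts the newcomer at its entrance. Along a diagonal the table grows by 1 or 0 by `hi`
    -- and `lo`, and against the shift by `t` the walker then stays or advances. `anti` and the
    -- shift by `c` keep the positions distinct.
    row-moves : ∀ t r → t + suc r ≡ M → row (suc t) r ∈ moves (row t (suc r) ++ suc r ∷ [])
    row-moves t r e = subst (λ a → row (suc t) r ∈ moves a) (sym extended)
      (moves-complete _ (Pointwise-applyUpTo (position t (suc r)) (position (suc t) r) (suc t)
          (λ c p → steps c (≤-pred p)))
        (Linked.applyUpTo⁺₁ (position (suc t) r) (suc t) (λ {c} p → descends c (≤-pred p))))
      where
      newborn : position t (suc r) t ≡ suc r
      newborn = trans (cong (λ x → (x + t) ∸ suc t) (trans (cong (λ k → I k (suc (suc r)))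
          (trans (+-suc t (suc r)) (cong suc e)))
          (top (suc (suc r)) z<s (s≤s (≤-trans (m≤n+m (suc r) t) (≤-reflexive e))))))
        (trans (cong (_∸ t) (sym refl)) (m+n∸n≡m (suc r) t))
      extended : row t (suc r) ++ suc r ∷ [] ≡ applyUpTo (position t (suc r)) (suc t)
      extended = trans (cong (λ y → row t (suc r) ++ y ∷ []) (sym newborn)) (applyUpTo-∷ʳ (position t (suc r)) t)
      steps : ∀ c → c ≤ t → Step (position t (suc r) c) (position (suc t) r c)
      steps c c≤ rewrite +-suc c (suc r) with m≤n⇒m<n∨m≡n (hi (c + suc r) (suc r) z<s (m≤n+m (suc r) c) (index≤ c≤ e))
      ... | inj₂ up   rewrite up = inj₁ (cong (_∸ suc c) (+-suc (I (c + suc r) (suc r)) t))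
      ... | inj₁ (s≤s p) rewrite ≤-antisym p (lo (c + suc r) (suc r) z<s (m≤n+m (suc r) c) (index≤ c≤ e)) =
        inj₂ (trans (cong (_∸ suc c) (+-suc (I (c + suc r) (suc r)) t))
            (+-∸-assoc 1 {I (c + suc r) (suc r) + t} {suc c} (+-mono-≤ (positive c≤ e) c≤)))
      descends : ∀ c → suc c ≤ t → position (suc t) r (suc c) < position (suc t) r c
      descends c c< = ≤-trans (s≤s (∸-monoˡ-≤ (suc (suc c)) (+-monoˡ-≤ (suc t)
          (anti (c + suc r) (suc r) z<s (m≤n+m (suc r) c) (index≤ (<⇒≤ c<) e)))))
        (≤-reflexive (sym (+-∸-assoc 1 {I (c + suc r) (suc r) + suc t} {suc (suc c)}
            (≤-trans (s≤s c<) (m≤n+m (suc t) _)))))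

    walk-∈ : ∀ t r → t + r ≡ M → walk t r ∈ walks r (row t r)
    walk-∈ t zero    e = here refl
    walk-∈ t (suc r) e = ∈-walks⁺ {r} {row t (suc r)} (row-moves t r e) (walk-∈ (suc t) r (trans (sym (+-suc t r)) e))

walk-cong : ∀ {I I′} M → I ≈[ suc M ] I′ → ∀ t r → t + r ≡ M → FromTable.walk I t r ≡ FromTable.walk I′ t r
walk-cong M e t zero    p = refl
walk-cong M e t (suc r) p = cong₂ _∷_
  (applyUpTo-cong (suc t) (λ c c< → cong (λ x → (x + suc t) ∸ suc c)
    (e (c + suc r) (suc r) z<s (m≤n+m (suc r) c) (m≤n⇒m≤1+n (≤-trans (+-monoˡ-≤ (suc r) (≤-pred c<))
        (≤-reflexive p))))))
  (walk-cong M e (suc t) r (trans (sym (+-suc t r)) p))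

-- Row `s` is listed together with the walker about to enter at `r − s`. At `s = r` this appends
-- position 0, which later yields the table entry in column `n` at `k = 1`.
record Rows (r : ℕ) (a : List ℕ) (w : List (List ℕ)) : Set where
  field
    desc  : ∀ s → s ≤ r → Desc (nth [] (a ∷ w) s ++ (r ∸ s) ∷ [])
    size  : ∀ s → s ≤ r → length (nth [] (a ∷ w) s) ≡ s + length a
    steps : ∀ s → s < r → Pointwise Step (nth [] (a ∷ w) s ++ (r ∸ s) ∷ []) (nth [] (a ∷ w) (suc s))

∈-walks-Rows : ∀ r a w → Desc a → All (_> r) a → w ∈ walks r a → length w ≡ r × Rows r a w
∈-walks-Rows zero    a w d pos (here refl) = refl , record
  { desc = λ { zero _ → desc-∷ʳ a d pos } ; size = λ { zero _ → refl } ; steps = λ _ () }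
∈-walks-Rows (suc r) a w d pos w∈ with ∈-walks⁻ {r} {a} w∈
... | b , w′ , refl , b∈ , w′∈ with moves-sound (a ++ suc r ∷ []) (desc-∷ʳ a d pos) b∈
...   | ps , db with ∈-walks-Rows r b w′ db (step-> ps (∷ʳ-> a (desc-∷ʳ a d pos))) w′∈
...     | len , rows = cong suc len , record
  { desc  = λ { zero _ → desc-∷ʳ a d pos ; (suc s) (s≤s p) → Rows.desc rows s p }
  ; size  = λ { zero _ → refl ; (suc s) (s≤s p) → trans (Rows.size rows s p)
      (trans (cong (λ k → s + k) grown) (+-suc s (length a))) }
  ; steps = λ { zero _ → ps ; (suc s) (s≤s p) → Rows.steps rows s p } }
  where
  grown : length b ≡ suc (length a)
  grown = trans (sym (Pointwise.Pointwise-length ps)) (trans (length-++ a) (+-comm (length a) 1))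

module ToTable (M : ℕ) (w : List (List ℕ)) where

  extended : ℕ → List ℕ
  extended s = nth [] ([] ∷ w) s ++ (M ∸ s) ∷ []

  -- The formula for `position` solved for the table entry, with `c = j − k` and `t = M + 1 − k`.
  walkTable : Table
  walkTable j k = (nth 0 (extended (suc M ∸ k)) (j ∸ k) + suc (j ∸ k)) ∸ (suc M ∸ k)

  module _ (w∈ : w ∈ walks M []) where

    private
      R : length w ≡ M × Rows M [] w
      R = ∈-walks-Rows M [] w [] [] w∈
    open Rows (proj₂ R)

    size′ : ∀ s → s ≤ M → length (nth [] ([] ∷ w) s) ≡ s
    size′ s p = trans (size s p) (+-identityʳ s)

    length-extended : ∀ s → s ≤ M → length (extended s) ≡ suc s
    length-extended s p = trans (length-++ (nth [] ([] ∷ w) s)) (trans (cong (_+ 1) (size′ s p)) (+-comm s 1))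

    walkTable-isTable : IsTable (suc M) walkTable
    walkTable-isTable = record
      { top  = λ { (suc r) _ (s≤s r≤M) → newest r r≤M }
      ; anti = λ { j (suc r) _ q (s≤s j≤M) → decreasing j r q j≤M }
      ; lo   = λ { j (suc r) _ q (s≤s j≤M) → proj₁ (advance j r q j≤M) }
      ; hi   = λ { j (suc r) _ q (s≤s j≤M) → proj₂ (advance j r q j≤M) } }
      where
      newest : ∀ r → r ≤ M → walkTable (suc M) (suc r) ≡ suc r
      newest r r≤M = trans (cong (λ y → (y + suc (M ∸ r)) ∸ (M ∸ r)) last)
        (trans (cong (_∸ (M ∸ r)) (+-suc r (M ∸ r))) (m+n∸n≡m (suc r) (M ∸ r)))
        where
        last : nth 0 (extended (M ∸ r)) (M ∸ r) ≡ r
        last = trans (cong (nth 0 (extended (M ∸ r))) (sym (size′ (M ∸ r) (m∸n≤m M r))))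
          (trans (nth-last 0 (nth [] ([] ∷ w) (M ∸ r)) (M ∸ (M ∸ r))) (m∸[m∸n]≡n r≤M))
      decreasing : ∀ j r → suc r ≤ j → j ≤ M → walkTable (suc j) (suc r) ≤ walkTable j (suc r)
      decreasing j r q j≤M = ∸-monoˡ-≤ (M ∸ r)
        (subst (λ c → nth 0 (extended (M ∸ r)) c + suc c ≤ nth 0 (extended (M ∸ r)) (j ∸ suc r) + suc (j ∸ suc r))
            (sym (c≡))
          (≤-trans (≤-reflexive (+-suc _ (suc (j ∸ suc r)))) (+-monoˡ-≤ (suc (j ∸ suc r))
            (nth-Desc (desc (M ∸ r) (m∸n≤m M r)) (j ∸ suc r) (subst (suc (j ∸ suc r) <_)
                (sym (length-extended (M ∸ r) (m∸n≤m M r)))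
              (s≤s (≤-trans (≤-reflexive (sym c≡)) (∸-monoˡ-≤ r j≤M))))))))
        where
        c≡ : j ∸ r ≡ suc (j ∸ suc r)
        c≡ = +-∸-assoc 1 q
      advance : ∀ j r → suc r ≤ j → j ≤ M →
        (walkTable j (suc r) ≤ walkTable (suc j) (suc (suc r))) ×
            (walkTable (suc j) (suc (suc r)) ≤ suc (walkTable j (suc r)))
      advance j r q j≤M = bounds
        where
        c t : ℕ
        c = j ∸ suc r
        t = M ∸ suc r
        t≡ : M ∸ r ≡ suc t
        t≡ = +-∸-assoc 1 (≤-trans q j≤M)
        c≤t : c ≤ t
        c≤t = ∸-monoˡ-≤ (suc r) j≤M
        t<M : t < M
        t<M = subst (_≤ M) t≡ (m∸n≤m M r)
        later : nth 0 (extended (suc t)) c ≡ nth 0 (nth [] ([] ∷ w) (suc t)) c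
        later = nth-++ 0 (nth [] ([] ∷ w) (suc t)) (M ∸ suc t ∷ []) c
            (subst (c <_) (sym (size′ (suc t) t<M)) (s≤s c≤t))
        move : Step (nth 0 (extended t) c) (nth 0 (extended (suc t)) c)
        move = subst (Step (nth 0 (extended t) c)) (sym later)
          (nth-Pointwise (steps t t<M) c (subst (c <_) (sym (length-extended t (<⇒≤ t<M))) (s≤s c≤t)))
        compare : ∀ {y y′} → Step y y′ → ((y′ + suc c) ∸ suc t ≤ (y + suc c) ∸ t) ×
            ((y + suc c) ∸ t ≤ suc ((y′ + suc c) ∸ suc t))
        compare {y} (inj₁ refl) = ∸-monoʳ-≤ (y + suc c) (n≤1+n t) , within (y + suc c) t
          where
          within : ∀ x t → x ∸ t ≤ suc (x ∸ suc t)
          within zero    zero    = z≤n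
          within zero    (suc t) = z≤n
          within (suc x) zero    = ≤-refl
          within (suc x) (suc t) = within x t
        compare {y} (inj₂ refl) = ≤-refl , n≤1+n _
        bounds : (walkTable j (suc r) ≤ walkTable (suc j) (suc (suc r))) ×
            (walkTable (suc j) (suc (suc r)) ≤ suc (walkTable j (suc r)))
        bounds = subst (λ s → ((nth 0 (extended s) c + suc c) ∸ s ≤ walkTable (suc j) (suc (suc r)))
                              × (walkTable (suc j) (suc (suc r)) ≤ suc ((nth 0 (extended s) c + suc c) ∸ s)))
                       (sym t≡) (compare move)

    walk-walkTable : FromTable.walk walkTable 0 M ≡ w
    walk-walkTable = nth-ext [] _ w (trans (FromTable.length-walk walkTable 0 M) (sym (proj₁ R))) λ s s< →
      let s<M = subst (s <_) (FromTable.length-walk walkTable 0 M) s< in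
      trans (FromTable.nth-walk walkTable 0 M s s<M) (same-row s s<M)
      where
      same-row : ∀ s → s < M → FromTable.row walkTable (suc s) (M ∸ suc s) ≡ nth [] w s
      same-row s s<M = nth-ext 0 (FromTable.row walkTable (suc s) r) (nth [] w s)
          (trans (length-applyUpTo (FromTable.position walkTable (suc s) r) (suc s))
          (sym (size′ (suc s) s<M))) λ c c< →
        let c<t = subst (c <_) (length-applyUpTo (FromTable.position walkTable (suc s) r) (suc s)) c< in
        trans (nth-applyUpTo 0 (FromTable.position walkTable (suc s) r) (suc s) c c<t) (same-position c c<t)
        where
        r : ℕ
        r = M ∸ suc s
        M∸r : M ∸ r ≡ suc s
        M∸r = m∸[m∸n]≡n s<M
        same-position : ∀ c → c < suc s → FromTable.position walkTable (suc s) r c ≡ nth 0 (nth [] w s) c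
        same-position c c<t = begin
          ((nth 0 (extended (M ∸ r)) ((c + suc r) ∸ suc r) + suc ((c + suc r) ∸ suc r)) ∸ (M ∸ r) + suc s) ∸ suc c
            ≡⟨ cong₂ (λ x t → ((nth 0 (extended t) x + suc x) ∸ t + suc s) ∸ suc c) (m+n∸n≡m c (suc r)) M∸r ⟩
          ((nth 0 (extended (suc s)) c + suc c) ∸ suc s + suc s) ∸ suc c
            ≡⟨ cong (λ y → ((y + suc c) ∸ suc s + suc s) ∸ suc c) (nth-++ 0 (nth [] w s) _ c c<len) ⟩
          ((nth 0 (nth [] w s) c + suc c) ∸ suc s + suc s) ∸ suc c
            ≡⟨ cong (_∸ suc c) (m∸n+n≡m (≤-trans (≤-reflexive (sym (size′ (suc s) s<M)))
                (Desc-length (nth [] w s) (desc-init (nth [] w s) (desc (suc s) s<M)) c c<len))) ⟩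
          (nth 0 (nth [] w s) c + suc c) ∸ suc c
            ≡⟨ m+n∸n≡m (nth 0 (nth [] w s) c) (suc c) ⟩
          nth 0 (nth [] w s) c ∎
          where
          open ≡-Reasoning
          c<len : c < length (nth [] w s)
          c<len = subst (c <_) (sym (size′ (suc s) s<M)) c<t
          desc-init : ∀ xs {y} → Desc (xs ++ y ∷ []) → Desc xs
          desc-init []           d       = []
          desc-init (x ∷ [])     d       = [-]
          desc-init (x ∷ z ∷ xs) (p ∷ d) = p ∷ desc-init (z ∷ xs) d

walkTable-walk : ∀ M {I} → IsTable (suc M) I → ToTable.walkTable M (FromTable.walk I 0 M) ≈[ suc M ] I
walkTable-walk M {I} T j (suc r) _ r<j (s≤s r≤) with m≤n⇒m<n∨m≡n (s≤s r≤)
... | inj₂ refl = trans (IsTable.top (ToTable.walkTable-isTable M _ (FromTable.walk-∈ I T 0 M refl))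
    (suc r) z<s r<j) (sym (IsTable.top T (suc r) z<s r<j))
... | inj₁ (s≤s j≤M) = body (M ∸ r) refl
  where
  c : ℕ
  c = j ∸ suc r
  r<M : r < M
  r<M = ≤-trans r<j j≤M
  body : ∀ t → M ∸ r ≡ t → (nth 0 (ToTable.extended M (FromTable.walk I 0 M) t) c + suc c) ∸ t ≡ I j (suc r)
  body zero    e = ⊥-elim (n≮n 0 (subst (0 <_) e (m<n⇒0<n∸m r<M)))
  body (suc s) e = begin
    (nth 0 (nth [] (FromTable.walk I 0 M) s ++ (M ∸ suc s) ∷ []) c + suc c) ∸ suc s
      ≡⟨ cong (λ l → (nth 0 (l ++ (M ∸ suc s) ∷ []) c + suc c) ∸ suc s) (FromTable.nth-walk I 0 M s s<M) ⟩
    (nth 0 (FromTable.row I (suc s) (M ∸ suc s) ++ (M ∸ suc s) ∷ []) c + suc c) ∸ suc s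
      ≡⟨ cong (λ y → (y + suc c) ∸ suc s) (trans (nth-++ 0 (FromTable.row I (suc s) (M ∸ suc s)) _ c
          (subst (c <_) (sym (length-applyUpTo pos (suc s))) c<t)) (nth-applyUpTo 0 pos (suc s) c c<t)) ⟩
    ((I (c + suc (M ∸ suc s)) (suc (M ∸ suc s)) + suc s) ∸ suc c + suc c) ∸ suc s
      ≡⟨ cong (_∸ suc s) (m∸n+n≡m {J + suc s} {suc c} (≤-trans c<t (m≤n+m (suc s) J))) ⟩
    (I (c + suc (M ∸ suc s)) (suc (M ∸ suc s)) + suc s) ∸ suc s
      ≡⟨ m+n∸n≡m J (suc s) ⟩
    I (c + suc (M ∸ suc s)) (suc (M ∸ suc s))
      ≡⟨ cong₂ I (trans (cong (λ k → c + suc k) back) (m∸n+n≡m r<j)) (cong suc back) ⟩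
    I j (suc r) ∎
    where
    open ≡-Reasoning
    pos : ℕ → ℕ
    pos = FromTable.position I (suc s) (M ∸ suc s)
    J : ℕ
    J = I (c + suc (M ∸ suc s)) (suc (M ∸ suc s))
    s<M : s < M
    s<M = subst (_≤ M) e (m∸n≤m M r)
    back : M ∸ suc s ≡ r
    back = trans (cong (M ∸_) (sym e)) (m∸[m∸n]≡n (<⇒≤ r<M))
    c<t : c < suc s
    c<t = subst (c <_) e (≤-trans (≤-reflexive (sym (+-∸-assoc 1 r<j))) (∸-monoˡ-≤ r j≤M))

HasCard-magog : ∀ M → HasCard (IsMagog (suc M)) (length (walks M []))
HasCard-magog M = HasCard-⇔ (λ _ → proj₁) (λ _ m → m , tt)
  (HasCard-table (suc M) {P = λ _ → ⊤} (ToTable.walkTable M) (λ I → FromTable.walk I 0 M)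
    (λ w w∈ → ToTable.walkTable-isTable M w w∈) (λ _ _ → tt) (λ I T _ → FromTable.walk-∈ I T 0 M refl)
    (λ w w∈ → ToTable.walk-walkTable M w w∈) (λ I T _ → walkTable-walk M T)
    (λ _ _ e → walk-cong M e 0 M refl) (λ _ _ _ → tt)
    (walks M [] , Unique-walks M [] , (λ w → mk⇔ id id) , refl))

-- The number of walks as a Pfaffian of powers of u

data Parity : ℕ → Set where
  even : ∀ {m} e → Padding e → length (pending e m) ≡ 2 * half (suc m) → powers (suc m) ≡ pending e m → Parity m

parity : ∀ m → Parity m
parity zero          = even [] unpadded refl refl
parity (suc zero)    = even (pw 0 0 ∷ []) padded refl refl
parity (suc (suc m)) with parity m
... | even e pad len eq = even e pad (trans (cong (λ l → suc (suc l)) len) (sym (*-suc 2 (half (suc m)))))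
    (cong (λ l → u (suc (suc m)) ∷ u (suc m) ∷ l) eq)

length-pending : ∀ e m → length (pending e m) ≡ m + length e
length-pending e zero    = refl
length-pending e (suc m) = cong suc (length-pending e m)

length-walks : ∀ M → + length (walks M []) ≡ magogPf (suc M)
length-walks M with parity M
... | even e pad len eq = trans (walks-Pf M (half (suc M)) [] pad [] [] (trans (sym (length-pending e M)) len))
  (cong (Pf (half (suc M))) (sym eq))

walks-formula : ∀ M → length (walks M []) * prodBelow (suc M) (λ j → (suc M + j) !) ≡ prodBelow (suc M)
    (λ j → (3 * j + 1) !)
walks-formula M = ℤP.+-injective (trans (ℤP.pos-* (length (walks M [])) _)
  (trans (cong (_*ᶻ + prodBelow (suc M) (λ j → (suc M + j) !)) (length-walks M)) (magog-formula (suc M))))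

-- Matrices with a prescribed entry 1

HasCard-tables : ∀ {n n′ k} {P Q : Table → Set} (F G : Table → Table) →
  (∀ I → IsTable n I → P I → IsTable n′ (F I) × Q (F I)) → (∀ I → IsTable n′ I → Q I → IsTable n (G I) × P (G I)) →
  (∀ I → IsTable n I → P I → G (F I) ≈[ n ] I) → (∀ I → IsTable n′ I → Q I → F (G I) ≈[ n′ ] I) →
  (∀ {I I′} → I ≈[ n ] I′ → F I ≈[ n′ ] F I′) → (∀ {I I′} → I ≈[ n′ ] I′ → G I ≈[ n ] G I′) →
  (∀ {I I′} → IsTable n I → I ≈[ n ] I′ → P I → P I′) → (∀ {I I′} → IsTable n′ I → I ≈[ n′ ] I′ → Q I → Q I′) →
  HasCard (AtTable n P) k → HasCard (AtTable n′ Q) k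
HasCard-tables {n} {n′} {k} {P} {Q} F G fP gQ GF FG respF respG respP respQ =
  HasCard-table n′ (λ A → F (tableOf A)) (λ I → matrixOf n (G I))
    (λ A (M , p) → proj₁ (fP _ (tableOf-isTable M) p))
    (λ A (M , p) → proj₂ (fP _ (tableOf-isTable M) p))
    (λ I T q → let T′ , p = gQ I T q in matrixOf-isMagog n T′ , respP T′ (≈-sym (tableOf-matrixOf n T′)) p)
    (λ A (M , p) → let T = tableOf-isTable M ; T′ , q = fP _ T p ; T″ , _ = gQ _ T′ q in
      magog-ext (matrixOf-isMagog n T″) M (≈-trans (tableOf-matrixOf n T″) (GF _ T p)))
    (λ I T q → let T′ , _ = gQ I T q in ≈-trans (respF (tableOf-matrixOf n T′)) (FG I T q))
    (λ {I} {I′} T T′ e → matrixOf-cong (respG e))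
    respQ
  where
  ≈-sym : ∀ {n I I′} → I ≈[ n ] I′ → I′ ≈[ n ] I
  ≈-sym e j k p q r = sym (e j k p q r)
  ≈-trans : ∀ {n I I′ I″} → I ≈[ n ] I′ → I′ ≈[ n ] I″ → I ≈[ n ] I″
  ≈-trans e e′ j k p q r = trans (e j k p q r) (e′ j k p q r)
  matrixOf-cong : ∀ {n I I′} → I ≈[ n ] I′ → matrixOf n I ≡ matrixOf n I′
  matrixOf-cong {n} {I} {I′} e = cong-matrix
    where
    greatest-cong : ∀ {P P′ : ℕ → Set} j (p : ∀ k → Dec (P k)) (p′ : ∀ k → Dec (P′ k)) →
      (∀ k → 1 ≤ k → k ≤ j → P k → P′ k) → (∀ k → 1 ≤ k → k ≤ j → P′ k → P k) → greatest j p ≡ greatest j p′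
    greatest-cong zero    p p′ f g = refl
    greatest-cong (suc j) p p′ f g with p (suc j) | p′ (suc j)
    ... | yes _ | yes _ = refl
    ... | yes a | no ¬b = ⊥-elim (¬b (f (suc j) z<s ≤-refl a))
    ... | no ¬a | yes b = ⊥-elim (¬a (g (suc j) z<s ≤-refl b))
    ... | no _  | no _  = greatest-cong j p p′ (λ k a b → f k a (m≤n⇒m≤1+n b)) (λ k a b → g k a (m≤n⇒m≤1+n b))
    corner-cong : ∀ i j → j ≤ n → cornerOf n I i j ≡ cornerOf n I′ i j
    corner-cong i j j≤ = greatest-cong j _ _ (λ k a b → subst (_≤ i) (e j k a b j≤))
        (λ k a b → subst (_≤ i) (sym (e j k a b j≤)))
    cong-matrix : matrixOf n I ≡ matrixOf n I′
    cong-matrix = rows-ext _ _ λ where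
      (suc i) (suc j) _ i< _ j< → trans (entry-fromFun₂ n _ (suc i) (suc j) z<s i< z<s j<)
        (trans (cong₂ _−ᶻ_
          (cong₂ (λ s t → + s −ᶻ + t) (corner-cong (suc i) (suc j) j<) (corner-cong (suc i) j (<⇒≤ j<)))
          (cong₂ (λ s t → + s −ᶻ + t) (corner-cong i (suc j) j<) (corner-cong i j (<⇒≤ j<))))
        (sym (entry-fromFun₂ n _ (suc i) (suc j) z<s i< z<s j<)))

module Entries {n} {A : Matrix n} (M : IsMagog n A) where
  open FromMatrix A using (corner) public
  open IsCorner (FromMatrix.isCorner A M) public hiding (magog)
  open Galois (tableOf-Galois M) public

  N : Table
  N = corner

  I : Table
  I = tableOf A

  T : IsTable n I
  T = tableOf-isTable M

  private
    entry-value : ∀ i j {s t} → i < n → j < n → N (suc i) (suc j) ≡ s → N i (suc j) ≡ t →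
      entry A (suc i) (suc j) ≡ (+ s −ᶻ + N (suc i) j) −ᶻ (+ t −ᶻ + N i j)
    entry-value i j i< j< a b = trans (FromMatrix.entry-corner A M i j i< j<)
      (cong₂ (λ s t → (+ s −ᶻ + N (suc i) j) −ᶻ (+ t −ᶻ + N i j)) a b)

    x−x : ∀ x y → (x −ᶻ x) −ᶻ (y −ᶻ y) ≡ 0ℤ
    x−x = solve-∀

    x−suc : ∀ x y → (x −ᶻ x) −ᶻ (+ 1 +ᶻ y −ᶻ y) ≡ ℤ.-1ℤ
    x−suc = solve-∀

    suc−x : ∀ x y → (+ 1 +ᶻ x −ᶻ x) −ᶻ (y −ᶻ y) ≡ 1ℤ
    suc−x = solve-∀

    suc−suc : ∀ x y → (+ 1 +ᶻ x −ᶻ x) −ᶻ (+ 1 +ᶻ y −ᶻ y) ≡ 0ℤ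
    suc−suc = solve-∀

    impossible : ∀ {P : Set} {x y} → x ≡ 1ℤ → x ≡ y → y ≢ 1ℤ → P
    impossible e e′ y≢1 = ⊥-elim (y≢1 (trans (sym e′) e))

  -- An entry is the difference of two consecutive partial sums of its column, each 0 or 1, and
  -- equals 1 only as `1 − 0`.
  one⇒ : ∀ i j → i < n → j < n → entry A (suc i) (suc j) ≡ 1ℤ → N (suc i) (suc j) ≡ suc (N (suc i) j) × N i
      (suc j) ≡ N i j
  one⇒ i j i< j< e = cases (step (suc i) j i< j<) (step i j (<⇒≤ i<) j<)
    where
    x y : ℤ
    x = + N (suc i) j
    y = + N i j
    cases : N (suc i) (suc j) ≡ N (suc i) j ⊎ N (suc i) (suc j) ≡ suc (N (suc i) j) → N i (suc j) ≡ N i j ⊎ N i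
        (suc j) ≡ suc (N i j) →
      N (suc i) (suc j) ≡ suc (N (suc i) j) × N i (suc j) ≡ N i j
    cases (inj₂ a) (inj₁ b) = a , b
    cases (inj₁ a) (inj₁ b) = impossible e (trans (entry-value i j i< j< a b) (x−x x y)) (λ ())
    cases (inj₁ a) (inj₂ b) = impossible e (trans (entry-value i j i< j< a b) (x−suc x y)) (λ ())
    cases (inj₂ a) (inj₂ b) = impossible e (trans (entry-value i j i< j< a b) (suc−suc x y)) (λ ())

  one⇐ : ∀ i j → i < n → j < n → N (suc i) (suc j) ≡ suc (N (suc i) j) → N i (suc j) ≡ N i j → entry A (suc i)
      (suc j) ≡ 1ℤ
  one⇐ i j i< j< a b = trans (entry-value i j i< j< a b) (suc−x (+ N (suc i) j) (+ N i j))

  N≤row : ∀ i j → i ≤ n → j ≤ n → N i j ≤ i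
  N≤row i j i≤ j≤ with N i j in eq
  ... | zero  = z≤n
  ... | suc k = ≤-trans (I-lower n I T (n ∸ j) j (suc k) z<s k≤j (m+[n∸m]≡n j≤))
      (from i j (suc k) i≤ z<s k≤j j≤ (≤-reflexive (sym eq)))
    where
    k≤j : suc k ≤ j
    k≤j = ≤-trans (≤-reflexive (sym eq)) (N≤j i j i≤ j≤)

  jump : ∀ i j → i ≤ n → j < n → N i j < N i (suc j) → N i (suc j) ≡ suc (N i j)
  jump i j i≤ j< p with step i j i≤ j<
  ... | inj₂ e = e
  ... | inj₁ e = ⊥-elim (n≮n _ (subst (N i j <_) e p))

  empty : ∀ {i j} → i ≤ n → 1 ≤ j → j ≤ n → i < I j 1 → N i j ≡ 0
  empty {i} {j} i≤ 1≤j j≤ p with N i j in eq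
  ... | zero  = refl
  ... | suc k = ⊥-elim (<⇒≱ p (from i j 1 i≤ ≤-refl 1≤j j≤ (≤-trans z<s (≤-reflexive (sym eq)))))

  late : ∀ {i j} → i ≤ n → 1 ≤ j → j ≤ n → N i j ≡ 0 → i < I j 1
  late {i} {j} i≤ 1≤j j≤ e = ≰⇒> λ p → n≮n 0 (≤-trans (to i j 1 i≤ ≤-refl 1≤j j≤ p) (≤-reflexive e))

At11 At12 At21 : Table → Set
At11 I = I 1 1 ≤ 1
At12 I = I 2 1 ≤ 1 × 1 < I 1 1
At21 I = I 1 1 ≤ 2 × 1 < I 1 1

-- The parameter is `n − 2`. Since no table entry exceeds `n`, `Atₙ₁` means `I 1 1 = n`. The premise
-- in `At₁ₙ₋₁` is there because column `n − 2` does not exist for `n = 2`.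
Atₙ₁ Atₙ₂ At₁ₙ At₁ₙ₋₁ : ℕ → Table → Set
Atₙ₁ m I   = suc m < I 1 1
Atₙ₂ m I   = suc m < I 2 2 × I 1 1 ≤ suc m
At₁ₙ m I   = 1 < I (suc m) 1
At₁ₙ₋₁ m I = I (suc m) 1 ≤ 1 × (1 ≤ m → 1 < I m 1)

module _ {m : ℕ} {A : Matrix (suc m)} (M : IsMagog (suc m) A) where
  open Entries M

  at11⇒ : entry A 1 1 ≡ 1ℤ → At11 I
  at11⇒ e = from 1 1 1 z<s ≤-refl ≤-refl z<s
    (≤-reflexive (sym (trans (proj₁ (one⇒ 0 0 z<s z<s e)) (cong suc (col₀ 1)))))

  at11⇐ : At11 I → entry A 1 1 ≡ 1ℤ
  at11⇐ p = one⇐ 0 0 z<s z<s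
    (jump 1 0 z<s z<s (subst (_< N 1 1) (sym (col₀ 1)) (to 1 1 1 z<s ≤-refl ≤-refl z<s p)))
    (trans (row₀ 1 z<s) (sym (row₀ 0 z≤n)))

module _ {m : ℕ} {A : Matrix (suc (suc m))} (M : IsMagog (suc (suc m)) A) where
  open Entries M
  private
    n : ℕ
    n = suc (suc m)
    1≤n : 1 ≤ n
    1≤n = z<s
    2≤n : 2 ≤ n
    2≤n = s≤s z<s
    m≤n : suc m ≤ n
    m≤n = n≤1+n _

  at12⇒ : entry A 1 2 ≡ 1ℤ → At12 I
  at12⇒ e = from 1 2 1 1≤n ≤-refl z<s 2≤n (≤-trans z<s (≤-reflexive (sym grows)))
           , late 1≤n ≤-refl 1≤n first
    where
    grows : N 1 2 ≡ suc (N 1 1)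
    grows = proj₁ (one⇒ 0 1 1≤n 2≤n e)
    first : N 1 1 ≡ 0
    first with N 1 1 in eq
    ... | zero  = refl
    ... | suc k = ⊥-elim (1+n≰n (≤-trans (≤-trans (s≤s z<s) (≤-reflexive (sym (trans grows (cong suc eq)))))
        (N≤row 1 2 1≤n 2≤n)))

  at12⇐ : At12 I → entry A 1 2 ≡ 1ℤ
  at12⇐ (p , q) = one⇐ 0 1 1≤n 2≤n
    (jump 1 1 1≤n 2≤n (subst (_< N 1 2) (sym (empty 1≤n ≤-refl 1≤n q)) (to 1 2 1 1≤n ≤-refl z<s 2≤n p)))
    (trans (row₀ 2 2≤n) (sym (row₀ 1 1≤n)))

  at21⇒ : entry A 2 1 ≡ 1ℤ → At21 I
  at21⇒ e with one⇒ 1 0 2≤n 1≤n e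
  ... | a , b = from 2 1 1 2≤n ≤-refl ≤-refl 1≤n (≤-trans z<s (≤-reflexive (sym a)))
              , late 1≤n ≤-refl 1≤n (trans b (col₀ 1))

  at21⇐ : At21 I → entry A 2 1 ≡ 1ℤ
  at21⇐ (p , q) = one⇐ 1 0 2≤n 1≤n
    (jump 2 0 2≤n 1≤n (subst (_< N 2 1) (sym (col₀ 2)) (to 2 1 1 2≤n ≤-refl ≤-refl 1≤n p)))
    (trans (empty 1≤n ≤-refl 1≤n q) (sym (col₀ 1)))

  atₙ₁⇒ : entry A n 1 ≡ 1ℤ → Atₙ₁ m I
  atₙ₁⇒ e = late m≤n ≤-refl 1≤n (trans (proj₂ (one⇒ (suc m) 0 ≤-refl 1≤n e)) (col₀ (suc m)))

  atₙ₁⇐ : Atₙ₁ m I → entry A n 1 ≡ 1ℤ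
  atₙ₁⇐ p = one⇐ (suc m) 0 ≤-refl 1≤n (trans (colₙ 1 1≤n) (cong suc (sym (col₀ n))))
    (trans (empty m≤n ≤-refl 1≤n p) (sym (col₀ (suc m))))

  atₙ₂⇒ : entry A n 2 ≡ 1ℤ → Atₙ₂ m I
  atₙ₂⇒ e = ≰⇒> (λ p → 1+n≰n (≤-trans (to (suc m) 2 2 m≤n z<s ≤-refl 2≤n p)
      (≤-trans (≤-reflexive same) (N≤j (suc m) 1 m≤n 1≤n))))
           , from (suc m) 1 1 m≤n ≤-refl ≤-refl 1≤n (≤-trans (to (suc m) 2 1 m≤n ≤-refl z<s 2≤n
               (I-upper n I T m 2 1 ≤-refl z<s refl)) (≤-reflexive same))
    where
    same : N (suc m) 2 ≡ N (suc m) 1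
    same = proj₂ (one⇒ (suc m) 1 ≤-refl 2≤n e)

  atₙ₂⇐ : Atₙ₂ m I → entry A n 2 ≡ 1ℤ
  atₙ₂⇐ (p , q) = one⇐ (suc m) 1 ≤-refl 2≤n (trans (colₙ 2 2≤n) (cong suc (sym (colₙ 1 1≤n)))) same
    where
    same : N (suc m) 2 ≡ N (suc m) 1
    same with step (suc m) 1 m≤n 2≤n
    ... | inj₁ e = e
    ... | inj₂ e = ⊥-elim (<⇒≱ p (from (suc m) 2 2 m≤n z<s ≤-refl 2≤n
      (≤-trans (s≤s (to (suc m) 1 1 m≤n ≤-refl ≤-refl 1≤n q)) (≤-reflexive (sym e)))))

  at₁ₙ⇒ : entry A 1 n ≡ 1ℤ → At₁ₙ m I
  at₁ₙ⇒ e = late 1≤n z<s m≤n (suc-injective (trans (sym (proj₁ (one⇒ 0 (suc m) 1≤n ≤-refl e))) (rowₙ 1 1≤n)))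

  at₁ₙ⇐ : At₁ₙ m I → entry A 1 n ≡ 1ℤ
  at₁ₙ⇐ p = one⇐ 0 (suc m) 1≤n ≤-refl
    (trans (rowₙ 1 1≤n) (cong suc (sym (empty 1≤n z<s m≤n p))))
    (trans (row₀ n ≤-refl) (sym (row₀ (suc m) m≤n)))

  at₁ₙ₋₁⇒ : entry A 1 (suc m) ≡ 1ℤ → At₁ₙ₋₁ m I
  at₁ₙ₋₁⇒ e = from 1 (suc m) 1 1≤n ≤-refl z<s m≤n (≤-trans z<s (≤-reflexive (sym grows)))
            , λ 1≤m → late 1≤n 1≤m (<⇒≤ m≤n) before
    where
    grows : N 1 (suc m) ≡ suc (N 1 m)
    grows = proj₁ (one⇒ 0 m 1≤n m≤n e)
    before : N 1 m ≡ 0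
    before with N 1 m in eq
    ... | zero  = refl
    ... | suc k = ⊥-elim (1+n≰n (≤-trans (≤-trans (s≤s z<s) (≤-reflexive (sym (trans grows (cong suc eq)))))
        (N≤row 1 (suc m) 1≤n m≤n)))

  at₁ₙ₋₁⇐ : At₁ₙ₋₁ m I → entry A 1 (suc m) ≡ 1ℤ
  at₁ₙ₋₁⇐ (p , q) = one⇐ 0 m 1≤n m≤n
    (jump 1 m 1≤n m≤n (subst (_< N 1 (suc m)) (sym (before m refl)) (to 1 (suc m) 1 1≤n ≤-refl z<s m≤n p)))
    (trans (row₀ (suc m) m≤n) (sym (row₀ m (<⇒≤ m≤n))))
    where
    before : ∀ l → l ≡ m → N 1 l ≡ 0
    before zero    _ = col₀ 1
    before (suc l) e = empty 1≤n z<s (≤-trans (≤-reflexive e) (<⇒≤ m≤n))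
      (subst (λ j → 1 < I j 1) (sym e) (q (≤-trans z<s (≤-reflexive e))))

module _ {n : ℕ} {I : Table} (T : IsTable n I) where
  open IsTable T

  diagonal-lo : ∀ d k → 1 ≤ k → k + d ≤ n → I k k ≤ I (k + d) (k + d)
  diagonal-lo zero    k p q = ≤-reflexive (cong (λ j → I j j) (sym (+-identityʳ k)))
  diagonal-lo (suc d) k p q = ≤-trans (diagonal-lo d k p (<⇒≤ q′))
      (≤-trans (lo (k + d) (k + d) (≤-trans p (m≤m+n k d)) ≤-refl q′)
    (≤-reflexive (cong (λ j → I j j) (sym (+-suc k d)))))
    where
    q′ : k + d < n
    q′ = subst (_≤ n) (+-suc k d) q

  shifted-hi : ∀ d j k → 1 ≤ k → k ≤ j → j + d ≤ n → I (j + d) (k + d) ≤ I j k + d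
  shifted-hi zero    j k p r q = ≤-reflexive (trans (cong₂ I (+-identityʳ j) (+-identityʳ k))
      (sym (+-identityʳ (I j k))))
  shifted-hi (suc d) j k p r q = ≤-trans (≤-reflexive (cong₂ I (+-suc j d) (+-suc k d)))
    (≤-trans (hi (j + d) (k + d) (≤-trans p (m≤m+n k d)) (+-monoˡ-≤ d r) q′)
      (≤-trans (s≤s (shifted-hi d j k p r (<⇒≤ q′))) (≤-reflexive (sym (+-suc (I j k) d)))))
    where
    q′ : j + d < n
    q′ = subst (_≤ n) (+-suc j d) q

  column-anti : ∀ d j k → 1 ≤ k → k ≤ j → j + d ≤ n → I (j + d) k ≤ I j k
  column-anti zero    j k p r q = ≤-reflexive (cong (λ l → I l k) (+-identityʳ j))
  column-anti (suc d) j k p r q = ≤-trans (≤-reflexive (cong (λ l → I l k) (+-suc j d)))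
    (≤-trans (anti (j + d) k p (≤-trans r (m≤m+n j d)) q′) (column-anti d j k p r (<⇒≤ q′)))
    where
    q′ : j + d < n
    q′ = subst (_≤ n) (+-suc j d) q

  -- From (j₀, 1), move along the diagonal and then along a column.
  bound-from : ∀ j₀ v → 1 ≤ j₀ → I j₀ 1 ≤ v → ∀ j k → 1 ≤ k → j₀ + k ≤ suc j → j ≤ n → I j k ≤ v + (k ∸ 1)
  bound-from j₀ v 1≤j₀ b j (suc k) _ p j≤ = ≤-trans
    (subst (λ l → I l (suc k) ≤ I (j₀ + k) (suc k)) (m+[n∸m]≡n p′) (column-anti (j ∸ (j₀ + k)) (j₀ + k) (suc k) z<s
      (+-monoˡ-≤ k 1≤j₀) (≤-trans (≤-reflexive (m+[n∸m]≡n p′)) j≤)))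
    (≤-trans (shifted-hi k j₀ 1 ≤-refl 1≤j₀ (≤-trans p′ j≤)) (+-monoˡ-≤ k b))
    where
    p′ : j₀ + k ≤ j
    p′ = ≤-pred (≤-trans (≤-reflexive (sym (+-suc j₀ k))) p)

  lower : ∀ j k → 1 ≤ k → k ≤ j → j ≤ n → k ≤ I j k
  lower j k p q r = I-lower n I T (n ∸ j) j k p q (m+[n∸m]≡n r)

-- `I 1 1 = 1` pushes every entry down to its minimum `k`; this is the table of the identity matrix.
HasCard-11 : ∀ m → HasCard (MagogAt (suc m) 1 1) 1
HasCard-11 m = HasCard-⇔ (λ A (M , p) → M , at11⇐ M p) (λ A (M , e) → M , at11⇒ M e)
  (HasCard-table {R = λ (_ : ⊤) → ⊤} (suc m) {P = At11} (λ _ j k → k) (λ _ → tt)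
    (λ _ _ → record
      { top = λ _ _ _ → refl ; anti = λ _ _ _ _ _ → ≤-refl
      ; lo = λ _ _ _ _ _ → n≤1+n _ ; hi = λ _ _ _ _ _ → ≤-refl })
    (λ _ _ → ≤-refl) (λ _ _ _ → tt) (λ _ _ → refl)
    (λ I T p j k a b c → ≤-antisym (lower T j k a b c)
      (≤-trans (bound-from T 1 1 ≤-refl p j k a (s≤s b) c) (≤-reflexive (m+[n∸m]≡n a))))
    (λ _ _ _ → refl) (λ {I} _ e p → subst (_≤ 1) (e 1 1 ≤-refl ≤-refl z<s) p)
    (tt ∷ [] , [] ∷ [] , (λ _ → mk⇔ (λ _ → tt) (λ _ → here refl)) , refl))

-- Changing one table entry, and deleting the diagonal

setFirst : ℕ → ℕ → Table → Table
setFirst p v I j zero          = I j zero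
setFirst p v I j (suc (suc k)) = I j (suc (suc k))
setFirst p v I j (suc zero) with j ≟ p
... | yes _ = v
... | no  _ = I j 1

setFirst-hit : ∀ p v I → setFirst p v I p 1 ≡ v
setFirst-hit p v I with p ≟ p
... | yes _ = refl
... | no ¬e = ⊥-elim (¬e refl)

setFirst-miss : ∀ p v I j → j ≢ p → setFirst p v I j 1 ≡ I j 1
setFirst-miss p v I j j≢p with j ≟ p
... | yes e = ⊥-elim (j≢p e)
... | no  _ = refl

setFirst-cong : ∀ {n} p v {I I′} → I ≈[ n ] I′ → setFirst p v I ≈[ n ] setFirst p v I′
setFirst-cong p v e j (suc (suc k)) a b c = e j (suc (suc k)) a b c
setFirst-cong p v e j (suc zero)    a b c with j ≟ p
... | yes _ = refl
... | no  _ = e j 1 a b c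

setFirst-back : ∀ {n} p v v′ I → I p 1 ≡ v′ → setFirst p v′ (setFirst p v I) ≈[ n ] I
setFirst-back p v v′ I e j (suc (suc k)) a b c = refl
setFirst-back p v v′ I e j (suc zero)    a b c with j ≟ p
... | yes refl = sym e
... | no j≢p   = setFirst-miss p v I j j≢p

-- The entry `(p, 1)` is compared only with `(p + 1, 1)`, `(p − 1, 1)` and `(p + 1, 2)`.
setFirst-isTable : ∀ {n} p v I → IsTable n I → 1 ≤ p → p < n → I (suc p) 1 ≤ v →
  (∀ l → suc l ≡ p → 1 ≤ l → v ≤ I l 1) → v ≤ I (suc p) 2 → I (suc p) 2 ≤ suc v → IsTable n (setFirst p v I)
setFirst-isTable {n} p v I T 1≤p p<n above below lo′ hi′ = record
  { top  = λ { (suc (suc k)) a b → top _ a b ; (suc zero) a b → trans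
      (setFirst-miss p v I n (λ { refl → n≮n n p<n })) (top 1 a b) }
  ; anti = λ { j (suc (suc k)) a b c → anti j _ a b c ; j (suc zero) a b c → anti₁ j a b c }
  ; lo   = λ { j (suc (suc k)) a b c → lo j _ a b c ; j (suc zero) a b c → proj₁ (lo-hi j a b c) }
  ; hi   = λ { j (suc (suc k)) a b c → hi j _ a b c ; j (suc zero) a b c → proj₂ (lo-hi j a b c) } }
  where
  open IsTable T
  anti₁ : ∀ j → 1 ≤ 1 → 1 ≤ j → j < n → setFirst p v I (suc j) 1 ≤ setFirst p v I j 1
  anti₁ j a b c with suc j ≟ p | j ≟ p
  ... | yes refl | yes e    = ⊥-elim (1+n≰n (≤-reflexive (sym e)))
  ... | yes e    | no _     = below j e b
  ... | no _     | yes refl = above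
  ... | no _     | no _     = anti j 1 a b c
  lo-hi : ∀ j → 1 ≤ 1 → 1 ≤ j → j < n → (setFirst p v I j 1 ≤ I (suc j) 2) × (I (suc j) 2 ≤ suc (setFirst p v I j 1))
  lo-hi j a b c with j ≟ p
  ... | yes refl = lo′ , hi′
  ... | no _     = lo j 1 a b c , hi j 1 a b c

lift : ℕ → Table → Table
lift n J j k with j ≤? k
... | yes _ = n
... | no  _ = J (j ∸ 1) k

unlift : Table → Table
unlift I j k = I (suc j) k

lift-diagonal : ∀ n J k → lift n J k k ≡ n
lift-diagonal n J k with k ≤? k
... | yes _ = refl
... | no ¬p = ⊥-elim (¬p ≤-refl)

lift-below : ∀ n J j k → k ≤ j → lift n J (suc j) k ≡ J j k
lift-below n J j k p with suc j ≤? k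
... | yes q = ⊥-elim (n≮n j (≤-trans q p))
... | no  _ = refl

lift-isTable : ∀ m J → IsTable m J → IsTable (suc m) (lift (suc m) J)
lift-isTable m J T = record
  { top  = tops
  ; anti = λ j k a b c → antis j k a b c (m≤n⇒m<n∨m≡n b)
  ; lo   = λ j k a b c → proj₁ (both j k a b c (m≤n⇒m<n∨m≡n b))
  ; hi   = λ j k a b c → proj₂ (both j k a b c (m≤n⇒m<n∨m≡n b)) }
  where
  open IsTable T
  L : Table
  L = lift (suc m) J
  tops : ∀ k → 1 ≤ k → k ≤ suc m → L (suc m) k ≡ k
  tops k a b with m≤n⇒m<n∨m≡n b
  ... | inj₂ refl    = lift-diagonal (suc m) J (suc m)
  ... | inj₁ (s≤s p) = trans (lift-below (suc m) J m k p) (top k a p)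
  antis : ∀ j k → 1 ≤ k → k ≤ j → j < suc m → k < j ⊎ k ≡ j → L (suc j) k ≤ L j k
  antis j       k a b (s≤s c) (inj₂ refl) = subst₂ _≤_ (sym (lift-below (suc m) J k k ≤-refl))
      (sym (lift-diagonal (suc m) J k))
    (m≤n⇒m≤1+n (I-bounded m J T k k a ≤-refl c))
  antis (suc j) k a b (s≤s c) (inj₁ (s≤s p)) = subst₂ _≤_ (sym (lift-below (suc m) J (suc j) k b))
      (sym (lift-below (suc m) J j k p)) (anti j k a p c)
  both : ∀ j k → 1 ≤ k → k ≤ j → j < suc m → k < j ⊎ k ≡ j → (L j k ≤ L (suc j) (suc k)) ×
      (L (suc j) (suc k) ≤ suc (L j k))
  both j       k a b (s≤s c) (inj₂ refl) rewrite lift-diagonal (suc m) J k | lift-diagonal (suc m) J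
      (suc k) = ≤-refl , n≤1+n _
  both (suc j) k a b (s≤s c) (inj₁ (s≤s p)) rewrite lift-below (suc m) J j k p | lift-below (suc m) J (suc j)
      (suc k) (s≤s p) = lo j k a p c , hi j k a p c

-- `lo` makes the diagonal weakly increasing, so `I 1 1 = n` fixes it at `n` throughout. Deleting it
-- leaves an arbitrary table of size `n − 1`, since `n` is large enough for every condition that
-- involves the diagonal.
HasCard-n1 : ∀ m {k} → HasCard (IsMagog (suc m)) k → HasCard (AtTable (suc (suc m)) (Atₙ₁ m)) k
HasCard-n1 m h = HasCard-tables {P = λ _ → ⊤} (lift (suc (suc m))) unlift
  (λ J T _ → lift-isTable (suc m) J T , ≤-reflexive (sym (lift-diagonal (suc (suc m)) J 1)))
  (λ I T _ → record
    { top = λ k a b → IsTable.top T k a (m≤n⇒m≤1+n b) ; anti = λ j k a b c → IsTable.anti T (suc j) k a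
        (m≤n⇒m≤1+n b) (s≤s c)
    ; lo = λ j k a b c → IsTable.lo T (suc j) k a (m≤n⇒m≤1+n b) (s≤s c) ; hi = λ j k a b c → IsTable.hi T
        (suc j) k a (m≤n⇒m≤1+n b) (s≤s c) } , tt)
  (λ J T _ j k a b c → lift-below (suc (suc m)) J j k b)
  (λ I T p j k a b c → undo I T p j k a b c (m≤n⇒m<n∨m≡n b))
  resp
  (λ e j k a b c → e (suc j) k a (m≤n⇒m≤1+n b) (s≤s c))
  (λ _ _ _ → tt)
  (λ _ e p → subst (suc m <_) (e 1 1 ≤-refl ≤-refl z<s) p)
  (HasCard-⇔ (λ _ M → M , tt) (λ _ → proj₁) h)
  where
  undo : ∀ I → IsTable (suc (suc m)) I → Atₙ₁ m I → ∀ j k → 1 ≤ k → k ≤ j → j ≤ suc (suc m) → k < j ⊎ k ≡ j →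
    lift (suc (suc m)) (unlift I) j k ≡ I j k
  undo I T p (suc j) k a b c (inj₁ (s≤s q)) = lift-below (suc (suc m)) (unlift I) j k q
  undo I T p (suc k) _ a b c (inj₂ refl) = trans (lift-diagonal (suc (suc m)) (unlift I) (suc k)) (sym (≤-antisym
    (I-bounded (suc (suc m)) I T (suc k) (suc k) a ≤-refl c) (≤-trans p (diagonal-lo T k 1 ≤-refl c))))
  resp : ∀ {J J′} → J ≈[ suc m ] J′ → lift (suc (suc m)) J ≈[ suc (suc m) ] lift (suc (suc m)) J′
  resp {J} {J′} e j k a b c with m≤n⇒m<n∨m≡n b
  ... | inj₂ refl = trans (lift-diagonal (suc (suc m)) J k) (sym (lift-diagonal (suc (suc m)) J′ k))
  resp {J} {J′} e (suc j) k a b (s≤s c) | inj₁ (s≤s q) =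
    trans (lift-below (suc (suc m)) J j k q) (trans (e j k a q c) (sym (lift-below (suc (suc m)) J′ j k q)))

-- If `I 1 1 = n`, then also `I 2 2 = n`; if `I 2 2 = n` and `I 1 1 < n`, then `I 1 1 = n − 1` by
-- `hi`. So the two kinds of tables differ in the single entry `I 1 1`.
HasCard-n2 : ∀ m {k} → HasCard (AtTable (suc (suc m)) (Atₙ₁ m)) k → HasCard (AtTable (suc (suc m)) (Atₙ₂ m)) k
HasCard-n2 m = HasCard-tables {P = Atₙ₁ m} {Q = Atₙ₂ m} (setFirst 1 (suc m)) (setFirst 1 (suc (suc m)))
  (λ I T p → let e = full I T p in
    setFirst-isTable 1 (suc m) I T ≤-refl 2≤ (I-upper (suc (suc m)) I T m 2 1 ≤-refl z<s refl)
        (λ { zero _ () ; (suc _) () })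
      (<⇒≤ (≤-trans p (IsTable.lo T 1 1 ≤-refl ≤-refl 2≤))) (I-bounded (suc (suc m)) I T 2 2 z<s ≤-refl 2≤)
    , ≤-trans p (IsTable.lo T 1 1 ≤-refl ≤-refl 2≤) , ≤-reflexive (setFirst-hit 1 (suc m) I))
  (λ I T (p , q) → setFirst-isTable 1 (suc (suc m)) I T ≤-refl 2≤ (I-bounded (suc (suc m)) I T 2 1 ≤-refl z<s 2≤)
      (λ { zero _ () ; (suc _) () })
      p (m≤n⇒m≤1+n (I-bounded (suc (suc m)) I T 2 2 z<s ≤-refl 2≤))
    , ≤-reflexive (sym (setFirst-hit 1 (suc (suc m)) I)))
  (λ I T p → setFirst-back 1 (suc m) (suc (suc m)) I (full I T p))
  (λ I T (p , q) → setFirst-back 1 (suc (suc m)) (suc m) I (≤-antisym q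
      (≤-pred (≤-trans p (IsTable.hi T 1 1 ≤-refl ≤-refl 2≤)))))
  (setFirst-cong 1 (suc m)) (setFirst-cong 1 (suc (suc m)))
  (λ _ e p → subst (suc m <_) (e 1 1 ≤-refl ≤-refl z<s) p)
  (λ _ e (p , q) → subst (suc m <_) (e 2 2 z<s ≤-refl 2≤) p , subst (_≤ suc m) (e 1 1 ≤-refl ≤-refl z<s) q)
  where
  2≤ : 2 ≤ suc (suc m)
  2≤ = s≤s z<s
  full : ∀ I → IsTable (suc (suc m)) I → Atₙ₁ m I → I 1 1 ≡ suc (suc m)
  full I T p = ≤-antisym (I-bounded (suc (suc m)) I T 1 1 ≤-refl ≤-refl z<s) p

-- `I (n − 1) 1` is at most 2. Given that the entry before it, if any, exceeds 1, both values 1 and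
-- 2 are compatible with `I n 1 = 1` and `I n 2 = 2`, and switching between them is the bijection.
HasCard-1n : ∀ m {k} → HasCard (AtTable (suc (suc m)) (At₁ₙ m)) k → HasCard (AtTable (suc (suc m)) (At₁ₙ₋₁ m)) k
HasCard-1n m = HasCard-tables {P = At₁ₙ m} {Q = At₁ₙ₋₁ m} (setFirst (suc m) 1) (setFirst (suc m) 2)
  (λ I T p → setFirst-isTable (suc m) 1 I T z<s ≤-refl (≤-reflexive (IsTable.top T 1 ≤-refl z<s))
      (λ { l refl 1≤l → lower T l 1 ≤-refl 1≤l (m≤n⇒m≤1+n (n≤1+n l)) })
      (≤-trans (n≤1+n 1) (≤-reflexive (sym (second I T)))) (≤-reflexive (second I T))
    , ≤-reflexive (setFirst-hit (suc m) 1 I)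
    , λ 1≤m → subst (1 <_) (sym (setFirst-miss (suc m) 1 I m (λ e → 1+n≰n (≤-reflexive (sym e)))))
        (≤-trans p (IsTable.anti T m 1 ≤-refl 1≤m (n≤1+n (suc m)))))
  (λ I T (p , q) → setFirst-isTable (suc m) 2 I T z<s ≤-refl (≤-trans (≤-reflexive (IsTable.top T 1 ≤-refl z<s))
      (n≤1+n 1))
      (λ { l refl 1≤l → q 1≤l }) (≤-reflexive (sym (second I T))) (≤-trans (≤-reflexive (second I T)) (n≤1+n 2))
    , ≤-reflexive (sym (setFirst-hit (suc m) 2 I)))
  (λ I T p → setFirst-back (suc m) 1 2 I (≤-antisym (I-upper (suc (suc m)) I T 1 (suc m) 1 ≤-refl z<s
      (+-comm (suc m) 1)) p))
  (λ I T (p , q) → setFirst-back (suc m) 2 1 I (≤-antisym p (lower T (suc m) 1 ≤-refl z<s (n≤1+n _))))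
  (setFirst-cong (suc m) 1) (setFirst-cong (suc m) 2)
  (λ _ e p → subst (1 <_) (e (suc m) 1 ≤-refl z<s (n≤1+n _)) p)
  (λ _ e (p , q) → subst (_≤ 1) (e (suc m) 1 ≤-refl z<s (n≤1+n _)) p
    , λ 1≤m → subst (1 <_) (e m 1 ≤-refl 1≤m (m≤n⇒m≤1+n (n≤1+n m))) (q 1≤m))
  where
  second : ∀ I → IsTable (suc (suc m)) I → I (suc (suc m)) 2 ≡ 2
  second I T = IsTable.top T 2 z<s (s≤s z<s)

HasCard-none : ∀ {A : Set} {P : A → Set} → (∀ a → ¬ P a) → HasCard P 0
HasCard-none ¬p = [] , [] , (λ a → mk⇔ (λ ()) (λ p → ⊥-elim (¬p a p))) , refl

HasCard-one : ∀ {A : Set} (x : A) → HasCard (_≡ x) 1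
HasCard-one x = x ∷ [] , [] ∷ [] , (λ a → mk⇔ (λ { (here e) → e ; (there ()) }) here) , refl

HasCard-⊎ : ∀ {A : Set} {P Q : A → Set} {k l} → (∀ a → P a → ¬ Q a) → HasCard P k → HasCard Q l → HasCard
    (λ a → P a ⊎ Q a) (k + l)
HasCard-⊎ apart (xs , ux , mx , lx) (ys , uy , my , ly) = xs ++ ys ,
  Unique.++⁺ ux uy (λ (x∈ , y∈) → apart _ (Equivalence.to (mx _) x∈) (Equivalence.to (my _) y∈)) ,
  (λ a → mk⇔ (λ a∈ → [ inj₁ ∘ Equivalence.to (mx a) , inj₂ ∘ Equivalence.to (my a) ]′ (∈-++⁻ xs a∈))
             [ ∈-++⁺ˡ ∘ Equivalence.from (mx a) , ∈-++⁺ʳ xs ∘ Equivalence.from (my a) ]′) ,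
  trans (length-++ xs) (cong₂ _+_ lx ly)

Headed : ∀ {A : Set} → A → (List A → Set) → List A → Set
Headed x R ys = ∃ λ xs → ys ≡ x ∷ xs × R xs

HasCard-Headed : ∀ {A : Set} (x : A) {R : List A → Set} {k} → HasCard R k → HasCard (Headed x R) k
HasCard-Headed x = HasCard-map (x ∷_) (drop 1) (λ xs r → xs , refl , r) (λ { _ (_ , refl , r) → r })
  (λ _ _ → refl) (λ { _ (_ , refl , _) → refl })

-- Weakly decreasing sequences under a staircase

-- `b` bounds the first entry. The cap `x ⊓ r` on the tail joins monotonicity with the staircase,
-- whose height is the length of the tail.
data Bounded : ℕ → ℕ → List ℕ → Set where
  []  : ∀ {b} → Bounded 0 b []
  _∷_ : ∀ {r b x xs} → x ≤ b → Bounded r (x ⊓ r) xs → Bounded (suc r) b (x ∷ xs)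

-- The recursion is on the first entry. The leading 1 in `ballot` is the zero sequence, the only one
-- that starts with 0.
ballot positive : ℕ → ℕ → ℕ
ballot zero    b = 1
ballot (suc r) b = suc (positive r b)
positive r zero    = 0
positive r (suc b) = positive r b + ballot r (suc b ⊓ r)

HasCard-Bounded : ∀ r b → HasCard (Bounded r b) (ballot r b)
HasCard-positive : ∀ r b → HasCard (λ xs → Bounded (suc r) b xs × 1 ≤ nth 0 xs 0) (positive r b)

ballot-0 : ∀ r → ballot r 0 ≡ 1
ballot-0 zero    = refl
ballot-0 (suc r) = refl

HasCard-Bounded zero    b = HasCard-⇔ (λ { _ refl → [] }) (λ { _ [] → refl }) (HasCard-one [])
HasCard-Bounded (suc r) b = HasCard-⇔
  (λ { _ (inj₁ (xs , refl , p)) → z≤n ∷ p ; _ (inj₂ (p , _)) → p })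
  (λ { (zero ∷ xs) (_ ∷ p) → inj₁ (xs , refl , p) ; (suc x ∷ xs) p → inj₂ (p , z<s) })
  (HasCard-⊎ (λ { _ (_ , refl , _) (_ , ()) })
    (HasCard-Headed 0 (subst (HasCard (Bounded r 0)) (ballot-0 r) (HasCard-Bounded r 0))) (HasCard-positive r b))

HasCard-positive r zero    = HasCard-none λ { _ (z≤n ∷ _ , ()) }
HasCard-positive r (suc b) = HasCard-⇔
  (λ { _ (inj₁ (p ∷ q , h)) → m≤n⇒m≤1+n p ∷ q , h ; _ (inj₂ (xs , refl , p)) → ≤-refl ∷ p , z<s })
  (λ { (x ∷ xs) (p ∷ q , h) → split x xs p q h (m≤n⇒m<n∨m≡n p) })
  (HasCard-⊎ (λ { _ (p ∷ _ , _) (_ , refl , _) → 1+n≰n p }) (HasCard-positive r b)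
      (HasCard-Headed (suc b) (HasCard-Bounded r (suc b ⊓ r))))
  where
  split : ∀ x xs → x ≤ suc b → Bounded r (x ⊓ r) xs → 1 ≤ x → x < suc b ⊎ x ≡ suc b →
    (Bounded (suc r) b (x ∷ xs) × 1 ≤ x) ⊎ Headed (suc b) (Bounded r (suc b ⊓ r)) (x ∷ xs)
  split x xs p q h (inj₁ (s≤s p′)) = inj₁ (p′ ∷ q , h)
  split x xs p q h (inj₂ refl)     = inj₂ (xs , refl , q)

-- Ballot numbers, binomial coefficients and Catalan numbers

previousC : ℕ → ℕ → ℕ
previousC n zero    = 0
previousC n (suc b) = n C b

pascal : ∀ n b → suc n C b ≡ previousC n b + n C b
pascal n zero    = refl
pascal n (suc b) = sym (nCk+nC[k+1]≡[n+1]C[k+1] n b)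

-- The reflection formula, extended to b = r where the bound suc b ⊓ r takes over.
reflection : ∀ r b → b ≤ r → ballot r b + previousC (suc (r + b)) b ≡ suc (r + b) C b
reflection-next : ∀ r b → b ≤ r → ballot r (suc b ⊓ r) + suc (suc (r + b)) C b ≡ suc (suc (r + b)) C suc b

reflection r       zero    _ rewrite ballot-0 r = refl
reflection (suc r) (suc b) (s≤s p) = begin
  suc (positive r b + ballot r (suc b ⊓ r)) + suc (suc r + suc b) C b
    ≡⟨ cong (λ n → suc (positive r b + ballot r (suc b ⊓ r)) + n C b) shape ⟩
  ballot (suc r) b + ballot r (suc b ⊓ r) + suc N C b
    ≡⟨ cong (λ t → ballot (suc r) b + ballot r (suc b ⊓ r) + t) (pascal N b) ⟩
  ballot (suc r) b + ballot r (suc b ⊓ r) + (previousC N b + N C b)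
    ≡⟨ regroup (ballot (suc r) b) (ballot r (suc b ⊓ r)) (previousC N b) (N C b) ⟩
  (ballot (suc r) b + previousC N b) + (ballot r (suc b ⊓ r) + N C b)
    ≡⟨ cong₂ _+_ (reflection (suc r) b (m≤n⇒m≤1+n p)) (reflection-next r b p) ⟩
  N C b + N C suc b
    ≡⟨ nCk+nC[k+1]≡[n+1]C[k+1] N b ⟩
  suc N C suc b
    ≡⟨ cong (_C suc b) shape ⟨
  suc (suc r + suc b) C suc b ∎
  where
  open ≡-Reasoning
  N : ℕ
  N = suc (suc (r + b))
  shape : suc (suc r + suc b) ≡ suc N
  shape = cong (λ t → suc (suc t)) (+-suc r b)
  regroup : ∀ a c x y → a + c + (x + y) ≡ (a + x) + (c + y)
  regroup = ℕ-Solver.solve-∀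

reflection-next r b p with m≤n⇒m<n∨m≡n p
... | inj₁ b<r = begin
  ballot r (suc b ⊓ r) + suc (suc (r + b)) C b  ≡⟨ cong₂ (λ s n → ballot r s + suc n C b) (m≤n⇒m⊓n≡m b<r)
      (sym (+-suc r b)) ⟩
  ballot r (suc b) + suc (r + suc b) C b        ≡⟨ reflection r (suc b) b<r ⟩
  suc (r + suc b) C suc b                       ≡⟨ cong (λ n → suc n C suc b) (+-suc r b) ⟩
  suc (suc (r + b)) C suc b                     ∎
  where open ≡-Reasoning
-- The cap repeats the value at `b`, and the symmetry of the middle binomial coefficients of the odd
-- row `2b + 1` makes up for the missing step.
... | inj₂ refl = begin
  ballot b (suc b ⊓ b) + suc N C b              ≡⟨ cong₂ (λ s t → ballot b s + t) (m≥n⇒m⊓n≡n (n≤1+n b)) (pascal N b) ⟩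
  ballot b b + (previousC N b + N C b)          ≡⟨ +-assoc (ballot b b) _ _ ⟨
  ballot b b + previousC N b + N C b            ≡⟨ cong (_+ N C b) (reflection b b ≤-refl) ⟩
  N C b + N C b                                 ≡⟨ cong (λ t → N C b + t) symmetric ⟩
  N C b + N C suc b                             ≡⟨ nCk+nC[k+1]≡[n+1]C[k+1] N b ⟩
  suc N C suc b                                 ∎
  where
  open ≡-Reasoning
  N : ℕ
  N = suc (b + b)
  symmetric : N C b ≡ N C suc b
  symmetric = trans (nCk≡nC[n∸k] {b} {N} (m≤n⇒m≤1+n (m≤m+n b b)))
    (cong (N C_) (trans (cong (_∸ b) (sym (+-suc b b))) (trans (cong (_∸ b) (+-comm b (suc b))) (m+n∸n≡m (suc b) b))))

absorb : ∀ n k → suc k * (suc n C suc k) ≡ suc n * (n C k)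
absorb zero    zero    = refl
absorb zero    (suc k) = trans (cong (suc (suc k) *_) (k>n⇒nCk≡0 {1} {suc (suc k)} (s≤s z<s)))
  (trans (*-zeroʳ (suc (suc k))) (sym (trans (cong (λ t → 1 * t) (k>n⇒nCk≡0 {0} {suc k} z<s)) refl)))
absorb (suc n) zero    = trans (cong (1 *_) (nC1≡n (suc (suc n))))
    (trans (*-identityˡ _) (sym (*-identityʳ (suc (suc n)))))
absorb (suc n) (suc k) = begin
  suc (suc k) * (suc (suc n) C suc (suc k))
    ≡⟨ cong (suc (suc k) *_) (nCk+nC[k+1]≡[n+1]C[k+1] (suc n) (suc k)) ⟨
  suc (suc k) * (c + suc n C suc (suc k))
    ≡⟨ split (suc k) c (suc n C suc (suc k)) ⟩
  c + suc k * c + suc (suc k) * (suc n C suc (suc k))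
    ≡⟨ cong₂ (λ s t → c + s + t) (absorb n k) (absorb n (suc k)) ⟩
  c + suc n * (n C k) + suc n * (n C suc k)
    ≡⟨ trans (+-assoc c _ _) (cong (λ t → c + t) (sym (*-distribˡ-+ (suc n) (n C k) (n C suc k)))) ⟩
  c + suc n * (n C k + n C suc k)
    ≡⟨ cong (λ t → c + suc n * t) (nCk+nC[k+1]≡[n+1]C[k+1] n k) ⟩
  suc (suc n) * c ∎
  where
  open ≡-Reasoning
  c : ℕ
  c = suc n C suc k
  split : ∀ k c d → suc k * (c + d) ≡ c + k * c + suc k * d
  split = ℕ-Solver.solve-∀

-- By reflection `ballot r r` is the difference `a − b` of neighbouring binomial coefficients of the
-- row `2r + 2`, and absorption gives their ratio as `(r + 2) : (r + 1)`.
catalan : ∀ r → suc (suc r) * ballot r r ≡ (suc r + suc r) C suc r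
catalan r = +-cancelʳ-≡ (suc r * a) _ _ (begin
  suc (suc r) * ballot r r + suc r * a             ≡⟨ cong (λ t → suc (suc r) * ballot r r + t) ratio ⟩
  suc (suc r) * ballot r r + suc (suc r) * b       ≡⟨ *-distribˡ-+ (suc (suc r)) (ballot r r) b ⟨
  suc (suc r) * (ballot r r + b)                   ≡⟨ cong (suc (suc r) *_) reflected ⟩
  a + suc r * a                                    ∎)
  where
  open ≡-Reasoning
  N a b : ℕ
  N = suc r + suc r
  a = N C suc r
  b = N C r
  N≡ : suc (suc (r + r)) ≡ N
  N≡ = cong suc (sym (+-suc r r))
  reflected : ballot r r + b ≡ a
  reflected = subst (λ n → ballot r r + n C r ≡ n C suc r) N≡
    (trans (cong (λ s → ballot r s + suc (suc (r + r)) C r) (sym (m≥n⇒m⊓n≡n (n≤1+n r)))) (reflection-next r r ≤-refl))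
  ratio : suc r * a ≡ suc (suc r) * b
  ratio = +-cancelˡ-≡ (suc r * b) _ _ (begin
    suc r * b + suc r * a         ≡⟨ *-distribˡ-+ (suc r) b a ⟨
    suc r * (b + a)               ≡⟨ cong (suc r *_) (nCk+nC[k+1]≡[n+1]C[k+1] N r) ⟩
    suc r * (suc N C suc r)       ≡⟨ absorb N r ⟩
    suc N * b                     ≡⟨ split r b ⟩
    suc r * b + suc (suc r) * b   ∎)
    where
    split : ∀ r b → suc (suc r + suc r) * b ≡ suc r * b + suc (suc r) * b
    split = ℕ-Solver.solve-∀

Bounded-head : ∀ {r b xs} → Bounded r b xs → nth 0 xs 0 ≤ b
Bounded-head []      = z≤n
Bounded-head (p ∷ _) = p

Bounded-nth : ∀ {r b xs} → Bounded r b xs → b ≤ r → ∀ i → nth 0 xs i ≤ r ∸ i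
Bounded-nth []      _ i       = z≤n
Bounded-nth (p ∷ q) h zero    = ≤-trans p h
Bounded-nth {suc r} {xs = x ∷ _} (p ∷ q) h (suc i) = Bounded-nth q (m⊓n≤n x r) i

Bounded-decreasing : ∀ {r b xs} → Bounded r b xs → ∀ i → nth 0 xs (suc i) ≤ nth 0 xs i
Bounded-decreasing []      i       = z≤n
Bounded-decreasing {suc r} {xs = x ∷ _} (p ∷ q) zero    = ≤-trans (Bounded-head q) (m⊓n≤m x r)
Bounded-decreasing (p ∷ q) (suc i) = Bounded-decreasing q i

Bounded-length : ∀ {r b xs} → Bounded r b xs → length xs ≡ r
Bounded-length []      = refl
Bounded-length (_ ∷ q) = cong suc (Bounded-length q)

Bounded-applyUpTo : ∀ r b f → f 0 ≤ b → (∀ i → i < r → f i ≤ r ∸ i) → (∀ i → suc i < r → f (suc i) ≤ f i)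
    → Bounded r b (applyUpTo f r)
Bounded-applyUpTo zero    b f h bd dec = []
Bounded-applyUpTo (suc r) b f h bd dec = h ∷ rest r refl
  where
  rest : ∀ s → s ≡ r → Bounded s (f 0 ⊓ s) (applyUpTo (f ∘ suc) s)
  rest zero    refl = []
  rest (suc s) refl = Bounded-applyUpTo (suc s) _ (f ∘ suc)
    (⊓-glb (dec 0 (s≤s z<s)) (bd 1 (s≤s z<s))) (λ i p → bd (suc i) (s≤s p)) (λ i p → dec (suc i) (s≤s p))

least-cong : ∀ {P P′ : ℕ → Set} n (P? : ∀ i → Dec (P i)) (P′? : ∀ i → Dec (P′ i)) →
  (∀ i → i < n → P i → P′ i) → (∀ i → i < n → P′ i → P i) → least n P? ≡ least n P′?
least-cong zero    P? P′? f g = refl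
least-cong (suc n) P? P′? f g with P? 0 | P′? 0
... | yes _ | yes _ = refl
... | yes a | no ¬b = ⊥-elim (¬b (f 0 z<s a))
... | no ¬a | yes b = ⊥-elim (¬a (g 0 z<s b))
... | no _  | no _  = cong suc (least-cong n (P? ∘ suc) (P′? ∘ suc) (λ i p → f (suc i) (s≤s p))
    (λ i p → g (suc i) (s≤s p)))

-- All I j k lie in {k, k + 1}; entry i of the sequence is the number of j with I j (i + 1) = i + 2.
module Staircase (m : ℕ) where

  private
    M n : ℕ
    M = suc m
    n = suc M

  staircase : List ℕ → Table
  staircase xs j k with (j ∸ k) <? nth 0 xs (k ∸ 1)
  ... | yes _ = suc k
  ... | no  _ = k

  staircase-in : ∀ xs j k → j ∸ k < nth 0 xs (k ∸ 1) → staircase xs j k ≡ suc k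
  staircase-in xs j k p with (j ∸ k) <? nth 0 xs (k ∸ 1)
  ... | yes _ = refl
  ... | no ¬p = ⊥-elim (¬p p)

  staircase-out : ∀ xs j k → nth 0 xs (k ∸ 1) ≤ j ∸ k → staircase xs j k ≡ k
  staircase-out xs j k p with (j ∸ k) <? nth 0 xs (k ∸ 1)
  ... | yes q = ⊥-elim (<⇒≱ q p)
  ... | no  _ = refl

  height? : ∀ (I : Table) i c → Dec (I (c + suc i) (suc i) ≤ suc i)
  height? I i c = I (c + suc i) (suc i) ≤? suc i

  -- By `anti` the entries `k + 1` of row index `k = i + 1` precede the entries `k`, so the first
  -- return to `k` counts them. The default `M − i` belongs to column `n`, where `top` applies.
  height : Table → ℕ → ℕ
  height I i = least (M ∸ i) (height? I i)

  heights : Table → List ℕ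
  heights I = applyUpTo (height I) M

  nth-heights : ∀ I i → i < M → nth 0 (heights I) i ≡ height I i
  nth-heights I i p = nth-applyUpTo 0 (height I) M i p

  Sequence : List ℕ → Set
  Sequence xs = Bounded M M xs × 1 ≤ nth 0 xs 0

  staircase-isTable : ∀ xs → Sequence xs → IsTable n (staircase xs)
  staircase-isTable xs (bd , _) = record
    { top  = λ { (suc i) _ (s≤s p) → staircase-out xs n (suc i) (Bounded-nth bd ≤-refl i) }
    ; anti = antis ; lo = λ j k _ _ _ → ≤-trans (upper j k) (lower′ (suc j) (suc k)) ; hi = his }
    where
    upper : ∀ j k → staircase xs j k ≤ suc k
    upper j k with (j ∸ k) <? nth 0 xs (k ∸ 1)
    ... | yes _ = ≤-refl
    ... | no  _ = n≤1+n k
    lower′ : ∀ j k → k ≤ staircase xs j k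
    lower′ j k with (j ∸ k) <? nth 0 xs (k ∸ 1)
    ... | yes _ = n≤1+n k
    ... | no  _ = ≤-refl
    antis : ∀ j k → 1 ≤ k → k ≤ j → j < n → staircase xs (suc j) k ≤ staircase xs j k
    antis j k a b c with (suc j ∸ k) <? nth 0 xs (k ∸ 1)
    ... | no  _ = lower′ j k
    ... | yes p = ≤-reflexive (sym (staircase-in xs j k (≤-trans (s≤s (∸-monoˡ-≤ k (n≤1+n j))) p)))
    his : ∀ j k → 1 ≤ k → k ≤ j → j < n → staircase xs (suc j) (suc k) ≤ suc (staircase xs j k)
    his j (suc i) a b c with (j ∸ suc i) <? nth 0 xs (suc i)
    ... | no  _ = s≤s (lower′ j (suc i))
    ... | yes p = ≤-reflexive (cong suc (sym (staircase-in xs j (suc i) (≤-trans p (Bounded-decreasing bd i)))))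

  staircase-at21 : ∀ xs → Sequence xs → At21 (staircase xs)
  staircase-at21 xs (_ , p) = ≤-reflexive e , ≤-reflexive (sym e)
    where
    e : staircase xs 1 1 ≡ 2
    e = staircase-in xs 1 1 p

  module _ {I : Table} (T : IsTable n I) where
    open IsTable T

    ends : ∀ i → i < M → I ((M ∸ i) + suc i) (suc i) ≤ suc i
    ends i p = ≤-reflexive (trans (cong (λ j → I j (suc i)) (trans (+-suc (M ∸ i) i)
        (cong suc (m∸n+n≡m (<⇒≤ p))))) (top (suc i) z<s (s≤s (<⇒≤ p))))

    height-≤ : ∀ i → i < M → height I i ≤ M ∸ i
    height-≤ i p = least-lower (M ∸ i) (height? I i) (M ∸ i) (ends i p)

    height-holds : ∀ i → i < M → I (height I i + suc i) (suc i) ≤ suc i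
    height-holds i p = least-holds (M ∸ i) (height? I i) (ends i p)

    inside : ∀ i → i < M → height I i + suc i ≤ n
    inside i p = ≤-trans (+-monoˡ-≤ (suc i) (height-≤ i p)) (≤-reflexive
        (trans (+-suc (M ∸ i) i) (cong suc (m∸n+n≡m (<⇒≤ p)))))

    -- `hi` makes the heights weakly decreasing. `At21` excludes the zero sequence, which would
    -- belong to the table with `I j k = k`; this is the 1 subtracted from the Catalan number.
    heights-Sequence : At21 I → Sequence (heights I)
    heights-Sequence (_ , q) = Bounded-applyUpTo M M (height I) (height-≤ 0 z<s) height-≤ decreasing , positive₀
      where
      decreasing : ∀ i → suc i < M → height I (suc i) ≤ height I i
      decreasing i p with m≤n⇒m<n∨m≡n (inside i (<⇒≤ p))
      ... | inj₁ h< = least-lower (M ∸ suc i) (height? I (suc i)) (height I i)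
            (≤-trans (≤-reflexive (cong (λ j → I j (suc (suc i))) (+-suc (height I i) (suc i))))
              (≤-trans (hi (height I i + suc i) (suc i) z<s (m≤n+m (suc i) (height I i)) h<)
                  (s≤s (height-holds i (<⇒≤ p)))))
      ... | inj₂ h≡ = ≤-trans (height-≤ (suc i) p) (≤-trans (∸-monoʳ-≤ M (n≤1+n i)) (≤-reflexive (sym h)))
        where
        h : height I i ≡ M ∸ i
        h = trans (sym (m+n∸n≡m (height I i) (suc i))) (cong (_∸ suc i) h≡)
      positive₀ : 1 ≤ nth 0 (heights I) 0
      positive₀ = n≢0⇒n>0 λ e → <⇒≱ q (subst (λ h → I (h + 1) 1 ≤ 1) e (height-holds 0 z<s))

    staircase-heights : At21 I → staircase (heights I) ≈[ n ] I
    staircase-heights at@(p , q) j (suc i) a b c with m≤n⇒m<n∨m≡n c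
    ... | inj₂ refl = trans (IsTable.top (staircase-isTable (heights I) (heights-Sequence at)) (suc i) a b)
        (sym (top (suc i) a b))
    ... | inj₁ (s≤s j≤M) = compare (≤-<-connex s (j ∸ suc i))
      where
      i<M : i < M
      i<M = ≤-trans b j≤M
      s : ℕ
      s = height I i
      column : (j ∸ suc i) + suc i ≡ j
      column = m∸n+n≡m b
      compare : s ≤ j ∸ suc i ⊎ j ∸ suc i < s → staircase (heights I) j (suc i) ≡ I j (suc i)
      compare (inj₁ s≤c) = trans
        (staircase-out (heights I) j (suc i) (≤-trans (≤-reflexive (nth-heights I i i<M)) s≤c))
        (≤-antisym (lower T j (suc i) a b c) (≤-trans
          (subst (λ l → I l (suc i) ≤ I (s + suc i) (suc i)) reach
            (column-anti T ((j ∸ suc i) ∸ s) (s + suc i) (suc i) z<s (m≤n+m (suc i) s)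
                (≤-trans (≤-reflexive reach) c)))
          (height-holds i i<M)))
        where
        reach : s + suc i + ((j ∸ suc i) ∸ s) ≡ j
        reach = trans (+-assoc s (suc i) _) (trans (cong (λ t → s + t) (+-comm (suc i) _))
          (trans (sym (+-assoc s _ (suc i))) (trans (cong (_+ suc i) (m+[n∸m]≡n s≤c)) column)))
      compare (inj₂ c<s) = trans
        (staircase-in (heights I) j (suc i) (≤-trans c<s (≤-reflexive (sym (nth-heights I i i<M)))))
        (≤-antisym (≰⇒> λ h → <⇒≱ c<s (least-lower (M ∸ i) (height? I i) (j ∸ suc i)
            (subst (λ l → I l (suc i) ≤ suc i) (sym column) h)))
          (bound-from T 1 2 ≤-refl p j (suc i) a (s≤s b) c))

  heights-staircase : ∀ xs → Sequence xs → heights (staircase xs) ≡ xs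
  heights-staircase xs sq@(bd , _) = nth-ext 0 (heights (staircase xs)) xs
    (trans (length-applyUpTo (height (staircase xs)) M) (sym (Bounded-length bd)))
    λ i p → let i<M = subst (i <_) (length-applyUpTo (height (staircase xs)) M) p in
      trans (nth-heights (staircase xs) i i<M) (≤-antisym (below i) (above i i<M))
    where
    column : ∀ c i → (c + suc i) ∸ suc i ≡ c
    column c i = m+n∸n≡m c (suc i)
    below : ∀ i → height (staircase xs) i ≤ nth 0 xs i
    below i = least-lower (M ∸ i) (height? (staircase xs) i) (nth 0 xs i)
      (≤-reflexive (staircase-out xs (nth 0 xs i + suc i) (suc i) (≤-reflexive (sym (column (nth 0 xs i) i)))))
    above : ∀ i → i < M → nth 0 xs i ≤ height (staircase xs) i
    above i i<M = ≮⇒≥ λ h< → 1+n≰n (≤-trans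
      (≤-reflexive (sym (staircase-in xs (h + suc i) (suc i) (≤-trans (s≤s (≤-reflexive (column h i))) h<))))
      (height-holds (staircase-isTable xs sq) i i<M))
      where
      h : ℕ
      h = height (staircase xs) i

  heights-cong : ∀ {I I′} → I ≈[ n ] I′ → heights I ≡ heights I′
  heights-cong {I} {I′} e = applyUpTo-cong M λ i i<M → least-cong (M ∸ i) (height? I i) (height? I′ i)
    (λ c c< → subst (_≤ suc i) (same i c i<M c<)) (λ c c< → subst (_≤ suc i) (sym (same i c i<M c<)))
    where
    same : ∀ i c → i < M → c < M ∸ i → I (c + suc i) (suc i) ≡ I′ (c + suc i) (suc i)
    same i c i<M c< = e (c + suc i) (suc i) z<s (m≤n+m (suc i) c)
      (≤-trans (+-monoˡ-≤ (suc i) (<⇒≤ c<)) (≤-reflexive (trans (+-suc (M ∸ i) i) (cong suc (m∸n+n≡m (<⇒≤ i<M))))))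

  HasCard-21 : HasCard (AtTable n At21) (positive m M)
  HasCard-21 = HasCard-table {R = Sequence} n {P = At21} staircase heights staircase-isTable staircase-at21
    (λ I T p → heights-Sequence T p) heights-staircase (λ I T p → staircase-heights T p) (λ _ _ e → heights-cong e)
    (λ _ e (p , q) → subst (_≤ 2) (e 1 1 ≤-refl ≤-refl z<s) p , subst (1 <_) (e 1 1 ≤-refl ≤-refl z<s) q)
    (HasCard-positive m M)

-- Tables in which only the diagonal moves

trues : List Bool → ℕ
trues []           = 0
trues (true ∷ xs)  = suc (trues xs)
trues (false ∷ xs) = trues xs

HasCard-bits : ∀ r → HasCard (λ (xs : List Bool) → length xs ≡ r) (2 ^ r)
HasCard-bits zero    = HasCard-⇔ (λ { _ refl → refl }) (λ { [] _ → refl }) (HasCard-one [])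
HasCard-bits (suc r) = subst (HasCard (λ xs → length xs ≡ suc r))
    (cong (λ k → 2 ^ r + k) (sym (+-identityʳ (2 ^ r)))) (HasCard-⇔
  (λ { _ (inj₁ (_ , refl , e)) → cong suc e ; _ (inj₂ (_ , refl , e)) → cong suc e })
  (λ { [] () ; (true ∷ xs) e → inj₁ (xs , refl , suc-injective e) ; (false ∷ xs) e → inj₂
      (xs , refl , suc-injective e) })
  (HasCard-⊎ (λ { _ (_ , refl , _) (_ , () , _) }) (HasCard-Headed true (HasCard-bits r))
      (HasCard-Headed false (HasCard-bits r))))

mersenne : ℕ → ℕ
mersenne zero    = 0
mersenne (suc r) = 2 ^ r + mersenne r

mersenne+1 : ∀ r → mersenne r + 1 ≡ 2 ^ r
mersenne+1 zero    = refl
mersenne+1 (suc r) = trans (+-assoc (2 ^ r) (mersenne r) 1) (cong (λ k → 2 ^ r + k)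
    (trans (mersenne+1 r) (sym (+-identityʳ (2 ^ r)))))

HasCard-nonzero-bits : ∀ r → HasCard (λ xs → length xs ≡ r × 1 ≤ trues xs) (mersenne r)
HasCard-nonzero-bits zero    = HasCard-none λ { [] (_ , ()) ; (_ ∷ _) (() , _) }
HasCard-nonzero-bits (suc r) = HasCard-⇔
  (λ { _ (inj₁ (_ , refl , e)) → cong suc e , z<s ; _ (inj₂ (_ , refl , e , p)) → cong suc e , p })
  (λ { [] (() , _) ; (true ∷ xs) (e , _) → inj₁ (xs , refl , suc-injective e) ; (false ∷ xs) (e , p) → inj₂
      (xs , refl , suc-injective e , p) })
  (HasCard-⊎ (λ { _ (_ , refl , _) (_ , () , _) }) (HasCard-Headed true (HasCard-bits r))
      (HasCard-Headed false (HasCard-nonzero-bits r)))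

drop-nth : ∀ {A : Set} (d : A) xs i → i < length xs → drop i xs ≡ nth d xs i ∷ drop (suc i) xs
drop-nth d (x ∷ xs) zero    _       = refl
drop-nth d (x ∷ xs) (suc i) (s≤s p) = drop-nth d xs i p

drop-length : ∀ {A : Set} (xs : List A) → drop (length xs) xs ≡ []
drop-length []       = refl
drop-length (x ∷ xs) = drop-length xs

bit : Bool → ℕ
bit true  = 1
bit false = 0

trues-∷ : ∀ b xs → trues (b ∷ xs) ≡ bit b + trues xs
trues-∷ true  xs = refl
trues-∷ false xs = refl

-- Off the diagonal I j k = k; bit i of the code records whether I (i + 1) (i + 1) = I (i + 2) (i + 2).
module Diagonal (m : ℕ) where

  private
    M n : ℕ
    M = suc m
    n = suc M

  Code : List Bool → Set
  Code xs = length xs ≡ M × 1 ≤ trues xs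

  diagonal : List Bool → Table
  diagonal xs j k with j ≤? k
  ... | yes _ = k + trues (drop (k ∸ 1) xs)
  ... | no  _ = k

  diagonal-on : ∀ xs k → diagonal xs k k ≡ k + trues (drop (k ∸ 1) xs)
  diagonal-on xs k with k ≤? k
  ... | yes _ = refl
  ... | no ¬p = ⊥-elim (¬p ≤-refl)

  diagonal-off : ∀ xs j k → k < j → diagonal xs j k ≡ k
  diagonal-off xs j k p with j ≤? k
  ... | yes q = ⊥-elim (<⇒≱ p q)
  ... | no  _ = refl

  drop-suc : ∀ xs i → length xs ≡ M → i < M → trues (drop i xs) ≡ bit (nth false xs i) + trues (drop (suc i) xs)
  drop-suc xs i e p = trans (cong trues (drop-nth false xs i (subst (i <_) (sym e) p)))
      (trues-∷ (nth false xs i) (drop (suc i) xs))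

  bit≤1 : ∀ b → bit b ≤ 1
  bit≤1 true  = ≤-refl
  bit≤1 false = z≤n

  diagonal-isTable : ∀ xs → Code xs → IsTable n (diagonal xs)
  diagonal-isTable xs (len , _) = record
    { top  = tops
    ; anti = λ j k a b c → ≤-trans (≤-reflexive (diagonal-off xs (suc j) k (s≤s b))) (lower′ j k)
    ; lo   = λ j k a b c → proj₁ (both j k a b c (m≤n⇒m<n∨m≡n b))
    ; hi   = λ j k a b c → proj₂ (both j k a b c (m≤n⇒m<n∨m≡n b)) }
    where
    lower′ : ∀ j k → k ≤ diagonal xs j k
    lower′ j k with j ≤? k
    ... | yes _ = m≤m+n k _
    ... | no  _ = ≤-refl
    tops : ∀ k → 1 ≤ k → k ≤ n → diagonal xs n k ≡ k
    tops k a b with m≤n⇒m<n∨m≡n b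
    ... | inj₁ p    = diagonal-off xs n k p
    ... | inj₂ refl = trans (diagonal-on xs n) (trans (cong (λ l → n + trues l)
                        (trans (cong (λ i → drop i xs) (sym len)) (drop-length xs))) (+-identityʳ n))
    both : ∀ j k → 1 ≤ k → k ≤ j → j < n → k < j ⊎ k ≡ j →
      (diagonal xs j k ≤ diagonal xs (suc j) (suc k)) × (diagonal xs (suc j) (suc k) ≤ suc (diagonal xs j k))
    both j k a b c (inj₁ p) rewrite diagonal-off xs j k p | diagonal-off xs (suc j) (suc k) (s≤s p) = n≤1+n k , ≤-refl
    both _ (suc i) a b (s≤s c) (inj₂ refl) rewrite diagonal-on xs (suc i) | diagonal-on xs
        (suc (suc i)) | drop-suc xs i len c =
      s≤s (≤-trans (+-monoʳ-≤ i (+-monoˡ-≤ (trues (drop (suc i) xs)) (bit≤1 (nth false xs i))))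
        (≤-reflexive (+-suc i (trues (drop (suc i) xs)))))
      , s≤s (s≤s (+-monoʳ-≤ i (m≤n+m (trues (drop (suc i) xs)) (bit (nth false xs i)))))

  diagonal-at12 : ∀ xs → Code xs → At12 (diagonal xs)
  diagonal-at12 xs (_ , p) = ≤-reflexive (diagonal-off xs 2 1 ≤-refl) , ≤-trans (s≤s p)
      (≤-reflexive (sym (diagonal-on xs 1)))

  stays : Table → ℕ → Bool
  stays I i = isYes (I (suc i) (suc i) ≟ I (suc (suc i)) (suc (suc i)))

  code : Table → List Bool
  code I = applyUpTo (stays I) M

  isYes-≡ : ∀ {a b} → a ≡ b → isYes (a ≟ b) ≡ true
  isYes-≡ {a} {b} e with a ≟ b
  ... | yes _ = refl
  ... | no ¬e = ⊥-elim (¬e e)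

  isYes-≢ : ∀ {a b} → a ≢ b → isYes (a ≟ b) ≡ false
  isYes-≢ {a} {b} ¬e with a ≟ b
  ... | yes e = ⊥-elim (¬e e)
  ... | no  _ = refl

  code-cong : ∀ {I I′} → I ≈[ n ] I′ → code I ≡ code I′
  code-cong e = applyUpTo-cong M λ i p → cong₂ (λ a b → isYes (a ≟ b))
    (e (suc i) (suc i) z<s ≤-refl (m≤n⇒m≤1+n p)) (e (suc (suc i)) (suc (suc i)) z<s ≤-refl (s≤s p))

  code-diagonal : ∀ xs → Code xs → code (diagonal xs) ≡ xs
  code-diagonal xs (len , _) = nth-ext false (code (diagonal xs)) xs
      (trans (length-applyUpTo (stays (diagonal xs)) M) (sym len))
    λ i p → let i<M = subst (i <_) (length-applyUpTo (stays (diagonal xs)) M) p in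
      trans (nth-applyUpTo false (stays (diagonal xs)) M i i<M) (decide i i<M (nth false xs i) refl)
    where
    decide : ∀ i → i < M → ∀ b → nth false xs i ≡ b → stays (diagonal xs) i ≡ b
    decide i i<M b e = go b (trans (drop-suc xs i len i<M) (cong (λ b → bit b + trues (drop (suc i) xs)) e))
      where
      go : ∀ b → trues (drop i xs) ≡ bit b + trues (drop (suc i) xs) → stays (diagonal xs) i ≡ b
      go true  e = isYes-≡ (trans (diagonal-on xs (suc i)) (trans (cong (λ t → suc i + t) e)
        (trans (+-suc (suc i) _) (sym (diagonal-on xs (suc (suc i)))))))
      go false e = isYes-≢ λ same → 1+n≰n (≤-reflexive (sym (trans
          (sym (trans (diagonal-on xs (suc i)) (cong (λ t → suc i + t) e)))
        (trans same (diagonal-on xs (suc (suc i)))))))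

  module _ {I : Table} (T : IsTable n I) where
    open IsTable T

    -- Downward induction from `I n n = n`. The excess of `I k k` over `k` drops by one wherever the
    -- diagonal stays constant and is unchanged wherever it grows.
    diagonal-value : ∀ d i → i + d ≡ M → I (suc i) (suc i) ≡ suc i + trues (drop i (code I))
    diagonal-value zero    i e with refl ← trans (sym (+-identityʳ i)) e = trans (top n z<s ≤-refl)
      (trans (sym (+-identityʳ n)) (cong (λ l → n + trues l) (sym
          (trans (cong (λ k → drop k (code I)) (sym (length-applyUpTo (stays I) M))) (drop-length (code I))))))
    diagonal-value (suc d) i e = go (I (suc i) (suc i) ≟ I (suc (suc i)) (suc (suc i)))
      where
      i<M : i < M
      i<M = subst (suc i ≤_) e (≤-trans (s≤s (m≤m+n i d)) (≤-reflexive (sym (+-suc i d))))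
      rest : ℕ
      rest = trues (drop (suc i) (code I))
      next : I (suc (suc i)) (suc (suc i)) ≡ suc (suc i) + rest
      next = diagonal-value d (suc i) (trans (sym (+-suc i d)) e)
      unfold : ∀ {b} → stays I i ≡ b → trues (drop i (code I)) ≡ bit b + rest
      unfold e = trans (drop-suc (code I) i (length-applyUpTo (stays I) M) i<M)
        (cong (λ b → bit b + rest) (trans (nth-applyUpTo false (stays I) M i i<M) e))
      go : Dec (I (suc i) (suc i) ≡ I (suc (suc i)) (suc (suc i))) → I (suc i) (suc i) ≡ suc i + trues
          (drop i (code I))
      go (yes same) = trans same (trans next (trans (sym (+-suc (suc i) rest))
          (cong (λ t → suc i + t) (sym (unfold (isYes-≡ same))))))
      go (no differ) = trans (suc-injective (trans (≤-antisym (≤∧≢⇒< (lo (suc i) (suc i) z<s ≤-refl (s≤s i<M)) differ)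
                          (hi (suc i) (suc i) z<s ≤-refl (s≤s i<M))) next))
                        (cong (λ t → suc i + t) (sym (unfold (isYes-≢ differ))))

    code-Code : At12 I → Code (code I)
    code-Code (_ , q) = length-applyUpTo (stays I) M , ≤-pred (≤-trans q (≤-reflexive (diagonal-value M 0 refl)))

    diagonal-code : At12 I → diagonal (code I) ≈[ n ] I
    diagonal-code (p , _) j (suc i) a b c with m≤n⇒m<n∨m≡n b
    -- `I 2 1 ≤ 1` propagates along diagonals and columns and forces the minimum `k` everywhere off
    -- the diagonal.
    ... | inj₁ k<j  = trans (diagonal-off (code I) j (suc i) k<j) (≤-antisym (lower T j (suc i) a b c)
                        (bound-from T 2 1 z<s p j (suc i) a (s≤s k<j) c))
    ... | inj₂ refl with m≤n⇒m<n∨m≡n c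
    ...   | inj₁ (s≤s i<M) = trans (diagonal-on (code I) (suc i))
        (sym (diagonal-value (M ∸ i) i (m+[n∸m]≡n (<⇒≤ i<M))))
    ...   | inj₂ refl      = trans (diagonal-on (code I) n) (sym (diagonal-value 0 M (+-identityʳ M)))

  HasCard-12 : HasCard (AtTable n At12) (mersenne M)
  HasCard-12 = HasCard-table {R = Code} n {P = At12} diagonal code diagonal-isTable diagonal-at12
    (λ I T p → code-Code T p) code-diagonal (λ I T p → diagonal-code T p) (λ _ _ e → code-cong e)
    (λ _ e (p , q) → subst (_≤ 1) (e 2 1 ≤-refl z<s (s≤s z<s)) p , subst (1 <_) (e 1 1 ≤-refl ≤-refl z<s) q)
    (HasCard-nonzero-bits M)

-- In a 1 × 1 matrix the positions (2, 1) and (1, 2) are outside the matrix, where entry is 0.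
outside-row : ∀ (A : Matrix 1) → entry A 2 1 ≡ 0ℤ
outside-row (_ ∷ []) = refl

outside-column : ∀ (A : Matrix 1) → entry A 1 2 ≡ 0ℤ
outside-column ((_ ∷ []) ∷ []) = refl

theorem3p10 : (∀ n → 1 ≤ n → HasCard (MagogAt n 1 1) 1)
    × (∀ n → 2 ≤ n → Σ ℕ (λ k →
    HasCard (MagogAt n n 1) k × HasCard (MagogAt n n 2) k
    × HasCard (IsMagog (n ∸ 1)) k
    × (k * prodBelow (n ∸ 1) (λ j → (n ∸ 1 + j) !) ≡ prodBelow (n ∸ 1) (λ j → (3 * j + 1) !))))
    × (∀ n → 2 ≤ n → Σ ℕ (λ k → HasCard (MagogAt n 1 n) k × HasCard (MagogAt n 1 (n ∸ 1)) k))
    × (∀ n → 1 ≤ n → Σ ℕ (λ k → HasCard (MagogAt n 2 1) k × ((n + 1) * (k + 1) ≡ (2 * n) C n)))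
    × (∀ n → 1 ≤ n → Σ ℕ (λ k → HasCard (MagogAt n 1 2) k × (k + 1 ≡ 2 ^ (n ∸ 1))))
theorem3p10 = part₁ , part₂ , part₃ , part₄ , part₅
  where
  part₁ : ∀ n → 1 ≤ n → HasCard (MagogAt n 1 1) 1
  part₁ (suc m) _ = HasCard-11 m

  part₂ : ∀ n → 2 ≤ n → Σ ℕ (λ k → HasCard (MagogAt n n 1) k × HasCard (MagogAt n n 2) k × HasCard (IsMagog (n ∸ 1)) k
    × (k * prodBelow (n ∸ 1) (λ j → (n ∸ 1 + j) !) ≡ prodBelow (n ∸ 1) (λ j → (3 * j + 1) !)))
  part₂ (suc zero)    (s≤s ())
  part₂ (suc (suc m)) _ = length (walks m [])
    , HasCard-⇔ (λ A (M , p) → M , atₙ₁⇐ M p) (λ A (M , e) → M , atₙ₁⇒ M e) corner₁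
    , HasCard-⇔ (λ A (M , p) → M , atₙ₂⇐ M p) (λ A (M , e) → M , atₙ₂⇒ M e) (HasCard-n2 m corner₁)
    , HasCard-magog m , walks-formula m
    where
    corner₁ : HasCard (AtTable (suc (suc m)) (Atₙ₁ m)) (length (walks m []))
    corner₁ = HasCard-n1 m (HasCard-magog m)

  part₃ : ∀ n → 2 ≤ n → Σ ℕ (λ k → HasCard (MagogAt n 1 n) k × HasCard (MagogAt n 1 (n ∸ 1)) k)
  part₃ (suc zero)    (s≤s ())
  -- The common number has no closed form here: deciding the entry `(1, n)` in the finite list of
  -- magog matrices provides it, and the bijection transports it.
  part₃ (suc (suc m)) _ = _ , at₁ₙ
    , HasCard-⇔ (λ A (M , p) → M , at₁ₙ₋₁⇐ M p) (λ A (M , e) → M , at₁ₙ₋₁⇒ M e)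
        (HasCard-1n m (HasCard-⇔ (λ A (M , e) → M , at₁ₙ⇒ M e) (λ A (M , p) → M , at₁ₙ⇐ M p) at₁ₙ))
    where
    at₁ₙ : HasCard (MagogAt (suc (suc m)) 1 (suc (suc m))) _
    at₁ₙ = proj₂ (HasCard-filter (λ A → entry A 1 (suc (suc m)) ℤ.≟ 1ℤ) (HasCard-magog (suc m)))

  part₄ : ∀ n → 1 ≤ n → Σ ℕ (λ k → HasCard (MagogAt n 2 1) k × ((n + 1) * (k + 1) ≡ (2 * n) C n))
  part₄ (suc zero)    _ = 0 , HasCard-none (λ A (_ , e) → contradiction (trans (sym (outside-row A)) e) λ ()) , refl
  -- `k + 1` is `ballot (suc m) (suc m)`: the zero sequence is counted again.
  part₄ (suc (suc m)) _ = positive m (suc m)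
    , HasCard-⇔ (λ A (M , p) → M , at21⇐ M p) (λ A (M , e) → M , at21⇒ M e) (Staircase.HasCard-21 m)
    , (begin
      (suc (suc m) + 1) * (positive m (suc m) + 1)  ≡⟨ cong₂ _*_ (+-comm (suc (suc m)) 1)
          (+-comm (positive m (suc m)) 1) ⟩
      suc (suc (suc m)) * ballot (suc m) (suc m)    ≡⟨ catalan (suc m) ⟩
      (suc (suc m) + suc (suc m)) C suc (suc m)     ≡⟨ cong (λ k → (suc (suc m) + k) C suc (suc m))
          (+-identityʳ (suc (suc m))) ⟨
      (2 * suc (suc m)) C suc (suc m)               ∎)
    where open ≡-Reasoning

  part₅ : ∀ n → 1 ≤ n → Σ ℕ (λ k → HasCard (MagogAt n 1 2) k × (k + 1 ≡ 2 ^ (n ∸ 1)))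
  part₅ (suc zero)    _ = 0 , HasCard-none (λ A (_ , e) → contradiction (trans (sym (outside-column A)) e) λ
      ()) , refl
  part₅ (suc (suc m)) _ = mersenne (suc m)
    , HasCard-⇔ (λ A (M , p) → M , at12⇐ M p) (λ A (M , e) → M , at12⇒ M e) (Diagonal.HasCard-12 m)
    , mersenne+1 (suc m)
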